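{- Let $q$ be a prime power, $k\ge 1$, and let $m,n\ge 0$ be integers. Then $$P_k(m;n)=\sum_{0\le d\le\min\{m,n\}}N_k(m-d)N_k(n-d)A_k(d),$$ where $$A_k(d)=\sum_{h\in\mathcal N_k(d)}\mu(h)=\sum_{\substack{a_1,\dots,a_d\ge 0\\ 1a_1+2a_2+\cdots+da_d=d}}(-1)^{a_1+\cdots+a_d}\binom{I_k(1)}{a_1}\cdots\binom{I_k(d)}{a_d}.$$
   Context: $\mathbb F_q$ is the finite field with $q$ elements. Two polynomials in $\mathbb F_q[x_1,\dots,x_k]$ are identified if they differ by a factor in $\mathbb F_q^\times$; the classes are called normalized polynomials. For an integer $m\ge 0$, $\mathcal N_k(m)$ is the set of normalized (nonzero) polynomials in $\mathbb F_q[x_1,\dots,x_k]$ of total degree $m$, $N_k(m)=|\mathcal N_k(m)|$, and $I_k(m)$ is the number of irreducible elements of $\mathcal N_k(m)$. $P_k(m;n)=|\{(f,g)\in\mathcal N_k(m)\times\mathcal N_k(n):\gcd(f,g)=1\}|$. The Möbius function $\mu$ on nonzero normalized polynomials is $\mu(h)=(-1)^s$ if $h$ is a product of $s$ distinct irreducibles, and $\mu(h)=0$ if $h$ is divisible by the square of an irreducible. -}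

module Defs where

open import Level using (Level; _⊔_)
open import Algebra.Bundles.Raw using (RawRing)
open import Algebra.Apartness.Bundles using (HeytingField)
import Algebra.Apartness.Properties.HeytingCommutativeRing as HCR
import Algebra.Definitions.RawSemiring as RawSemiringDefinitions
open import Data.Fin.Base using (Fin; toℕ)
open import Data.Integer.Base as ℤ using (ℤ; 0ℤ; -1ℤ; +_)
import Data.Integer.Properties as ℤ
open import Data.List.Base as List using (List; []; _∷_; upTo; cartesianProductWith; filter)
open import Data.List.Relation.Unary.All using (All)
open import Data.List.Relation.Unary.AllPairs using (AllPairs)
open import Data.Nat.Base as ℕ using (ℕ; zero; suc; _≤_; _<_)
open import Data.Nat.Combinatorics using (_C_)
open import Data.Nat.Primality using (Prime)
import Data.Nat.Properties as ℕ
open import Data.Product using (Σ-syntax; ∃-syntax; _×_; _,_; proj₁; proj₂)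
open import Data.Product.Relation.Binary.Pointwise.NonDependent using (_×ₛ_)
open import Data.Vec.Base using (Vec; []; _∷_; lookup; sum)
open import Function.Bundles using (Func; Inverse)
open import Relation.Binary.Bundles using (Setoid)
import Relation.Binary.Construct.On as On
import Relation.Binary.Reasoning.Setoid as ≈-Reasoning
open import Relation.Binary.PropositionalEquality using (_≡_; setoid)
open import Relation.Nullary using (¬_)

import Algebra.Properties.Semiring.Sum ℕ.+-*-semiring as ℕ-Sum
import Algebra.Properties.Semiring.Sum ℤ.+-*-semiring as ℤ-Sum
import Algebra.Properties.CommutativeMonoid.Sum ℕ.*-1-commutativeMonoid as ℕ-Product

private
  variable
    c ℓ ℓ₁ ℓ₂ : Level

IsPrimePower : ℕ → Set
IsPrimePower q = ∃[ p ] ∃[ e ] Prime p × 1 ≤ e × q ≡ p ℕ.^ e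

HasCardinality : Setoid c ℓ → ℕ → Set (c ⊔ ℓ)
HasCardinality S n = Inverse (setoid (Fin n)) S

-- A polynomial a₀ + a₁ x + ⋯ + aₙ xⁿ is the list a₀ ∷ a₁ ∷ ⋯ ∷ aₙ ∷ [].
-- Trailing zeros are allowed; _≈ᵖ_ compares all coefficients.
module Univariate (R : RawRing c ℓ) where
  open RawRing R

  coeff₁ : List Carrier → ℕ → Carrier
  coeff₁ []      _       = 0#
  coeff₁ (a ∷ f) zero    = a
  coeff₁ (a ∷ f) (suc i) = coeff₁ f i

  _≈ᵖ_ : List Carrier → List Carrier → Set ℓ
  f ≈ᵖ g = ∀ i → coeff₁ f i ≈ coeff₁ g i

  _+ᵖ_ : List Carrier → List Carrier → List Carrier
  []      +ᵖ g       = g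
  (a ∷ f) +ᵖ []      = a ∷ f
  (a ∷ f) +ᵖ (b ∷ g) = (a + b) ∷ (f +ᵖ g)

  -- (a + x f) g = a g + x (f g)
  _*ᵖ_ : List Carrier → List Carrier → List Carrier
  []      *ᵖ g = []
  (a ∷ f) *ᵖ g = List.map (a *_) g +ᵖ (0# ∷ (f *ᵖ g))

  polynomialRing : RawRing c ℓ
  polynomialRing = record
    { Carrier = List Carrier
    ; _≈_     = _≈ᵖ_
    ; _+_     = _+ᵖ_
    ; _*_     = _*ᵖ_
    ; -_      = List.map (-_)
    ; 0#      = []
    ; 1#      = 1# ∷ []
    }

-- R [x₁ , … , xₖ], built by adjoining one variable at a time.
multivariateRing : RawRing c ℓ → ℕ → RawRing c ℓ
multivariateRing R zero    = R
multivariateRing R (suc k) = Univariate.polynomialRing (multivariateRing R k)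

module Polynomials (F : HeytingField c ℓ₁ ℓ₂) (k : ℕ) where

  private
    module F where
      open HeytingField F public
      open HCR heytingCommutativeRing public

  rawField : RawRing c ℓ₁
  rawField = record
    { Carrier = F.Carrier
    ; _≈_     = F._≈_
    ; _+_     = F._+_
    ; _*_     = F._*_
    ; -_      = F.-_
    ; 0#      = F.0#
    ; 1#      = F.1#
    }

  Poly : RawRing c ℓ₁
  Poly = multivariateRing rawField k

  open RawRing Poly using (Carrier; _≈_; _≉_; _*_; 0#; 1#; rawSemiring)
  open RawSemiringDefinitions rawSemiring public using (_∣_; Irreducible)

  coeff : Carrier → Vec ℕ k → F.Carrier
  coeff = go k
    where
    go : ∀ j → RawRing.Carrier (multivariateRing rawField j) → Vec ℕ j → F.Carrier
    go zero    a []      = a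
    go (suc j) f (i ∷ α) = go j (Univariate.coeff₁ (multivariateRing rawField j) f i) α

  record HasTotalDegree (f : Carrier) (m : ℕ) : Set ℓ₁ where
    field
      attained : ∃[ α ] sum α ≡ m × ¬ (coeff f α F.≈ F.0#)
      bounded  : ∀ α → m < sum α → coeff f α F.≈ F.0#

  record IsGCD (f g d : Carrier) : Set (c ⊔ ℓ₁) where
    field
      commonDivisor : d ∣ f × d ∣ g
      greatest      : ∀ {e} → e ∣ f × e ∣ g → e ∣ d

  -- f ∼ g says that g = a f for some a in F^×, compared coefficient by
  -- coefficient. In a Heyting field a # 0# means that a is invertible.
  infix 4 _∼_
  _∼_ : Carrier → Carrier → Set (c ⊔ ℓ₁ ⊔ ℓ₂)
  f ∼ g = ∃[ a ] a F.# F.0# × (∀ α → a F.* coeff f α F.≈ coeff g α)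

  ∼-refl : ∀ {f} → f ∼ f
  ∼-refl = F.1# , F.1#0 , λ α → F.*-identityˡ _

  ∼-sym : ∀ {f g} → f ∼ g → g ∼ f
  ∼-sym {f} {g} (a , a#0 , af≈g) with F.#⇒invertible a#0
  ... | b , b[a-0]≈1 , [a-0]b≈1 = b , b#0 , bg≈f
    where
    open ≈-Reasoning F.setoid

    ba≈1 : b F.* a F.≈ F.1#
    ba≈1 = F.trans (F.*-congˡ (F.sym (F.x-0≈x a))) b[a-0]≈1

    b#0 : b F.# F.0#
    b#0 = F.invertibleʳ⇒# (a , F.trans (F.*-congʳ (F.x-0≈x b)) ba≈1)

    bg≈f : ∀ α → b F.* coeff g α F.≈ coeff f α
    bg≈f α = begin
      b F.* coeff g α          ≈⟨ F.*-congˡ (af≈g α) ⟨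
      b F.* (a F.* coeff f α)  ≈⟨ F.*-assoc b a _ ⟨
      (b F.* a) F.* coeff f α  ≈⟨ F.*-congʳ ba≈1 ⟩
      F.1# F.* coeff f α       ≈⟨ F.*-identityˡ _ ⟩
      coeff f α                ∎

  ∼-trans : ∀ {f g h} → f ∼ g → g ∼ h → f ∼ h
  ∼-trans (a , a#0 , af≈g) (b , b#0 , bg≈h) =
    b F.* a , F.x#0y#0→xy#0 b#0 a#0 ,
    λ α → F.trans (F.*-assoc b a _) (F.trans (F.*-congˡ (af≈g α)) (bg≈h α))

  Normalized : Setoid (c ⊔ ℓ₁) (c ⊔ ℓ₁ ⊔ ℓ₂)
  Normalized = record
    { Carrier       = Σ[ f ∈ Carrier ] f ≉ 0#
    ; _≈_           = λ f g → proj₁ f ∼ proj₁ g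
    ; isEquivalence = record
      { refl  = λ {f} → ∼-refl {proj₁ f}
      ; sym   = λ {f} {g} → ∼-sym {proj₁ f} {proj₁ g}
      ; trans = λ {f} {g} {h} → ∼-trans {proj₁ f} {proj₁ g} {proj₁ h}
      }
    }

  NormalizedPoly : Set (c ⊔ ℓ₁)
  NormalizedPoly = Setoid.Carrier Normalized

  𝒩 : ℕ → Setoid (c ⊔ ℓ₁) (c ⊔ ℓ₁ ⊔ ℓ₂)
  𝒩 m = On.setoid {B = Σ[ h ∈ NormalizedPoly ] HasTotalDegree (proj₁ h) m} Normalized proj₁

  polynomial : ∀ {m} → Setoid.Carrier (𝒩 m) → Carrier
  polynomial ((f , _) , _) = f

  Irreducibles : ℕ → Setoid (c ⊔ ℓ₁) (c ⊔ ℓ₁ ⊔ ℓ₂)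
  Irreducibles m =
    On.setoid {B = Σ[ h ∈ Setoid.Carrier (𝒩 m) ] Irreducible (polynomial h)} (𝒩 m) proj₁

  CoprimePairs : ℕ → ℕ → Setoid (c ⊔ ℓ₁) (c ⊔ ℓ₁ ⊔ ℓ₂)
  CoprimePairs m n =
    On.setoid
      {B = Σ[ fg ∈ Setoid.Carrier (𝒩 m) × Setoid.Carrier (𝒩 n) ]
             IsGCD (polynomial (proj₁ fg)) (polynomial (proj₂ fg)) 1#}
      (𝒩 m ×ₛ 𝒩 n) proj₁

  record IsMöbius (μ : NormalizedPoly → ℤ) : Set (c ⊔ ℓ₁ ⊔ ℓ₂) where
    field
      squarefree : ∀ h (ps : List Carrier) →
                   All Irreducible ps → AllPairs (λ p r → ¬ (p ∼ r)) ps →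
                   proj₁ h ∼ List.foldr _*_ 1# ps →
                   μ h ≡ -1ℤ ℤ.^ List.length ps
      square     : ∀ h p → Irreducible p → (p * p) ∣ proj₁ h → μ h ≡ 0ℤ

  -- The counting functions and the Möbius function, each determined by
  -- its specification: the cardinality of a setoid is unique, and by
  -- unique factorization so is μ. An inhabitant of this record exists
  -- exactly because the sets in question are finite and μ is well defined.
  record Counting : Set (c ⊔ ℓ₁ ⊔ ℓ₂) where
    field
      N : ℕ → ℕ
      I : ℕ → ℕ
      P : ℕ → ℕ → ℕ
      μ : Func Normalized (setoid ℤ)

      N-counts   : ∀ m → HasCardinality (𝒩 m) (N m)
      I-counts   : ∀ m → HasCardinality (Irreducibles m) (I m)
      P-counts   : ∀ m n → HasCardinality (CoprimePairs m n) (P m n)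
      μ-isMöbius : IsMöbius (Func.to μ)

    -- The sum of μ h over h in 𝒩 d; as μ respects _∼_, it does not depend
    -- on the enumeration of 𝒩 d.
    A : ℕ → ℤ
    A d = ℤ-Sum.sum (λ i → Func.to μ (proj₁ (Inverse.to (N-counts d) i)))

-- The entry at position i stands for a_(i+1).
weight : ∀ {d} → Vec ℕ d → ℕ
weight a = ℕ-Sum.sum (λ i → suc (toℕ i) ℕ.* lookup a i)

boundedVectors : ∀ b n → List (Vec ℕ n)
boundedVectors b zero    = [] ∷ []
boundedVectors b (suc n) = cartesianProductWith _∷_ (upTo (suc b)) (boundedVectors b n)

-- All (a₁ , … , a_d) with 1 a₁ + 2 a₂ + ⋯ + d a_d = d; each entry of such a
-- vector is at most d.
solutions : ∀ d → List (Vec ℕ d)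
solutions d = filter (λ a → weight a ℕ.≟ d) (boundedVectors d d)

binomialTerm : (ℕ → ℕ) → ∀ {d} → Vec ℕ d → ℤ
binomialTerm I a =
  -1ℤ ℤ.^ sum a ℤ.* + ℕ-Product.sum (λ i → I (suc (toℕ i)) C lookup a i)

binomialSum : (ℕ → ℕ) → ℕ → ℤ
binomialSum I d = List.foldr ℤ._+_ 0ℤ (List.map (binomialTerm I) (solutions d))

{-# OPTIONS --safe #-}
-- All counting takes place in F [x₁ , … , xₖ] up to associates. This ring is
-- factorial: Gauss's lemma is proved by pseudo-division, one variable at a
-- time, and everything else is decidable because there are only finitely
-- many polynomials of bounded degree.
--
-- Both formulas rest on one cancellation. Let p be irreducible of degree e
-- and X a property that does not change under x ↦ p x when p ∤ x. Writing
-- the multiples of p as p y, the sum of μ over the elements of X of degree d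
-- becomes G d - G (d - e), where G sums over the elements of X prime to p.
-- If X x says that x divides f and g, and p is a common prime factor of f
-- and g, then summing over d gives 0; so the sum of μ over the common
-- divisors of f and g is 1 or 0 according to whether f and g are coprime.
-- If X x says that no prime of a given list divides x, then removing the
-- primes one by one shows that Σ A d t^d is the product of (1 - t^(deg p))
-- over all p.
module Submission where

open import Level as Level using (Level)
open import Algebra.Apartness.Bundles using (HeytingField; HeytingCommutativeRing)
import Algebra.Apartness.Properties.HeytingCommutativeRing as HCR
open import Algebra.Bundles using (CommutativeRing)
open import Algebra.Bundles.Raw using (RawRing)
open import Algebra.Definitions.RawMagma using (_,_; module _∣ʳ_)
import Algebra.Definitions.RawMagma as RawMagmaDefinitions
import Algebra.Definitions.RawSemiring as RawSemiringDefinitions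
import Algebra.Properties.AbelianGroup as AbelianGroupProperties
import Algebra.Properties.CommutativeSemigroup as CommutativeSemigroupProperties
import Algebra.Properties.CommutativeSemigroup.Divisibility as CommutativeDivisibility
import Algebra.Properties.Group as GroupProperties
import Algebra.Properties.Ring as RingProperties
import Algebra.Properties.Semiring.Divisibility as SemiringDivisibility
import Algebra.Properties.Semiring.Exp as Exp
import Algebra.Properties.Semiring.Primality as Primality
open import Algebra.Properties.Semiring.Sum using (sum⁺-syntax)
open import Algebra.Structures using (IsCommutativeRing)
open import Data.Bool.Base using (if_then_else_)
open import Data.Empty using (⊥-elim)
open import Data.Fin.Base as Fin using (Fin; toℕ)
import Data.Fin.Properties as Fin
open import Data.Integer.Base as ℤ using (ℤ; 0ℤ; 1ℤ; -1ℤ; +_)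
import Data.Integer.Properties as ℤ
open import Data.List.Base as List using (List; []; _∷_; applyUpTo; cartesianProductWith)
import Data.List.Properties as List
open import Data.List.Membership.Propositional.Properties using (∈-lookup)
open import Data.List.Relation.Unary.All as All using (All; []; _∷_)
import Data.List.Relation.Unary.All.Properties as All
open import Data.List.Relation.Unary.AllPairs as AllPairs using (AllPairs; []; _∷_)
import Data.List.Relation.Unary.AllPairs.Properties as AllPairs
open import Data.List.Relation.Unary.Any as Any using (Any; here; there)
import Data.List.Relation.Unary.Any.Properties as Any
open import Data.Nat.Base as ℕ using (ℕ; zero; suc; pred; _≤_; _<_; _⊔_; _⊓_; _∸_; s≤s; z≤n)
open import Data.Nat.Combinatorics using (_C_; nCk+nC[k+1]≡[n+1]C[k+1]; k>n⇒nCk≡0)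
open import Data.Nat.Induction using (<-wellFounded; Acc; acc)
import Data.Nat.Properties as ℕ
open import Data.Product using (_×_; _,_; proj₁; proj₂; ∃-syntax; Σ-syntax)
open import Data.Product.Relation.Binary.Pointwise.NonDependent using (_×ₛ_)
open import Data.Sum.Base as Sum using (_⊎_; inj₁; inj₂)
open import Data.Vec.Base as Vec using (Vec; []; _∷_; lookup)
open import Function.Base using (_∘_; id)
open import Function.Bundles using (Func; Inverse)
open import Relation.Binary.Bundles using (Setoid)
import Relation.Binary.Construct.On as On
open import Relation.Binary.Core using (Rel)
import Relation.Binary.Definitions as Binary
open import Relation.Binary.Definitions using (tri<; tri≈; tri>)
open import Relation.Binary.PropositionalEquality as ≡ using (_≡_; module ≡-Reasoning)
import Relation.Binary.Reasoning.Setoid as ≈-Reasoning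
open import Relation.Nullary using (¬_; Dec; yes; no; does)
import Relation.Nullary.Decidable as Dec
open import Relation.Unary using (Pred; Decidable)
open import Defs

-- The usual proof of Gauss's lemma passes to the field of fractions. Here every identity over that
-- field is instead multiplied by a non-zero constant, and an irreducible polynomial that is not
-- constant in the new variable lets such a constant be cancelled again, because every prime factor
-- of the constant stays prime in R [x]. The induction on the number of variables carries a total
-- degree, a finite list of the elements of each bounded degree, and the primality of irreducibles.
-- It works up to mutual divisibility `∥`, which agrees with `∼` on non-zero polynomials because the
-- units are the non-zero constants. The theorem asks for one `Counting` and for the formulas in
-- every `Counting`. The formulas are therefore proved for arbitrary representatives of the classes
-- of each degree, and sums over different index sets are compared through relations instead of
-- explicit bijections. Power series are compared only up to a given degree, so that finitely many
-- irreducibles suffice at a time.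

private
  variable
    c ℓ ℓ′ ℓ₁ ℓ₂ r : Level

-- Polynomial rings

IsCommutativeRawRing : RawRing c ℓ → Set _
IsCommutativeRawRing R = IsCommutativeRing _≈_ _+_ _*_ -_ 0# 1#
  where open RawRing R

toCommutativeRing : (R : RawRing c ℓ) → IsCommutativeRawRing R → CommutativeRing c ℓ
toCommutativeRing R isCR = record { isCommutativeRing = isCR }

module PolynomialRing (R : RawRing c ℓ) (isCR : IsCommutativeRawRing R) where
  open CommutativeRing (toCommutativeRing R isCR)
  open Univariate R
  open RingProperties ring using (-0#≈0#)
  open CommutativeSemigroupProperties +-commutativeSemigroup using (x∙yz≈y∙xz; interchange)

  infixr 21 _·_
  _·_ : Carrier → List Carrier → List Carrier
  a · f = List.map (a *_) f

  coeff-+ : ∀ f g i → coeff₁ (f +ᵖ g) i ≈ coeff₁ f i + coeff₁ g i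
  coeff-+ []      g       i       = sym (+-identityˡ _)
  coeff-+ (a ∷ f) []      i       = sym (+-identityʳ _)
  coeff-+ (a ∷ f) (b ∷ g) zero    = refl
  coeff-+ (a ∷ f) (b ∷ g) (suc i) = coeff-+ f g i

  coeff-· : ∀ a f i → coeff₁ (a · f) i ≈ a * coeff₁ f i
  coeff-· a []      i       = sym (zeroʳ a)
  coeff-· a (b ∷ f) zero    = refl
  coeff-· a (b ∷ f) (suc i) = coeff-· a f i

  coeff-neg : ∀ f i → coeff₁ (List.map (-_) f) i ≈ - coeff₁ f i
  coeff-neg []      i       = sym -0#≈0#
  coeff-neg (a ∷ f) zero    = refl
  coeff-neg (a ∷ f) (suc i) = coeff-neg f i

  -- A record, so that f and g can be inferred from a proof.
  infix 4 _≋_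
  record _≋_ (f g : List Carrier) : Set ℓ where
    constructor mk≋
    field at : f ≈ᵖ g
  open _≋_ public

  polySetoid : Setoid c ℓ
  polySetoid = record
    { Carrier = List Carrier
    ; _≈_ = _≋_
    ; isEquivalence = record
      { refl  = mk≋ λ i → refl
      ; sym   = λ p → mk≋ λ i → sym (at p i)
      ; trans = λ p q → mk≋ λ i → trans (at p i) (at q i)
      }
    }

  open Setoid polySetoid public using () renaming (refl to ≋-refl; sym to ≋-sym; trans to ≋-trans)
  open ≈-Reasoning polySetoid

  ∷-cong : ∀ {a b f g} → a ≈ b → f ≋ g → a ∷ f ≋ b ∷ g
  at (∷-cong a≈b f≋g) zero    = a≈b
  at (∷-cong a≈b f≋g) (suc i) = at f≋g i

  0∷[]≋[] : 0# ∷ [] ≋ []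
  at 0∷[]≋[] zero    = refl
  at 0∷[]≋[] (suc i) = refl

  +-cong′ : ∀ {f f′ g g′} → f ≋ f′ → g ≋ g′ → f +ᵖ g ≋ f′ +ᵖ g′
  at (+-cong′ {f} {f′} {g} {g′} p q) i =
    trans (coeff-+ f g i) (trans (+-cong (at p i) (at q i)) (sym (coeff-+ f′ g′ i)))

  ·-cong : ∀ {a b f g} → a ≈ b → f ≋ g → a · f ≋ b · g
  at (·-cong {a} {b} {f} {g} p q) i =
    trans (coeff-· a f i) (trans (*-cong p (at q i)) (sym (coeff-· b g i)))

  +-comm′ : ∀ f g → f +ᵖ g ≋ g +ᵖ f
  at (+-comm′ f g) i = trans (coeff-+ f g i) (trans (+-comm _ _) (sym (coeff-+ g f i)))

  +-assoc′ : ∀ f g h → (f +ᵖ g) +ᵖ h ≋ f +ᵖ (g +ᵖ h)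
  at (+-assoc′ f g h) i =
    trans (coeff-+ (f +ᵖ g) h i) (trans (+-congʳ (coeff-+ f g i)) (trans (+-assoc _ _ _)
      (sym (trans (coeff-+ f (g +ᵖ h) i) (+-congˡ (coeff-+ g h i))))))

  +-identityʳ′ : ∀ f → f +ᵖ [] ≋ f
  at (+-identityʳ′ f) i = trans (coeff-+ f [] i) (+-identityʳ _)

  neg-inverseʳ : ∀ f → f +ᵖ List.map (-_) f ≋ []
  at (neg-inverseʳ f) i =
    trans (coeff-+ f _ i) (trans (+-congˡ (coeff-neg f i)) (-‿inverseʳ _))

  neg-cong : ∀ {f g} → f ≋ g → List.map (-_) f ≋ List.map (-_) g
  at (neg-cong {f} {g} p) i = trans (coeff-neg f i) (trans (-‿cong (at p i)) (sym (coeff-neg g i)))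

  +-interchange : ∀ f g h k → (f +ᵖ g) +ᵖ (h +ᵖ k) ≋ (f +ᵖ h) +ᵖ (g +ᵖ k)
  at (+-interchange f g h k) i = trans (sums f g h k) (trans (interchange _ _ _ _) (sym (sums f h g k)))
    where
    sums : ∀ f g h k → coeff₁ ((f +ᵖ g) +ᵖ (h +ᵖ k)) i ≈
                        (coeff₁ f i + coeff₁ g i) + (coeff₁ h i + coeff₁ k i)
    sums f g h k = trans (coeff-+ (f +ᵖ g) (h +ᵖ k) i) (+-cong (coeff-+ f g i) (coeff-+ h k i))

  +-swap : ∀ f g h → f +ᵖ (g +ᵖ h) ≋ g +ᵖ (f +ᵖ h)
  +-swap f g h = begin
    f +ᵖ (g +ᵖ h)  ≈⟨ +-assoc′ f g h ⟨
    (f +ᵖ g) +ᵖ h  ≈⟨ +-cong′ (+-comm′ f g) ≋-refl ⟩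
    (g +ᵖ f) +ᵖ h  ≈⟨ +-assoc′ g f h ⟩
    g +ᵖ (f +ᵖ h)  ∎

  ·-distribʳ : ∀ a b f → (a + b) · f ≋ a · f +ᵖ b · f
  at (·-distribʳ a b f) i = trans (coeff-· (a + b) f i) (trans (distribʳ _ a b)
    (sym (trans (coeff-+ (a · f) _ i) (+-cong (coeff-· a f i) (coeff-· b f i)))))

  ·-distribˡ : ∀ a f g → a · (f +ᵖ g) ≋ a · f +ᵖ a · g
  at (·-distribˡ a f g) i = trans (coeff-· a (f +ᵖ g) i) (trans (*-congˡ (coeff-+ f g i))
    (trans (distribˡ a _ _)
      (sym (trans (coeff-+ (a · f) _ i) (+-cong (coeff-· a f i) (coeff-· a g i))))))

  ·-assoc : ∀ a b f → (a * b) · f ≋ a · (b · f)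
  at (·-assoc a b f) i = trans (coeff-· (a * b) f i) (trans (*-assoc a b _)
    (sym (trans (coeff-· a (b · f) i) (*-congˡ (coeff-· b f i)))))

  0·f≋[] : ∀ f → 0# · f ≋ []
  at (0·f≋[] f) i = trans (coeff-· 0# f i) (zeroˡ _)

  1·f≋f : ∀ f → 1# · f ≋ f
  at (1·f≋f f) i = trans (coeff-· 1# f i) (*-identityˡ _)

  *-congˡ′ : ∀ f {g h} → g ≋ h → f *ᵖ g ≋ f *ᵖ h
  *-congˡ′ []      p = ≋-refl
  *-congˡ′ (a ∷ f) p = +-cong′ (·-cong refl p) (∷-cong refl (*-congˡ′ f p))

  *-zeroʳ : ∀ f → f *ᵖ [] ≋ []
  *-zeroʳ []      = ≋-refl
  *-zeroʳ (a ∷ f) = ≋-trans (∷-cong refl (*-zeroʳ f)) 0∷[]≋[]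

  -- `_*ᵖ_` recurses on its first argument. This is the mirrored recursion, which the induction for
  -- commutativity needs.
  *-∷ʳ : ∀ f b g → f *ᵖ (b ∷ g) ≋ b · f +ᵖ (0# ∷ (f *ᵖ g))
  *-∷ʳ []      b g = ≋-sym 0∷[]≋[]
  *-∷ʳ (a ∷ f) b g = ∷-cong (+-congʳ (*-comm a b)) (begin
    a · g +ᵖ (f *ᵖ (b ∷ g))                ≈⟨ +-cong′ ≋-refl (*-∷ʳ f b g) ⟩
    a · g +ᵖ (b · f +ᵖ (0# ∷ (f *ᵖ g)))     ≈⟨ +-swap (a · g) (b · f) _ ⟩
    b · f +ᵖ (a · g +ᵖ (0# ∷ (f *ᵖ g)))     ∎)

  *-comm′ : ∀ f g → f *ᵖ g ≋ g *ᵖ f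
  *-comm′ []      g = ≋-sym (*-zeroʳ g)
  *-comm′ (a ∷ f) g = begin
    a · g +ᵖ (0# ∷ (f *ᵖ g))  ≈⟨ +-cong′ ≋-refl (∷-cong refl (*-comm′ f g)) ⟩
    a · g +ᵖ (0# ∷ (g *ᵖ f))  ≈⟨ *-∷ʳ g a f ⟨
    g *ᵖ (a ∷ f)              ∎

  -- The left factor is replaced by way of commutativity: equal polynomials may be lists of
  -- different lengths, which makes a direct recursion on f and f′ awkward.
  *-cong′ : ∀ {f f′ g g′} → f ≋ f′ → g ≋ g′ → f *ᵖ g ≋ f′ *ᵖ g′
  *-cong′ {f} {f′} {g} {g′} p q = begin
    f *ᵖ g    ≈⟨ *-congˡ′ f q ⟩
    f *ᵖ g′   ≈⟨ *-comm′ f g′ ⟩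
    g′ *ᵖ f   ≈⟨ *-congˡ′ g′ p ⟩
    g′ *ᵖ f′  ≈⟨ *-comm′ g′ f′ ⟩
    f′ *ᵖ g′  ∎

  0∷-+ : ∀ f g → 0# ∷ (f +ᵖ g) ≋ (0# ∷ f) +ᵖ (0# ∷ g)
  0∷-+ f g = ∷-cong (sym (+-identityˡ 0#)) ≋-refl

  *-distribʳ′ : ∀ h f g → (f +ᵖ g) *ᵖ h ≋ (f *ᵖ h) +ᵖ (g *ᵖ h)
  *-distribʳ′ h []      g       = ≋-refl
  *-distribʳ′ h (a ∷ f) []      = ≋-sym (+-identityʳ′ _)
  *-distribʳ′ h (a ∷ f) (b ∷ g) = begin
    (a + b) · h +ᵖ (0# ∷ ((f +ᵖ g) *ᵖ h))
      ≈⟨ +-cong′ (·-distribʳ a b h) (∷-cong refl (*-distribʳ′ h f g)) ⟩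
    (a · h +ᵖ b · h) +ᵖ (0# ∷ ((f *ᵖ h) +ᵖ (g *ᵖ h)))
      ≈⟨ +-cong′ (≋-refl {a · h +ᵖ b · h}) (0∷-+ (f *ᵖ h) (g *ᵖ h)) ⟩
    (a · h +ᵖ b · h) +ᵖ ((0# ∷ (f *ᵖ h)) +ᵖ (0# ∷ (g *ᵖ h)))
      ≈⟨ +-interchange (a · h) (b · h) _ _ ⟩
    ((a ∷ f) *ᵖ h) +ᵖ ((b ∷ g) *ᵖ h) ∎

  ·-* : ∀ a f g → (a · f) *ᵖ g ≋ a · (f *ᵖ g)
  ·-* a []      g = ≋-refl
  ·-* a (b ∷ f) g = begin
    (a * b) · g +ᵖ (0# ∷ ((a · f) *ᵖ g))      ≈⟨ +-cong′ (·-assoc a b g) (∷-cong (sym (zeroʳ a)) (·-* a f g)) ⟩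
    a · (b · g) +ᵖ a · (0# ∷ (f *ᵖ g))        ≈⟨ ·-distribˡ a (b · g) _ ⟨
    a · ((b ∷ f) *ᵖ g)                        ∎

  0∷-* : ∀ f g → (0# ∷ f) *ᵖ g ≋ 0# ∷ (f *ᵖ g)
  0∷-* f g = +-cong′ (0·f≋[] g) ≋-refl

  *-assoc′ : ∀ f g h → (f *ᵖ g) *ᵖ h ≋ f *ᵖ (g *ᵖ h)
  *-assoc′ []      g h = ≋-refl
  *-assoc′ (a ∷ f) g h = begin
    (a · g +ᵖ (0# ∷ (f *ᵖ g))) *ᵖ h              ≈⟨ *-distribʳ′ h (a · g) _ ⟩
    ((a · g) *ᵖ h) +ᵖ ((0# ∷ (f *ᵖ g)) *ᵖ h)     ≈⟨ +-cong′ (·-* a g h) (0∷-* (f *ᵖ g) h) ⟩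
    a · (g *ᵖ h) +ᵖ (0# ∷ ((f *ᵖ g) *ᵖ h))       ≈⟨ +-cong′ ≋-refl (∷-cong refl (*-assoc′ f g h)) ⟩
    (a ∷ f) *ᵖ (g *ᵖ h)                          ∎

  const-* : ∀ a f → (a ∷ []) *ᵖ f ≋ a · f
  const-* a f = ≋-trans (+-cong′ ≋-refl 0∷[]≋[]) (+-identityʳ′ _)

  *-identityˡ′ : ∀ f → (1# ∷ []) *ᵖ f ≋ f
  *-identityˡ′ f = ≋-trans (const-* 1# f) (1·f≋f f)

  *-distribˡ′ : ∀ f g h → f *ᵖ (g +ᵖ h) ≋ (f *ᵖ g) +ᵖ (f *ᵖ h)
  *-distribˡ′ f g h = begin
    f *ᵖ (g +ᵖ h)           ≈⟨ *-comm′ f _ ⟩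
    (g +ᵖ h) *ᵖ f           ≈⟨ *-distribʳ′ f g h ⟩
    (g *ᵖ f) +ᵖ (h *ᵖ f)    ≈⟨ +-cong′ (*-comm′ g f) (*-comm′ h f) ⟩
    (f *ᵖ g) +ᵖ (f *ᵖ h)    ∎

  ≋-rawRing : RawRing c ℓ
  ≋-rawRing = record
    { Carrier = List Carrier
    ; _≈_     = _≋_
    ; _+_     = _+ᵖ_
    ; _*_     = _*ᵖ_
    ; -_      = List.map (-_)
    ; 0#      = []
    ; 1#      = 1# ∷ []
    }

  ≋-isCommutativeRing : IsCommutativeRawRing ≋-rawRing
  ≋-isCommutativeRing = record
    { isRing = record
      { +-isAbelianGroup = record
        { isGroup = record
          { isMonoid = record
            { isSemigroup = record
              { isMagma = record
                { isEquivalence = Setoid.isEquivalence polySetoid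
                ; ∙-cong = +-cong′
                }
              ; assoc = +-assoc′
              }
            ; identity = (λ f → ≋-refl) , +-identityʳ′
            }
          ; inverse = (λ f → ≋-trans (+-comm′ _ f) (neg-inverseʳ f)) , neg-inverseʳ
          ; ⁻¹-cong = neg-cong
          }
        ; comm = +-comm′
        }
      ; *-cong = *-cong′
      ; *-assoc = *-assoc′
      ; *-identity = *-identityˡ′ , λ f → ≋-trans (*-comm′ f _) (*-identityˡ′ f)
      ; distrib = *-distribˡ′ , *-distribʳ′
      }
    ; *-comm = *-comm′
    }

-- Factorial domains with a degree

-- size f is 0 for f = 0 and 1 + (total degree of f) otherwise.
record IsSizedDomain (R : RawRing c ℓ) : Set (c Level.⊔ ℓ) where
  open RawRing R
  open RawSemiringDefinitions rawSemiring using (_∣_)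
  field
    isCommutativeRawRing : IsCommutativeRawRing R
    1≉0       : 1# ≉ 0#
    size      : Carrier → ℕ
    size-cong : ∀ {x y} → x ≈ y → size x ≡ size y
    size-0    : size 0# ≡ 0
    size⁻¹-0  : ∀ {x} → size x ≡ 0 → x ≈ 0#
    size-+    : ∀ x y → size (x + y) ≤ size x ⊔ size y
    size-*    : ∀ {x y} → x ≉ 0# → y ≉ 0# → suc (size (x * y)) ≡ size x ℕ.+ size y
    size-1⇒∣1 : ∀ {x} → size x ≡ 1 → x ∣ 1#
    finite    : ∀ n → ∃[ xs ] ∀ x → size x ≤ n → Any (x ≈_) xs

record IsSizedUFD (R : RawRing c ℓ) : Set (c Level.⊔ ℓ) where
  open RawRing R
  open RawSemiringDefinitions rawSemiring using (_∣_; Irreducible)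
  field
    isSizedDomain : IsSizedDomain R
    prime : ∀ {p x y} → Irreducible p → p ∣ x * y → p ∣ x ⊎ p ∣ y
  open IsSizedDomain isSizedDomain public

module _ (R : RawRing c ℓ) (_≈′_ : Rel (RawRing.Carrier R) ℓ′)
         (to : ∀ {x y} → RawRing._≈_ R x y → x ≈′ y)
         (from : ∀ {x y} → x ≈′ y → RawRing._≈_ R x y) where

  changeEquality : RawRing c ℓ′
  changeEquality = record
    { Carrier = Carrier ; _≈_ = _≈′_ ; _+_ = _+_ ; _*_ = _*_ ; -_ = -_ ; 0# = 0# ; 1# = 1# }
    where open RawRing R

  private
    module D  = RawSemiringDefinitions (RawRing.rawSemiring R)
    module D′ = RawSemiringDefinitions (RawRing.rawSemiring changeEquality)

    ∣-to : ∀ {x y} → x D.∣ y → x D′.∣ y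
    ∣-to (q , eq) = q , to eq

    ∣-from : ∀ {x y} → x D′.∣ y → x D.∣ y
    ∣-from (q , eq) = q , from eq

  -- The proofs use the record `_≋_`, whereas `Poly` is built with `_≈ᵖ_`. The two are equivalent
  -- but distinct types, so the structure has to be carried across at each adjunction of a variable.
  changeEquality-isSizedUFD : IsSizedUFD R → IsSizedUFD changeEquality
  changeEquality-isSizedUFD ufd = record { isSizedDomain = record
    { isCommutativeRawRing = record
      { isRing = record
        { +-isAbelianGroup = record
          { isGroup = record
            { isMonoid = record
              { isSemigroup = record
                { isMagma = record
                  { isEquivalence = record
                    { refl  = to refl
                    ; sym   = λ p → to (sym (from p))
                    ; trans = λ p q → to (trans (from p) (from q))
                    }
                  ; ∙-cong = λ p q → to (+-cong (from p) (from q))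
                  }
                ; assoc = λ x y z → to (+-assoc x y z)
                }
              ; identity = (λ x → to (+-identityˡ x)) , λ x → to (+-identityʳ x)
              }
            ; inverse = (λ x → to (-‿inverseˡ x)) , λ x → to (-‿inverseʳ x)
            ; ⁻¹-cong = λ p → to (-‿cong (from p))
            }
          ; comm = λ x y → to (+-comm x y)
          }
        ; *-cong = λ p q → to (*-cong (from p) (from q))
        ; *-assoc = λ x y z → to (*-assoc x y z)
        ; *-identity = (λ x → to (*-identityˡ x)) , λ x → to (*-identityʳ x)
        ; distrib = (λ x y z → to (distribˡ x y z)) , λ x y z → to (distribʳ x y z)
        }
      ; *-comm = λ x y → to (*-comm x y)
      }
    ; 1≉0       = λ p → 1≉0 (from p)
    ; size      = size
    ; size-cong = λ p → size-cong (from p)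
    ; size-0    = size-0
    ; size⁻¹-0  = λ p → to (size⁻¹-0 p)
    ; size-+    = size-+
    ; size-*    = λ x≉0 y≉0 → size-* (λ p → x≉0 (to p)) (λ p → y≉0 (to p))
    ; size-1⇒∣1 = λ p → ∣-to (size-1⇒∣1 p)
    ; finite    = λ n → proj₁ (finite n) , λ x p → Any.map to (proj₂ (finite n) x p)
    } ; prime     = λ p∣xy p-irr → Sum.map ∣-to ∣-to (prime (irr-from p∣xy) (∣-from p-irr))
    }
    where
    open IsSizedUFD ufd
    open CommutativeRing (toCommutativeRing R isCommutativeRawRing)

    irr-from : ∀ {p} → D′.Irreducible p → D.Irreducible p
    irr-from (D′.mkIrred p∤1 split) = D.mkIrred (λ p∣1 → p∤1 (∣-to p∣1))
      (λ eq → Sum.map ∣-from ∣-from (split (to eq)))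

module SubadditiveSize (R : CommutativeRing c ℓ) (size : CommutativeRing.Carrier R → ℕ)
  (size-cong : ∀ {x y} → CommutativeRing._≈_ R x y → size x ≡ size y)
  (size-+ : ∀ x y → size (CommutativeRing._+_ R x y) ≤ size x ⊔ size y)
  (size-neg : ∀ x → size (CommutativeRing.-_ R x) ≡ size x) where
  open CommutativeRing R

  -- Since y = (x + y) - x, a sum smaller than y would bound `size y` by two smaller numbers. The
  -- module assumes only subadditivity because this is used to show that `sizeᵖ` is multiplicative,
  -- before R [x] is known to be a sized domain.
  size-+-< : ∀ {x y} → size x < size y → size (x + y) ≡ size y
  size-+-< {x} {y} sx<sy = ℕ.≤-antisym
    (ℕ.≤-trans (size-+ x y) (ℕ.⊔-lub (ℕ.<⇒≤ sx<sy) ℕ.≤-refl))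
    (ℕ.≮⇒≥ λ sxy<sy → ℕ.<⇒≱ (ℕ.⊔-lub sxy<sy (≡.subst (_< size y) (≡.sym (size-neg x)) sx<sy))
      (≡.subst (_≤ size (x + y) ⊔ size (- x)) (size-cong y≈) (size-+ (x + y) (- x))))
    where
    open ≈-Reasoning setoid
    y≈ : (x + y) - x ≈ y
    y≈ = begin
      (x + y) - x    ≈⟨ +-congʳ (+-comm x y) ⟩
      (y + x) - x    ≈⟨ +-assoc y x (- x) ⟩
      y + (x - x)    ≈⟨ +-congˡ (-‿inverseʳ x) ⟩
      y + 0#         ≈⟨ +-identityʳ y ⟩
      y              ∎

module SizedDomain (R : RawRing c ℓ) (isSizedDomain : IsSizedDomain R) where
  open IsSizedDomain isSizedDomain public

  commutativeRing : CommutativeRing c ℓ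
  commutativeRing = toCommutativeRing R isCommutativeRawRing

  open CommutativeRing commutativeRing public hiding (0#; 1#; _≉_; zero)
  open RawRing R public using (0#; 1#; _≉_; rawSemiring)
  open RawSemiringDefinitions rawSemiring public using (_∣_; _∤_; Irreducible; mkIrred)
  open RawMagmaDefinitions *-rawMagma public using (_∥_)
  open Irreducible public
  open RingProperties ring public
    using (-‿involutive; -0#≈0#; -1*x≈-x; x[y-z]≈xy-xz; [y-z]x≈yx-zx)
  open GroupProperties +-group public
    using () renaming (x∙y⁻¹≈ε⇒x≈y to x-y≈0⇒x≈y; x≈y⇒x∙y⁻¹≈ε to x≈y⇒x-y≈0)
  open AbelianGroupProperties +-abelianGroup public using (xyx⁻¹≈y)
  open SemiringDivisibility semiring public
    using (x∣yx; x∣ʳy⇒x∣ʳzy; ∥-refl; ∥-reflexive; ∥-sym; ∥-trans; ∣ʳ-refl; ∣ʳ-trans; ∣ʳ-respʳ-≈; ∣ʳ-respˡ-≈)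
    renaming (ε∣ʳ_ to 1∣_)
  open CommutativeDivisibility *-commutativeSemigroup public
    using (x∣xy; x∣y⇒zx∣zy; ∙-cong-∣)
  open CommutativeSemigroupProperties *-commutativeSemigroup public
    using (x∙yz≈y∙xz; x∙yz≈z∙xy; x∙yz≈y∙zx)
  open ≈-Reasoning setoid using (begin_; step-≈-⟩; step-≈-⟨; _∎)

  irreducible⇒≉0 : ∀ {p} → Irreducible p → p ≉ 0#
  irreducible⇒≉0 = Primality.Irreducible⇒≉0 semiring (1≉0 ∘ sym)

  _≟0 : ∀ x → Dec (x ≈ 0#)
  x ≟0 = Dec.map′ size⁻¹-0 (λ x≈0 → ≡.trans (size-cong x≈0) size-0) (size x ℕ.≟ 0)

  _≟_ : ∀ x y → Dec (x ≈ y)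
  x ≟ y = Dec.map′ (x-y≈0⇒x≈y x y) (x≈y⇒x-y≈0 {x} {y}) ((x - y) ≟0)

  ≉0⇒size>0 : ∀ {x} → x ≉ 0# → 0 < size x
  ≉0⇒size>0 x≉0 = ℕ.n≢0⇒n>0 (x≉0 ∘ size⁻¹-0)

  size>0⇒≉0 : ∀ {x} → 0 < size x → x ≉ 0#
  size>0⇒≉0 0<s x≈0 = ℕ.<⇒≢ 0<s (≡.sym (≡.trans (size-cong x≈0) size-0))

  *-≉0 : ∀ {x y} → x ≉ 0# → y ≉ 0# → x * y ≉ 0#
  *-≉0 {x} {y} x≉0 y≉0 = size>0⇒≉0 (ℕ.s≤s⁻¹ (begin′
    2                    ≤⟨ ℕ.+-mono-≤ (≉0⇒size>0 x≉0) (≉0⇒size>0 y≉0) ⟩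
    size x ℕ.+ size y    ≡⟨ size-* x≉0 y≉0 ⟨
    suc (size (x * y))   ∎′))
    where open ℕ.≤-Reasoning renaming (begin_ to begin′_; _∎ to _∎′)

  *≉0⇒≉0ˡ : ∀ {x y} → x * y ≉ 0# → x ≉ 0#
  *≉0⇒≉0ˡ {x} {y} xy≉0 x≈0 = xy≉0 (trans (*-congʳ x≈0) (zeroˡ y))

  *≉0⇒≉0ʳ : ∀ {x y} → x * y ≉ 0# → y ≉ 0#
  *≉0⇒≉0ʳ {x} {y} xy≉0 y≈0 = xy≉0 (trans (*-congˡ y≈0) (zeroʳ x))

  integral : ∀ {x y} → x ≉ 0# → x * y ≈ 0# → y ≈ 0#
  integral {x} {y} x≉0 xy≈0 with y ≟0
  ... | yes y≈0 = y≈0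
  ... | no  y≉0 = ⊥-elim (*-≉0 x≉0 y≉0 xy≈0)

  *-cancelˡ : ∀ {x y z} → x ≉ 0# → x * y ≈ x * z → y ≈ z
  *-cancelˡ {x} {y} {z} x≉0 xy≈xz = x-y≈0⇒x≈y y z (integral x≉0 (begin
    x * (y - z)          ≈⟨ x[y-z]≈xy-xz x y z ⟩
    x * y - x * z        ≈⟨ x≈y⇒x-y≈0 xy≈xz ⟩
    0#                   ∎))

  ∣-cancelˡ : ∀ {x y z} → x ≉ 0# → x * y ∣ x * z → y ∣ z
  ∣-cancelˡ {x} {y} x≉0 (q , eq) = q , *-cancelˡ x≉0 (trans (x∙yz≈y∙xz x q y) eq)

  ∣-≉0 : ∀ {x y} → x ∣ y → y ≉ 0# → x ≉ 0#
  ∣-≉0 (q , eq) y≉0 = *≉0⇒≉0ʳ λ qx≈0 → y≉0 (trans (sym eq) qx≈0)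

  ∣-+ : ∀ {x y z} → x ∣ y → x ∣ z → x ∣ y + z
  ∣-+ {x} (q , qx≈y) (r , rx≈z) = q + r , trans (distribʳ x q r) (+-cong qx≈y rx≈z)

  ∣-+-cancelˡ : ∀ {x y z} → x ∣ y → x ∣ y + z → x ∣ z
  ∣-+-cancelˡ {x} {y} {z} (q , qx≈y) (r , rx≈y+z) = r - q , (begin
    (r - q) * x        ≈⟨ [y-z]x≈yx-zx x r q ⟩
    r * x - q * x      ≈⟨ +-cong rx≈y+z (-‿cong qx≈y) ⟩
    (y + z) - y        ≈⟨ xyx⁻¹≈y y z ⟩
    z                  ∎)

  size-1 : size 1# ≡ 1
  size-1 = ℕ.+-cancelʳ-≡ (size 1#) _ _
    (≡.trans (≡.sym (size-* 1≉0 1≉0)) (≡.cong suc (size-cong (*-identityˡ 1#))))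

  ∣⇒size≤ : ∀ {x y} → y ≉ 0# → x ∣ y → size x ≤ size y
  ∣⇒size≤ {x} {y} y≉0 (q , qx≈y) = ℕ.s≤s⁻¹ (begin′
    suc (size x)        ≤⟨ ℕ.+-monoˡ-≤ (size x) (≉0⇒size>0 (*≉0⇒≉0ˡ qx≉0)) ⟩
    size q ℕ.+ size x   ≡⟨ size-* (*≉0⇒≉0ˡ qx≉0) (*≉0⇒≉0ʳ qx≉0) ⟨
    suc (size (q * x))  ≡⟨ ≡.cong suc (size-cong qx≈y) ⟩
    suc (size y)        ∎′)
    where
    open ℕ.≤-Reasoning renaming (begin_ to begin′_; _∎ to _∎′)
    qx≉0 : q * x ≉ 0#
    qx≉0 qx≈0 = y≉0 (trans (sym qx≈y) qx≈0)

  ∣1⇒size≡1 : ∀ {x} → x ∣ 1# → size x ≡ 1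
  ∣1⇒size≡1 {x} x∣1 = ℕ.≤-antisym (≡.subst (size x ≤_) size-1 (∣⇒size≤ 1≉0 x∣1))
                                  (≉0⇒size>0 (∣-≉0 x∣1 1≉0))

  ∥⇒size≡ : ∀ {x y} → x ≉ 0# → x ∥ y → size x ≡ size y
  ∥⇒size≡ x≉0 (x∣y , y∣x) = ℕ.≤-antisym (∣⇒size≤ (∣-≉0 y∣x x≉0) x∣y) (∣⇒size≤ x≉0 y∣x)

  size-neg : ∀ x → size (- x) ≡ size x
  size-neg x with x ≟0
  ... | yes x≈0 = size-cong (trans (-‿cong x≈0) (trans -0#≈0# (sym x≈0)))
  ... | no  x≉0 = ≡.sym (∥⇒size≡ x≉0 ((- 1# , -1*x≈-x x) , (- 1# , trans (-1*x≈-x (- x)) (-‿involutive x))))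

  open SubadditiveSize commutativeRing size size-cong size-+ size-neg public

  -- Divisibility, reducibility and the existence of a common factor are all decided by this search:
  -- their witnesses divide a fixed non-zero element, so their sizes are bounded.
  find : ∀ {p} {P : Pred Carrier p} n → (∀ {x y} → x ≈ y → P x → P y) → (∀ x → P x → size x ≤ n) →
         (∀ x → Dec (P x)) → Dec (∃[ x ] P x)
  find n resp bounded P? with finite n
  ... | xs , complete = Dec.map′ Any.satisfied
    (λ (x , px) → Any.map (λ x≈y → resp x≈y px) (complete x (bounded x px))) (Any.any? P? xs)

  infix 4 _∣?_
  _∣?_ : ∀ x y → Dec (x ∣ y)
  x ∣? y with y ≟0
  ... | yes y≈0 = yes (0# , trans (zeroˡ x) (sym y≈0))
  ... | no  y≉0 = Dec.map′ (λ (q , eq) → q , eq) (λ (q , eq) → q , eq)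
    (find (size y) (λ q≈r eq → trans (*-congʳ (sym q≈r)) eq)
      (λ q eq → ∣⇒size≤ y≉0 (x , trans (*-comm x q) eq)) (λ q → (q * x) ≟ y))

  Reducible : Carrier → Set (c Level.⊔ ℓ)
  Reducible x = ∃[ a ] ∃[ b ] (a * b ≈ x × a ∤ 1# × b ∤ 1#)

  reducible? : ∀ {x} → x ≉ 0# → Dec (Reducible x)
  reducible? {x} x≉0 =
    find (size x) (λ { a≈a′ (b , eq , a∤1 , b∤1) → b , trans (*-congʳ (sym a≈a′)) eq ,
                       a∤1 ∘ ∣ʳ-respˡ-≈ (sym a≈a′) , b∤1 })
      (λ { a (b , eq , _) → ∣⇒size≤ x≉0 (b , trans (*-comm b a) eq) })
      λ a → find (size x) (λ { b≈b′ (eq , a∤1 , b∤1) → trans (*-congˡ (sym b≈b′)) eq ,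
                       a∤1 , b∤1 ∘ ∣ʳ-respˡ-≈ (sym b≈b′) })
      (λ { b (eq , _) → ∣⇒size≤ x≉0 (a , eq) })
      λ b → ((a * b) ≟ x) Dec.×-dec (Dec.¬? (a ∣? 1#) Dec.×-dec Dec.¬? (b ∣? 1#))

  ¬reducible⇒irreducible : ∀ {x} → x ∤ 1# → ¬ Reducible x → Irreducible x
  ¬reducible⇒irreducible {x} x∤1 ¬red = mkIrred x∤1 split
    where
    split : ∀ {a b} → x ≈ a * b → a ∣ 1# ⊎ b ∣ 1#
    split {a} {b} eq with a ∣? 1# | b ∣? 1#
    ... | yes a∣1 | _       = inj₁ a∣1
    ... | no  _   | yes b∣1 = inj₂ b∣1
    ... | no  a∤1 | no  b∤1 = ⊥-elim (¬red (a , b , sym eq , a∤1 , b∤1))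

  irreducible⇒¬reducible : ∀ {x} → Irreducible x → ¬ Reducible x
  irreducible⇒¬reducible irr (a , b , eq , a∤1 , b∤1) = Sum.[ a∤1 , b∤1 ] (split-∣1 irr (sym eq))

  irreducible? : ∀ x → Dec (Irreducible x)
  irreducible? x with x ≟0 | x ∣? 1#
  ... | yes x≈0 | _       = no λ irr → irreducible⇒≉0 irr x≈0
  ... | no  _   | yes x∣1 = no λ irr → p∤1 irr x∣1
  ... | no  x≉0 | no  x∤1 =
    Dec.map′ (¬reducible⇒irreducible x∤1) irreducible⇒¬reducible (Dec.¬? (reducible? x≉0))

  product : List Carrier → Carrier
  product = List.foldr _*_ 1#

  product-++ : ∀ xs ys → product xs * product ys ≈ product (xs List.++ ys)
  product-++ []       ys = *-identityˡ _
  product-++ (x ∷ xs) ys = trans (*-assoc x _ _) (*-congˡ (product-++ xs ys))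

  *-cong-∥ : ∀ {a b x y} → a ∥ b → x ∥ y → a * x ∥ b * y
  *-cong-∥ (a∣b , b∣a) (x∣y , y∣x) = ∙-cong-∣ a∣b x∣y , ∙-cong-∣ b∣a y∣x

  ∤1⇒size>1 : ∀ {x} → x ≉ 0# → x ∤ 1# → 1 < size x
  ∤1⇒size>1 x≉0 x∤1 = ℕ.≤∧≢⇒< (≉0⇒size>0 x≉0) (x∤1 ∘ size-1⇒∣1 ∘ ≡.sym)

  factor : ∀ {x} → x ≉ 0# → ∃[ ps ] (All Irreducible ps × x ∥ product ps)
  factor {x} = go (<-wellFounded (size x))
    where
    go : ∀ {x} → Acc _<_ (size x) → x ≉ 0# → ∃[ ps ] (All Irreducible ps × x ∥ product ps)
    go {x} (acc rec) x≉0 with x ∣? 1# | reducible? x≉0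
    ... | yes x∣1 | _       = [] , [] , x∣1 , (x , *-identityʳ x)
    ... | no  x∤1 | no ¬red = x ∷ [] , ¬reducible⇒irreducible x∤1 ¬red ∷ [] ,
      ∥-reflexive (sym (*-identityʳ x))
    ... | no  x∤1 | yes (a , b , ab≈x , a∤1 , b∤1) =
      ps List.++ qs , All.++⁺ irr-ps irr-qs ,
        ∥-trans (∥-reflexive (sym ab≈x)) (∥-trans (*-cong-∥ a∥ b∥) (∥-reflexive (product-++ ps qs)))
      where
      ab≉0 : a * b ≉ 0#
      ab≉0 ab≈0 = x≉0 (trans (sym ab≈x) ab≈0)
      a≉0 = *≉0⇒≉0ˡ ab≉0
      b≉0 = *≉0⇒≉0ʳ ab≉0
      -- A non-unit has size at least 2, so this equation makes both factors strictly smaller than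
      -- x.
      sizes : suc (size x) ≡ size a ℕ.+ size b
      sizes = ≡.trans (≡.cong suc (size-cong (sym ab≈x))) (size-* a≉0 b≉0)
      a< : size a < size x
      a< = ℕ.s≤s⁻¹ (≡.subst₂ _≤_ (ℕ.+-comm (size a) 2 ) (≡.sym sizes) (ℕ.+-monoʳ-≤ (size a) (∤1⇒size>1 b≉0 b∤1)))
      b< : size b < size x
      b< = ℕ.s≤s⁻¹ (≡.subst (2 ℕ.+ size b ≤_) (≡.sym sizes) (ℕ.+-monoˡ-≤ (size b) (∤1⇒size>1 a≉0 a∤1)))
      fa = go (rec a<) a≉0
      fb = go (rec b<) b≉0
      ps = proj₁ fa
      qs = proj₁ fb
      irr-ps = proj₁ (proj₂ fa)
      irr-qs = proj₁ (proj₂ fb)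
      a∥ = proj₂ (proj₂ fa)
      b∥ = proj₂ (proj₂ fb)

  irreducible-∣-irreducible : ∀ {p q} → Irreducible p → Irreducible q → p ∣ q → p ∥ q
  irreducible-∣-irreducible {p} {q} irr-p irr-q p∣q@(r , rp≈q) with split-∣1 irr-q (sym rp≈q)
  ... | inj₂ p∣1         = ⊥-elim (p∤1 irr-p p∣1)
  ... | inj₁ (s , sr≈1)  = p∣q , (s , (begin
    s * q        ≈⟨ *-congˡ rp≈q ⟨
    s * (r * p)  ≈⟨ *-assoc s r p ⟨
    (s * r) * p  ≈⟨ *-congʳ sr≈1 ⟩
    1# * p       ≈⟨ *-identityˡ p ⟩
    p            ∎))

  irreducible-respects-∥ : ∀ {p q} → p ∥ q → Irreducible p → Irreducible q
  irreducible-respects-∥ {p} {q} (p∣q , (r , rq≈p)) irr-p = mkIrred (p∤1 irr-p ∘ ∣ʳ-trans p∣q) split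
    where
    p≉0 = irreducible⇒≉0 irr-p
    split : ∀ {x y} → q ≈ x * y → x ∣ 1# ⊎ y ∣ 1#
    split {x} {y} q≈xy = Sum.map₁ (∣ʳ-trans (r , refl))
      (split-∣1 irr-p (trans (sym rq≈p) (trans (*-congˡ q≈xy) (sym (*-assoc r x y)))))

-- The degree on R [x]

module PolynomialSize (R : RawRing c ℓ) (isDomain : IsSizedDomain R) where
  open SizedDomain R isDomain
  open Univariate R
  open PolynomialRing R isCommutativeRawRing

  -- The effect on sizes of multiplying by the new variable. The degree grows by one, but the zero
  -- polynomial keeps size 0; hence this is not `suc`.
  shift : ℕ → ℕ
  shift zero    = zero
  shift (suc n) = suc (suc n)

  shift-mono : ∀ {m n} → m ≤ n → shift m ≤ shift n
  shift-mono {zero}  {n}     m≤n = z≤n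
  shift-mono {suc m} {suc n} m≤n = s≤s m≤n

  shift-⊔ : ∀ m n → shift (m ⊔ n) ≡ shift m ⊔ shift n
  shift-⊔ zero    n       = ≡.refl
  shift-⊔ (suc m) zero    = ≡.refl
  shift-⊔ (suc m) (suc n) = ≡.refl

  shift≤suc : ∀ n → shift n ≤ suc n
  shift≤suc zero    = z≤n
  shift≤suc (suc n) = ℕ.≤-refl

  shift>0⇒>0 : ∀ {m n} → m < shift n → 0 < n
  shift>0⇒>0 {n = suc n} _ = s≤s z≤n

  shift≤suc⇒≤ : ∀ {m n} → shift m ≤ suc n → m ≤ n
  shift≤suc⇒≤ {zero}  _ = z≤n
  shift≤suc⇒≤ {suc m} p = ℕ.s≤s⁻¹ p

  sizeᵖ : List Carrier → ℕ
  sizeᵖ []      = 0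
  sizeᵖ (a ∷ f) = size a ⊔ shift (sizeᵖ f)

  sizeᵖ-zero : ∀ {f} → f ≋ [] → sizeᵖ f ≡ 0
  sizeᵖ-zero {[]}    p = ≡.refl
  sizeᵖ-zero {a ∷ f} p = ≡.cong₂ (λ m n → m ⊔ shift n)
    (≡.trans (size-cong (at p 0)) size-0) (sizeᵖ-zero {f} (mk≋ λ i → at p (suc i)))

  sizeᵖ-cong : ∀ {f g} → f ≋ g → sizeᵖ f ≡ sizeᵖ g
  sizeᵖ-cong {[]}    {g}     p = ≡.sym (sizeᵖ-zero (≋-sym p))
  sizeᵖ-cong {a ∷ f} {[]}    p = sizeᵖ-zero p
  sizeᵖ-cong {a ∷ f} {b ∷ g} p = ≡.cong₂ (λ m n → m ⊔ shift n)
    (size-cong (at p 0)) (sizeᵖ-cong {f} {g} (mk≋ λ i → at p (suc i)))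

  sizeᵖ⁻¹-zero : ∀ {f} → sizeᵖ f ≡ 0 → f ≋ []
  sizeᵖ⁻¹-zero {[]}    p = ≋-refl
  sizeᵖ⁻¹-zero {a ∷ f} p = ≋-trans
    (∷-cong (size⁻¹-0 (ℕ.n≤0⇒n≡0 (ℕ.≤-trans (ℕ.m≤m⊔n _ _) (ℕ.≤-reflexive p))))
            (sizeᵖ⁻¹-zero (ℕ.n≤0⇒n≡0
              (shift≤suc⇒≤ (ℕ.m≤n⇒m≤1+n (ℕ.≤-trans (ℕ.m≤n⊔m (size a) _) (ℕ.≤-reflexive p)))))))
    0∷[]≋[]

  sizeᵖ-+ : ∀ f g → sizeᵖ (f +ᵖ g) ≤ sizeᵖ f ⊔ sizeᵖ g
  sizeᵖ-+ []      g       = ℕ.≤-refl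
  sizeᵖ-+ (a ∷ f) []      = ℕ.m≤m⊔n _ _
  sizeᵖ-+ (a ∷ f) (b ∷ g) = ℕ.⊔-lub
    (ℕ.≤-trans (size-+ a b) (ℕ.⊔-mono-≤ (ℕ.m≤m⊔n (size a) _) (ℕ.m≤m⊔n (size b) _)))
    (ℕ.≤-trans (shift-mono (sizeᵖ-+ f g))
      (ℕ.≤-trans (ℕ.≤-reflexive (shift-⊔ (sizeᵖ f) (sizeᵖ g)))
        (ℕ.⊔-mono-≤ (ℕ.m≤n⊔m (size a) (shift (sizeᵖ f))) (ℕ.m≤n⊔m (size b) (shift (sizeᵖ g))))))

  sizeᵖ-neg : ∀ f → sizeᵖ (List.map (-_) f) ≡ sizeᵖ f
  sizeᵖ-neg []      = ≡.refl
  sizeᵖ-neg (a ∷ f) = ≡.cong₂ (λ m n → m ⊔ shift n) (size-neg a) (sizeᵖ-neg f)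

  open SubadditiveSize (toCommutativeRing ≋-rawRing ≋-isCommutativeRing)
    sizeᵖ sizeᵖ-cong sizeᵖ-+ sizeᵖ-neg renaming (size-+-< to sizeᵖ-+-<)

  -- In this form the bound also holds for zero factors, so it can be applied to coefficients that
  -- may vanish.
  size-*-≤ : ∀ a b → size (a * b) ≤ pred (size a ℕ.+ size b)
  size-*-≤ a b with a ≟0 | b ≟0
  ... | yes a≈0 | _       = ℕ.≤-trans
    (ℕ.≤-reflexive (≡.trans (size-cong (trans (*-congʳ a≈0) (zeroˡ b))) size-0)) z≤n
  ... | no  _   | yes b≈0 = ℕ.≤-trans
    (ℕ.≤-reflexive (≡.trans (size-cong (trans (*-congˡ b≈0) (zeroʳ a))) size-0)) z≤n
  ... | no  a≉0 | no  b≉0 = ℕ.≤-reflexive (≡.cong pred (size-* a≉0 b≉0))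

  -- False for n = 0 and m = 2, which is why a zero tail is treated separately in both versions of
  -- `tail-bound`.
  shift-pred-+ˡ : ∀ m n → 0 < n → shift (pred (n ℕ.+ m)) ≤ pred (shift n ℕ.+ m)
  shift-pred-+ˡ m (suc n) _ = shift≤suc (n ℕ.+ m)

  shift-pred-+ʳ : ∀ m n → 0 < n → shift (pred (m ℕ.+ n)) ≤ pred (m ℕ.+ shift n)
  shift-pred-+ʳ m n 0<n = ≡.subst₂ (λ i j → shift (pred i) ≤ pred j)
    (ℕ.+-comm n m) (ℕ.+-comm (shift n) m) (shift-pred-+ˡ m n 0<n)

  sizeᵖ-·-≤ : ∀ a f → sizeᵖ (a · f) ≤ pred (size a ℕ.+ sizeᵖ f)
  sizeᵖ-·-≤ a []      = z≤n
  sizeᵖ-·-≤ a (b ∷ f) = ℕ.⊔-lub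
    (ℕ.≤-trans (size-*-≤ a b) (ℕ.pred-mono-≤ (ℕ.+-monoʳ-≤ (size a) (ℕ.m≤m⊔n _ _)))) tail-bound
    where
    tail-bound : shift (sizeᵖ (a · f)) ≤ pred (size a ℕ.+ (size b ⊔ shift (sizeᵖ f)))
    tail-bound with sizeᵖ f ℕ.≟ 0
    ... | yes sf≡0 = ℕ.≤-trans (ℕ.≤-reflexive (≡.cong shift
      (sizeᵖ-zero (≋-trans (·-cong {a} refl (sizeᵖ⁻¹-zero {f} sf≡0)) ≋-refl)))) z≤n
    ... | no  sf≢0 = ℕ.≤-trans (shift-mono (sizeᵖ-·-≤ a f))
      (ℕ.≤-trans (shift-pred-+ʳ (size a) (sizeᵖ f) (ℕ.n≢0⇒n>0 sf≢0))
        (ℕ.pred-mono-≤ (ℕ.+-monoʳ-≤ (size a) (ℕ.m≤n⊔m (size b) _))))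

  sizeᵖ-*-≤ : ∀ f g → sizeᵖ (f *ᵖ g) ≤ pred (sizeᵖ f ℕ.+ sizeᵖ g)
  sizeᵖ-*-≤ []      g = z≤n
  sizeᵖ-*-≤ (a ∷ f) g = ℕ.≤-trans (sizeᵖ-+ (a · g) (0# ∷ (f *ᵖ g))) (ℕ.⊔-lub
    (ℕ.≤-trans (sizeᵖ-·-≤ a g) (ℕ.pred-mono-≤ (ℕ.+-monoˡ-≤ (sizeᵖ g) (ℕ.m≤m⊔n (size a) _))))
    (ℕ.⊔-lub (ℕ.≤-trans (ℕ.≤-reflexive size-0) z≤n) tail-bound))
    where
    tail-bound : shift (sizeᵖ (f *ᵖ g)) ≤ pred ((size a ⊔ shift (sizeᵖ f)) ℕ.+ sizeᵖ g)
    tail-bound with sizeᵖ f ℕ.≟ 0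
    ... | yes sf≡0 = ℕ.≤-trans (ℕ.≤-reflexive (≡.cong shift
      (sizeᵖ-zero (*-cong′ (sizeᵖ⁻¹-zero {f} sf≡0) (≋-refl {g}))))) z≤n
    ... | no  sf≢0 = ℕ.≤-trans (shift-mono (sizeᵖ-*-≤ f g))
      (ℕ.≤-trans (shift-pred-+ˡ (sizeᵖ g) (sizeᵖ f) (ℕ.n≢0⇒n>0 sf≢0))
        (ℕ.pred-mono-≤ (ℕ.+-monoˡ-≤ (sizeᵖ g) (ℕ.m≤n⊔m (size a) _))))

  private
    -- If the constant coefficient does not attain the degree of f, then
    -- neither does a g attain that of f g.
    sizeᵖ-*-tail : ∀ a f g → size a < shift (sizeᵖ f) → 0 < sizeᵖ g →
      sizeᵖ f ℕ.+ sizeᵖ g ≤ suc (sizeᵖ (f *ᵖ g)) →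
      sizeᵖ (a ∷ f) ℕ.+ sizeᵖ g ≤ suc (sizeᵖ ((a ∷ f) *ᵖ g))
    sizeᵖ-*-tail a f g a<f 0<g ih with sizeᵖ f in sf≡ | sizeᵖ g in sg≡ | sizeᵖ (f *ᵖ g) in sfg≡
    ... | suc m | suc n | zero  = ⊥-elim (ℕ.<⇒≱ (s≤s (ℕ.≤-trans (s≤s z≤n) (ℕ.m≤n+m (suc n) m))) ih)
    ... | suc m | suc n | suc r = begin
      (size a ⊔ suc (suc m)) ℕ.+ suc n      ≡⟨ ≡.cong (ℕ._+ suc n) (ℕ.m≤n⇒m⊔n≡n (ℕ.<⇒≤ a<f)) ⟩
      suc (suc m ℕ.+ suc n)                 ≤⟨ s≤s ih ⟩
      suc (suc (suc r))                     ≡⟨ ≡.cong suc tail-size ⟨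
      suc (sizeᵖ (0# ∷ (f *ᵖ g)))           ≡⟨ ≡.cong suc (sizeᵖ-+-< {a · g} {0# ∷ (f *ᵖ g)} head<tail) ⟨
      suc (sizeᵖ ((a ∷ f) *ᵖ g))            ∎
      where
      open ℕ.≤-Reasoning
      tail-size : sizeᵖ (0# ∷ (f *ᵖ g)) ≡ suc (suc r)
      tail-size = ≡.cong₂ (λ i j → i ⊔ shift j) size-0 sfg≡
      head<tail : sizeᵖ (a · g) < sizeᵖ (0# ∷ (f *ᵖ g))
      head<tail = begin-strict
        sizeᵖ (a · g)                   ≤⟨ sizeᵖ-·-≤ a g ⟩
        pred (size a ℕ.+ sizeᵖ g)       ≡⟨ ≡.cong (λ i → pred (size a ℕ.+ i)) sg≡ ⟩
        pred (size a ℕ.+ suc n)         ≡⟨ ≡.cong pred (ℕ.+-suc (size a) n) ⟩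
        size a ℕ.+ n                    ≤⟨ ℕ.+-monoˡ-≤ n (ℕ.s≤s⁻¹ a<f) ⟩
        suc m ℕ.+ n                     ≡⟨ ℕ.+-suc m n ⟨
        m ℕ.+ suc n                     <⟨ ℕ.≤-refl ⟩
        suc m ℕ.+ suc n                 ≤⟨ ih ⟩
        suc (suc r)                     ≡⟨ tail-size ⟨
        sizeᵖ (0# ∷ (f *ᵖ g))           ∎

    -- The lowest powers of x in the top homogeneous parts multiply without cancellation. As long as
    -- the degree of a factor is attained only in its tail, the constant coefficient of that factor
    -- is discarded; once both constant coefficients attain the degrees, a b attains the degree of
    -- the product. The induction hypotheses are passed as functions, to be called only where the
    -- tail concerned is non-zero.
    sizeᵖ-*-step : ∀ a f b g → let ff = a ∷ f; gg = b ∷ g in 0 < sizeᵖ ff → 0 < sizeᵖ gg →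
      (0 < sizeᵖ f → sizeᵖ f ℕ.+ sizeᵖ gg ≤ suc (sizeᵖ (f *ᵖ gg))) →
      (0 < sizeᵖ g → sizeᵖ ff ℕ.+ sizeᵖ g ≤ suc (sizeᵖ (ff *ᵖ g))) →
      sizeᵖ ff ℕ.+ sizeᵖ gg ≤ suc (sizeᵖ (ff *ᵖ gg))
    sizeᵖ-*-step a f b g 0<f 0<g ihˡ ihʳ
      with size a ℕ.<? shift (sizeᵖ f) | size b ℕ.<? shift (sizeᵖ g)
    ... | yes a<f | _ = sizeᵖ-*-tail a f (b ∷ g) a<f 0<g (ihˡ (shift>0⇒>0 a<f))
    ... | no _    | yes b<g =
      ≡.subst₂ _≤_ (ℕ.+-comm (sizeᵖ (b ∷ g)) (sizeᵖ (a ∷ f))) (≡.cong suc (sizeᵖ-cong (*-comm′ (b ∷ g) (a ∷ f))))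
        (sizeᵖ-*-tail b g (a ∷ f) b<g 0<f
          (≡.subst₂ _≤_ (ℕ.+-comm (sizeᵖ (a ∷ f)) (sizeᵖ g)) (≡.cong suc (sizeᵖ-cong (*-comm′ (a ∷ f) g)))
            (ihʳ (shift>0⇒>0 b<g))))
    ... | no a≮f  | no b≮g = begin
      sizeᵖ (a ∷ f) ℕ.+ sizeᵖ (b ∷ g)  ≡⟨ ≡.cong₂ ℕ._+_ sf≡ sg≡ ⟩
      size a ℕ.+ size b                ≡⟨ size-* (size>0⇒≉0 (≡.subst (0 <_) sf≡ 0<f)) (size>0⇒≉0 (≡.subst (0 <_) sg≡ 0<g)) ⟨
      suc (size (a * b))               ≡⟨ ≡.cong suc (size-cong (+-identityʳ (a * b))) ⟨
      suc (size (a * b + 0#))          ≤⟨ s≤s (ℕ.m≤m⊔n _ _) ⟩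
      suc (sizeᵖ ((a ∷ f) *ᵖ (b ∷ g))) ∎
      where
      open ℕ.≤-Reasoning
      sf≡ : sizeᵖ (a ∷ f) ≡ size a
      sf≡ = ℕ.m≥n⇒m⊔n≡m (ℕ.≮⇒≥ a≮f)
      sg≡ : sizeᵖ (b ∷ g) ≡ size b
      sg≡ = ℕ.m≥n⇒m⊔n≡m (ℕ.≮⇒≥ b≮g)

  sizeᵖ-*-≥ : ∀ f g → 0 < sizeᵖ f → 0 < sizeᵖ g → sizeᵖ f ℕ.+ sizeᵖ g ≤ suc (sizeᵖ (f *ᵖ g))
  sizeᵖ-*-≥ (a ∷ f) (b ∷ g) 0<f 0<g = sizeᵖ-*-step a f b g 0<f 0<g
    (λ 0<f′ → sizeᵖ-*-≥ f (b ∷ g) 0<f′ 0<g) (λ 0<g′ → sizeᵖ-*-≥ (a ∷ f) g 0<f 0<g′)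

  sizeᵖ-1⇒∣1 : ∀ f → sizeᵖ f ≡ 1 → ∃[ g ] g *ᵖ f ≋ 1# ∷ []
  sizeᵖ-1⇒∣1 (a ∷ f) s≡1 = b ∷ [] , ≋-trans (const-* b (a ∷ f))
    (∷-cong ba≈1 (·-cong {b} refl (sizeᵖ⁻¹-zero {f} sf≡0)))
    where
    sf≡0 : sizeᵖ f ≡ 0
    sf≡0 = ℕ.n≤0⇒n≡0 (shift≤suc⇒≤ (ℕ.≤-trans (ℕ.m≤n⊔m (size a) _) (ℕ.≤-reflexive s≡1)))
    sa≡1 : size a ≡ 1
    sa≡1 = ≡.trans (≡.sym (≡.trans (≡.cong (λ n → size a ⊔ shift n) sf≡0) (ℕ.⊔-identityʳ (size a)))) s≡1
    a∣1 = size-1⇒∣1 sa≡1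
    b = a∣1 ._∣ʳ_.quotient
    ba≈1 = a∣1 ._∣ʳ_.equality

  -- The recursion is on the bound and not on the length of the list: the tail of a polynomial of
  -- size at most n + 1 has size at most n, and `≋` absorbs any number of trailing zeros.
  finiteᵖ : ∀ n → ∃[ fs ] ∀ f → sizeᵖ f ≤ n → Any (f ≋_) fs
  finiteᵖ zero    = [] ∷ [] , λ f s≤0 → here (sizeᵖ⁻¹-zero (ℕ.n≤0⇒n≡0 s≤0))
  finiteᵖ (suc n) = [] ∷ List.cartesianProductWith _∷_ as fs , complete
    where
    as = proj₁ (finite (suc n))
    fs = proj₁ (finiteᵖ n)
    complete : ∀ f → sizeᵖ f ≤ suc n → Any (f ≋_) ([] ∷ List.cartesianProductWith _∷_ as fs)
    complete []      _   = here ≋-refl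
    complete (a ∷ f) s≤n = there (Any.cartesianProductWith⁺ _∷_ ∷-cong
      (proj₂ (finite (suc n)) a (ℕ.≤-trans (ℕ.m≤m⊔n _ _) s≤n))
      (proj₂ (finiteᵖ n) f (shift≤suc⇒≤ (ℕ.≤-trans (ℕ.m≤n⊔m (size a) _) s≤n))))

  ≋-isSizedDomain : IsSizedDomain ≋-rawRing
  ≋-isSizedDomain = record
    { isCommutativeRawRing = ≋-isCommutativeRing
    ; 1≉0       = λ p → 1≉0 (at p 0)
    ; size      = sizeᵖ
    ; size-cong = sizeᵖ-cong
    ; size-0    = ≡.refl
    ; size⁻¹-0  = sizeᵖ⁻¹-zero
    ; size-+    = sizeᵖ-+
    ; size-*    = λ {f} {g} f≉0 g≉0 → let 0<f = positive f≉0; 0<g = positive g≉0 in ℕ.≤-antisym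
        (ℕ.≤-trans (s≤s (sizeᵖ-*-≤ f g)) (ℕ.≤-reflexive (suc-pred (ℕ.≤-trans 0<f (ℕ.m≤m+n _ _)))))
        (sizeᵖ-*-≥ f g 0<f 0<g)
    ; size-1⇒∣1 = λ {f} s≡1 → let (g , eq) = sizeᵖ-1⇒∣1 f s≡1 in g , eq
    ; finite    = finiteᵖ
    }
    where
    positive : ∀ {f} → ¬ f ≋ [] → 0 < sizeᵖ f
    positive {f} f≉0 = ℕ.n≢0⇒n>0 (f≉0 ∘ sizeᵖ⁻¹-zero)
    suc-pred : ∀ {n} → 0 < n → suc (pred n) ≡ n
    suc-pred {suc n} _ = ≡.refl

-- Gauss's lemma

module GaussLemma (R : RawRing c ℓ) (ufd : IsSizedUFD R) where
  open IsSizedUFD ufd using (isSizedDomain) renaming (prime to primeᴿ; isCommutativeRawRing to isCR)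
  private
    module R = SizedDomain R isSizedDomain
  open Univariate R using (coeff₁)
  open PolynomialRing R isCR hiding (≋-refl; ≋-sym; ≋-trans)
  open PolynomialSize R isSizedDomain
  open SizedDomain ≋-rawRing ≋-isSizedDomain
  open ≈-Reasoning setoid using (begin_; step-≈-⟩; step-≈-⟨; _∎)

  ι : R.Carrier → Carrier
  ι a = a ∷ []

  ι≉0 : ∀ {a} → a R.≉ R.0# → ι a ≉ 0#
  ι≉0 a≉0 p = a≉0 (at p 0)

  ι-∣⁺ : ∀ {a b} → a R.∣ b → ι a ∣ ι b
  ι-∣⁺ {a} (q , qa≈b) = ι q , trans (const-* q (ι a)) (∷-cong qa≈b refl)

  ι-∣⁻ : ∀ {a b} → ι a ∣ ι b → a R.∣ b
  ι-∣⁻ {a} (h , ha≈b) = coeff₁ h 0 ,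
    R.trans (R.*-comm _ a) (R.trans (R.sym (coeff-· a h 0)) (at (trans (sym (const-* a h)) (trans (*-comm _ h) ha≈b)) 0))

  ι-∣-∷⁻ : ∀ {c a f} → ι c ∣ (a ∷ f) → c R.∣ a × ι c ∣ f
  ι-∣-∷⁻ {c} {a} {f} (h , hc≈af) =
    (coeff₁ h 0 , R.trans (R.*-comm _ c) (coeffs 0)) ,
    (List.drop 1 h , trans (*-comm (List.drop 1 h) (ι c)) (trans (const-* c (List.drop 1 h))
      (mk≋ λ i → R.trans (coeff-· c (List.drop 1 h) i) (R.trans (R.*-congˡ (R.reflexive (drop-1 h i))) (coeffs (suc i))))))
    where
    coeffs : ∀ i → c R.* coeff₁ h i R.≈ coeff₁ (a ∷ f) i
    coeffs i = R.trans (R.sym (coeff-· c h i)) (at (trans (sym (const-* c h)) (trans (*-comm _ h) hc≈af)) i)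
    drop-1 : ∀ h i → coeff₁ (List.drop 1 h) i ≡ coeff₁ h (suc i)
    drop-1 []      i = ≡.refl
    drop-1 (a ∷ h) i = ≡.refl

  ι-∣-∷⁺ : ∀ {c a f} → c R.∣ a → ι c ∣ f → ι c ∣ (a ∷ f)
  ι-∣-∷⁺ {c} (q , qc≈a) (h , hc≈f) = (q ∷ h) ,
    trans (*-comm (q ∷ h) (ι c)) (trans (const-* c (q ∷ h))
      (∷-cong (R.trans (R.*-comm c q) qc≈a) (trans (sym (const-* c h)) (trans (*-comm (ι c) h) hc≈f))))

  private
    strip : ∀ {c a} f g → c R.∣ a → ι c ∣ (a ∷ f) * g → ι c ∣ f * g
    strip {c} {a} f g c∣a c∣afg = proj₂ (ι-∣-∷⁻ (∣-+-cancelˡ c∣ag c∣afg))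
      where
      c∣ag : ι c ∣ a · g
      c∣ag = ∣ʳ-respʳ-≈ (const-* a g) (∣ʳ-trans (ι-∣⁺ c∣a) (x∣xy (ι a) g))

  -- The primality of constants in R [x]. The constant coefficient of the product is a b, so c
  -- divides a or b; whichever it divides can be stripped off without disturbing divisibility of the
  -- product. No least index of a coefficient prime to c has to be chosen.
  ι-prime : ∀ {c} f g → R.Irreducible c → ι c ∣ f * g → ι c ∣ f ⊎ ι c ∣ g
  ι-prime []      g       irr c∣fg = inj₁ (0# , refl)
  ι-prime (a ∷ f) []      irr c∣fg = inj₂ (0# , refl)
  ι-prime (a ∷ f) (b ∷ g) irr c∣fg = Sum.[
      (λ c∣a → Sum.map₁ (ι-∣-∷⁺ c∣a) (ι-prime f (b ∷ g) irr (strip f (b ∷ g) c∣a c∣fg)))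
    , (λ c∣b → Sum.map₂ (ι-∣-∷⁺ c∣b) (ι-prime (a ∷ f) g irr
        (∣ʳ-respʳ-≈ (*-comm g (a ∷ f)) (strip g (a ∷ f) c∣b (∣ʳ-respʳ-≈ (*-comm (a ∷ f) (b ∷ g)) c∣fg)))))
    ]′ (primeᴿ irr (R.∣ʳ-respʳ-≈ (R.+-identityʳ _) (proj₁ (ι-∣-∷⁻ c∣fg))))

  ι-*-assoc : ∀ a b f → ι (a R.* b) * f ≈ ι a * (ι b * f)
  ι-*-assoc a b f = trans (*-congʳ {f} (sym (const-* a (ι b)))) (*-assoc (ι a) (ι b) f)

  NonConstant : Carrier → Set _
  NonConstant f = ∀ a → ¬ f ≈ ι a

  size-1⇒constant : ∀ f → sizeᵖ f ≡ 1 → f ≈ ι (coeff₁ f 0)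
  size-1⇒constant (a ∷ f) s≡1 = ∷-cong R.refl (sizeᵖ⁻¹-zero (ℕ.n≤0⇒n≡0
    (shift≤suc⇒≤ (ℕ.≤-trans (ℕ.m≤n⊔m (R.size a) _) (ℕ.≤-reflexive s≡1)))))

  -- This clears denominators. A prime factor p of c divides the cofactor u, where it is cancelled,
  -- or f; in the second case f would be p times a unit, and hence constant.
  irreducible-∣-ι* : ∀ {f c} g → Irreducible f → NonConstant f → c R.≉ R.0# → f ∣ ι c * g → f ∣ g
  irreducible-∣-ι* {f} {c} g irr non-const c≉0 f∣cg with R.factor c≉0
  ... | ps , irr-ps , (c∣ps , _) = go irr-ps (∣ʳ-trans f∣cg (∙-cong-∣ (ι-∣⁺ c∣ps) ∣ʳ-refl))
    where
    go : ∀ {ps} → All R.Irreducible ps → f ∣ ι (R.product ps) * g → f ∣ g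
    go []                           f∣g = ∣ʳ-respʳ-≈ (*-identityˡ g) f∣g
    go {p ∷ ps} (irr-p ∷ irr-ps) (u , uf≈pG)
      with ι-prime u f irr-p (ι (R.product ps) * g , trans (*-comm _ (ι p)) (sym (trans uf≈pG (ι-*-assoc p _ g))))
    ... | inj₁ (u′ , u′p≈u) = go irr-ps (u′ , *-cancelˡ (ι≉0 (R.irreducible⇒≉0 irr-p)) (begin
      ι p * (u′ * f)           ≈⟨ *-assoc (ι p) u′ f ⟨
      (ι p * u′) * f           ≈⟨ *-congʳ {f} (trans (*-comm (ι p) u′) u′p≈u) ⟩
      u * f                    ≈⟨ uf≈pG ⟩
      ι (p R.* R.product ps) * g ≈⟨ ι-*-assoc p _ g ⟩
      ι p * (ι (R.product ps) * g) ∎))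
    ... | inj₂ (v , vp≈f) with split-∣1 irr (sym vp≈f)
    ...   | inj₂ p∣1 = ⊥-elim (R.p∤1 irr-p (ι-∣⁻ p∣1))
    ...   | inj₁ (w , wv≈1) = ⊥-elim (non-const _ (constant-factor v≈ι))
      where
      v≈ι : v ≈ ι (coeff₁ v 0)
      v≈ι = size-1⇒constant v (∣1⇒size≡1 {v} (w , wv≈1))
      constant-factor : ∀ {a} → v ≈ ι a → f ≈ ι (a R.* p)
      constant-factor {a} v≈a = trans (sym vp≈f) (trans (*-congʳ {ι p} v≈a) (const-* a (ι p)))

  private
    Split : Carrier → Carrier → Set _
    Split f d = ∃[ a ] ∃[ d₀ ] ∃[ e₀ ] (a R.≉ R.0# × d ≈ ι a * d₀ × f ≈ d₀ * e₀)

    -- A factorisation of c f over R [x], with c constant, comes from a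
    -- factorisation of f.
    split-constant : ∀ {f c} d e → c R.≉ R.0# → e * d ≈ ι c * f → Split f d
    split-constant {f} {c} d e c≉0 ed≈cf with R.factor c≉0
    -- The factorisation of c holds only up to a unit; the factor r with r c = `product ps` is
    -- absorbed into e.
    ... | ps , irr-ps , ((r , rc≈ps) , _) = go irr-ps d (ι r * e) (begin
      ι (R.product ps) * f     ≈⟨ *-congʳ {f} (∷-cong rc≈ps (refl {[]})) ⟨
      ι (r R.* c) * f          ≈⟨ ι-*-assoc r c f ⟩
      ι r * (ι c * f)          ≈⟨ *-congˡ {ι r} ed≈cf ⟨
      ι r * (e * d)            ≈⟨ *-assoc (ι r) e d ⟨
      (ι r * e) * d            ≈⟨ *-comm (ι r * e) d ⟩
      d * (ι r * e)            ∎)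
      where
      go : ∀ {ps} → All R.Irreducible ps → ∀ d e → ι (R.product ps) * f ≈ d * e → Split f d
      go [] d e f≈de = R.1# , d , e , R.1≉0 , sym (*-identityˡ d) , trans (sym (*-identityˡ f)) f≈de
      go {p ∷ ps} (irr-p ∷ irr-ps) d e pf≈de
        with ι-prime d e irr-p (ι (R.product ps) * f , trans (*-comm _ (ι p)) (trans (sym (ι-*-assoc p _ f)) pf≈de))
      -- A prime that divides d is collected in the constant a of the splitting; one that divides e
      -- is cancelled and leaves no trace.
      ... | inj₁ (d′ , d′p≈d) with go irr-ps d′ e (*-cancelˡ (ι≉0 (R.irreducible⇒≉0 irr-p)) (begin
        ι p * (ι (R.product ps) * f)  ≈⟨ ι-*-assoc p _ f ⟨
        ι (p R.* R.product ps) * f    ≈⟨ pf≈de ⟩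
        d * e                         ≈⟨ *-congʳ {e} d′p≈d ⟨
        (d′ * ι p) * e                ≈⟨ *-congʳ {e} (*-comm d′ (ι p)) ⟩
        (ι p * d′) * e                ≈⟨ *-assoc (ι p) d′ e ⟩
        ι p * (d′ * e)                ∎))
      ...   | a , d₀ , e₀ , a≉0 , d′≈ad₀ , f≈d₀e₀ =
        p R.* a , d₀ , e₀ , R.*-≉0 (R.irreducible⇒≉0 irr-p) a≉0 , (begin
          d                  ≈⟨ d′p≈d ⟨
          d′ * ι p           ≈⟨ *-comm d′ (ι p) ⟩
          ι p * d′           ≈⟨ *-congˡ {ι p} d′≈ad₀ ⟩
          ι p * (ι a * d₀)   ≈⟨ ι-*-assoc p a d₀ ⟨
          ι (p R.* a) * d₀   ∎) , f≈d₀e₀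
      go {p ∷ ps} (irr-p ∷ irr-ps) d e pf≈de
          | inj₂ (e′ , e′p≈e) = go irr-ps d e′ (*-cancelˡ (ι≉0 (R.irreducible⇒≉0 irr-p)) (begin
        ι p * (ι (R.product ps) * f)  ≈⟨ ι-*-assoc p _ f ⟨
        ι (p R.* R.product ps) * f    ≈⟨ pf≈de ⟩
        d * e                         ≈⟨ *-congˡ {d} e′p≈e ⟨
        d * (e′ * ι p)                ≈⟨ x∙yz≈z∙xy d e′ (ι p) ⟩
        ι p * (d * e′)                ∎))

  -- A surrogate for the greatest common divisor of f and g over the
  -- field of fractions of R. The field `combination` is what remains of
  -- d being a linear combination of f and g.
  record PseudoGCD (f g : Carrier) : Set (c Level.⊔ ℓ) where
    field
      d           : Carrier
      d≉0         : d ≉ 0#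
      cᶠ cᵍ       : R.Carrier
      cᶠ≉0        : cᶠ R.≉ R.0#
      cᵍ≉0        : cᵍ R.≉ R.0#
      d∣cf        : d ∣ ι cᶠ * f
      d∣cg        : d ∣ ι cᵍ * g
      combination : ∀ {e h} → e ∣ f * h → e ∣ g * h → e ∣ d * h

  swap : ∀ {f g} → PseudoGCD f g → PseudoGCD g f
  swap e = record
    { d = d ; d≉0 = d≉0 ; cᶠ = cᵍ ; cᵍ = cᶠ ; cᶠ≉0 = cᵍ≉0 ; cᵍ≉0 = cᶠ≉0 ; d∣cf = d∣cg ; d∣cg = d∣cf
    ; combination = λ p q → combination q p }
    where open PseudoGCD e

  reduce : ∀ {f f₁ g h b} → b R.≉ R.0# → ι b * f ≈ h * g + f₁ → PseudoGCD f₁ g → PseudoGCD f g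
  reduce {f} {f₁} {g} {h} {b} b≉0 bf≈hg+f₁ e = record
    { d = d ; d≉0 = d≉0
    -- Multiplying b f = h g + f₁ by cᵍ cᶠ makes d divide both summands on the right.
    ; cᶠ = (cᵍ R.* cᶠ) R.* b ; cᵍ = cᵍ ; cᶠ≉0 = R.*-≉0 (R.*-≉0 cᵍ≉0 cᶠ≉0) b≉0 ; cᵍ≉0 = cᵍ≉0
    ; d∣cf = ∣ʳ-respʳ-≈ (sym (begin
        ι ((cᵍ R.* cᶠ) R.* b) * f            ≈⟨ ι-*-assoc (cᵍ R.* cᶠ) b f ⟩
        ι (cᵍ R.* cᶠ) * (ι b * f)            ≈⟨ *-congˡ {ι (cᵍ R.* cᶠ)} bf≈hg+f₁ ⟩
        ι (cᵍ R.* cᶠ) * (h * g + f₁)         ≈⟨ distribˡ (ι (cᵍ R.* cᶠ)) (h * g) f₁ ⟩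
        ι (cᵍ R.* cᶠ) * (h * g) + ι (cᵍ R.* cᶠ) * f₁ ∎))
        (∣-+ (∣ʳ-respʳ-≈ (x∙yz≈y∙xz h (ι (cᵍ R.* cᶠ)) g)
               (∣ʳ-trans d∣cg (x∣ʳy⇒x∣ʳzy h (∙-cong-∣ (ι-∣⁺ (R.x∣xy cᵍ cᶠ)) ∣ʳ-refl))))
             (∣ʳ-trans d∣cf (∙-cong-∣ (ι-∣⁺ (R.x∣yx cᶠ cᵍ)) ∣ʳ-refl)))
    ; d∣cg = d∣cg
    -- Because f₁ = b f - h g, whatever divides f k and g k divides f₁ k.
    ; combination = λ {e} {k} e∣fk e∣gk → combination
        (∣-+-cancelˡ
          (∣ʳ-respʳ-≈ (sym (*-assoc h g k)) (x∣ʳy⇒x∣ʳzy h e∣gk))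
          (∣ʳ-respʳ-≈ (begin
             ι b * (f * k)          ≈⟨ *-assoc (ι b) f k ⟨
             (ι b * f) * k          ≈⟨ *-congʳ {k} bf≈hg+f₁ ⟩
             (h * g + f₁) * k       ≈⟨ distribʳ k (h * g) f₁ ⟩
             (h * g) * k + f₁ * k   ∎) (x∣ʳy⇒x∣ʳzy (ι b) e∣fk)))
        e∣gk
    }
    where
    open PseudoGCD e

  zero-pseudoGCD : ∀ {f g} → f ≈ 0# → g ≉ 0# → PseudoGCD f g
  zero-pseudoGCD {f} {g} f≈0 g≉0 = record
    { d = g ; d≉0 = g≉0 ; cᶠ = R.1# ; cᵍ = R.1# ; cᶠ≉0 = R.1≉0 ; cᵍ≉0 = R.1≉0
    ; d∣cf = 0# , sym (trans (*-identityˡ f) f≈0)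
    ; d∣cg = 1# , refl
    ; combination = λ _ p → p
    }

  -- The degree in the last variable alone, which is the one that division lowers; `sizeᵖ` counts
  -- all variables.
  _HasDegree<_ : Carrier → ℕ → Set ℓ
  f HasDegree< n = ∀ {i} → n ≤ i → coeff₁ f i R.≈ R.0#

  x^_*_ : ℕ → Carrier → Carrier
  x^ zero  * f = f
  x^ suc k * f = R.0# ∷ (x^ k * f)

  coeff-x^* : ∀ k f i → coeff₁ (x^ k * f) (k ℕ.+ i) ≡ coeff₁ f i
  coeff-x^* zero    f i = ≡.refl
  coeff-x^* (suc k) f i = coeff-x^* k f i

  x^*-* : ∀ k f g → (x^ k * f) * g ≈ x^ k * (f * g)
  x^*-* zero    f g = refl
  x^*-* (suc k) f g = trans (0∷-* (x^ k * f) g) (∷-cong R.refl (x^*-* k f g))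

  drop-leading : ∀ {f m} → coeff₁ f m R.≈ R.0# → f HasDegree< suc m → f HasDegree< m
  drop-leading {f} {m} fₘ≈0 f<m {i} m≤i with ℕ.m≤n⇒m<n∨m≡n m≤i
  ... | inj₁ m<i    = f<m m<i
  ... | inj₂ ≡.refl = fₘ≈0

  -- One step of pseudo-division: f₁ = b f - a x^k g. The factor b, the coefficient of g at x^n,
  -- stands in for a division by b in R.
  cancel-leading : ∀ {f g} k n → let b = coeff₁ g n; a = coeff₁ f (k ℕ.+ n) in
    f HasDegree< suc (k ℕ.+ n) → g HasDegree< suc n →
    ∃[ f₁ ] f₁ HasDegree< (k ℕ.+ n) × ι b * f ≈ (x^ k * ι a) * g + f₁
  cancel-leading {f} {g} k n f< g< = f₁ , drop-leading {f₁} leading lower , sym eq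
    where
    b = coeff₁ g n
    a = coeff₁ f (k ℕ.+ n)
    f₁ = ι b * f - (x^ k * ι a) * g
    eq : (x^ k * ι a) * g + f₁ ≈ ι b * f
    eq = trans (sym (+-assoc ((x^ k * ι a) * g) (ι b * f) (- ((x^ k * ι a) * g)))) (xyx⁻¹≈y ((x^ k * ι a) * g) (ι b * f))
    coeffs : ∀ i → coeff₁ f₁ (k ℕ.+ i) R.≈ b R.* coeff₁ f (k ℕ.+ i) R.- a R.* coeff₁ g i
    coeffs i = R.trans (coeff-+ (ι b * f) _ (k ℕ.+ i)) (R.+-cong
      (R.trans (at (const-* b f) (k ℕ.+ i)) (coeff-· b f (k ℕ.+ i)))
      (R.trans (coeff-neg ((x^ k * ι a) * g) (k ℕ.+ i)) (R.-‿cong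
        (R.trans (at (trans (x^*-* k (ι a) g) (x^-cong k (const-* a g))) (k ℕ.+ i))
          (R.trans (R.reflexive (coeff-x^* k (a · g) i)) (coeff-· a g i))))))
      where
      x^-cong : ∀ k {f g} → f ≈ g → x^ k * f ≈ x^ k * g
      x^-cong zero    p = p
      x^-cong (suc k) p = ∷-cong R.refl (x^-cong k p)
    leading : coeff₁ f₁ (k ℕ.+ n) R.≈ R.0#
    leading = R.trans (coeffs n) (R.x≈y⇒x-y≈0 (R.*-comm b a))
    lower : f₁ HasDegree< suc (k ℕ.+ n)
    lower {i} k+n<i with ℕ.m≤n⇒∃[o]m+o≡n (ℕ.≤-trans (ℕ.m≤m+n k n) (ℕ.<⇒≤ k+n<i))
    ... | j , ≡.refl = R.trans (coeffs j) (R.x≈y⇒x-y≈0 (R.trans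
      (R.trans (R.*-congˡ (f< k+n<i)) (R.zeroʳ b))
      (R.sym (R.trans (R.*-congˡ (g< (ℕ.+-cancelˡ-< k n j k+n<i))) (R.zeroʳ a)))))

  cancel-leading-≤ : ∀ {f g m n} → n ≤ m → f HasDegree< suc m → g HasDegree< suc n →
    ∃[ h ] ∃[ f₁ ] f₁ HasDegree< m × ι (coeff₁ g n) * f ≈ h * g + f₁
  cancel-leading-≤ {f} {g} {m} {n} n≤m f< g< with m ℕ.∸ n | ℕ.m∸n+n≡m n≤m
  ... | k | ≡.refl = x^ k * ι (coeff₁ f (k ℕ.+ n)) , cancel-leading k n f< g<

  -- Euclid's algorithm on degree bounds. Each call lowers m or n by one, either by dropping a
  -- vanishing top coefficient or by a step of pseudo-division. The last hypothesis survives every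
  -- step and makes the final d non-zero.
  pseudoGCD : ∀ m n f g → f HasDegree< m → g HasDegree< n → ¬ (f ≈ 0# × g ≈ 0#) → PseudoGCD f g
  pseudoGCD zero n f g f< g< ¬both = zero-pseudoGCD f≈0 (λ g≈0 → ¬both (f≈0 , g≈0))
    where
    f≈0 : f ≈ 0#
    f≈0 = mk≋ λ i → f< z≤n
  pseudoGCD (suc m) zero f g f< g< ¬both = swap (zero-pseudoGCD g≈0 (λ f≈0 → ¬both (f≈0 , g≈0)))
    where
    g≈0 : g ≈ 0#
    g≈0 = mk≋ λ i → g< z≤n
  pseudoGCD (suc m) (suc n) f g f< g< ¬both with coeff₁ f m R.≟0 | coeff₁ g n R.≟0 | ℕ.≤-total n m
  ... | yes fₘ≈0 | _        | _ = pseudoGCD m (suc n) f g (drop-leading {f} fₘ≈0 f<) g< ¬both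
  ... | no _     | yes gₙ≈0 | _ = pseudoGCD (suc m) n f g f< (drop-leading {g} gₙ≈0 g<) ¬both
  ... | no fₘ≉0  | no gₙ≉0  | inj₁ n≤m =
    let (h , f₁ , f₁< , eq) = cancel-leading-≤ {f} {g} n≤m f< g<
    in reduce {h = h} gₙ≉0 eq (pseudoGCD m (suc n) f₁ g f₁< g< λ (_ , g≈0) → gₙ≉0 (at g≈0 n))
  ... | no fₘ≉0  | no gₙ≉0  | inj₂ m≤n =
    let (h , g₁ , g₁< , eq) = cancel-leading-≤ {g} {f} m≤n g< f<
    in swap (reduce {h = h} fₘ≉0 eq (swap (pseudoGCD (suc m) n f g₁ f< g₁< λ (f≈0 , _) → fₘ≉0 (at f≈0 m))))

  length-bound : ∀ f → f HasDegree< List.length f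
  length-bound []      _         = R.refl
  length-bound (a ∷ f) {suc i} p = length-bound f (ℕ.s≤s⁻¹ p)

  -- Up to the constant a, the pseudo-gcd d is a divisor d₀ of f, so d₀ is a unit or an associate of
  -- f. In the first case d divides a constant; `combination` gives f ∣ d h, hence f divides a
  -- constant times h. In the second case f ∣ d, hence f divides a constant times g. The constants
  -- are then cleared.
  nonConstant-prime : ∀ {f g h} → Irreducible f → NonConstant f → PseudoGCD f g →
                      f ∣ g * h → f ∣ g ⊎ f ∣ h
  nonConstant-prime {f} {g} {h} irr non-const e f∣gh =
    conclude (split-constant d (d∣cf ._∣ʳ_.quotient) cᶠ≉0 (d∣cf ._∣ʳ_.equality))
    where
    open PseudoGCD e
    conclude : Split f d → f ∣ g ⊎ f ∣ h
    conclude (a , d₀ , e₀ , a≉0 , d≈ad₀ , f≈d₀e₀) = Sum.[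
        (λ d₀∣1 → inj₂ (irreducible-∣-ι* h irr non-const a≉0
          (∣ʳ-trans (combination (x∣xy f h) f∣gh) (∙-cong-∣ (d∣a d₀∣1) ∣ʳ-refl))))
      , (λ e₀∣1 → inj₁ (irreducible-∣-ι* g irr non-const cᵍ≉0 (∣ʳ-trans (f∣d e₀∣1) d∣cg)))
      ]′ (split-∣1 irr f≈d₀e₀)
      where
      d∣a : d₀ ∣ 1# → d ∣ ι a
      d∣a d₀∣1 = ∣ʳ-respʳ-≈ (*-identityʳ (ι a))
        (∣ʳ-respˡ-≈ (sym d≈ad₀) (x∣y⇒zx∣zy (ι a) d₀∣1))
      f∣d : e₀ ∣ 1# → f ∣ d
      f∣d e₀∣1 = ∣ʳ-trans (∣ʳ-respʳ-≈ (*-identityʳ d₀)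
        (∣ʳ-respˡ-≈ (sym f≈d₀e₀) (x∣y⇒zx∣zy d₀ e₀∣1))) (ι a , sym d≈ad₀)

  ι-irreducible⁻ : ∀ {a} → Irreducible (ι a) → R.Irreducible a
  ι-irreducible⁻ {a} irr = R.mkIrred (p∤1 irr ∘ ι-∣⁺) λ {x} {y} a≈xy → Sum.map ι-∣⁻ ι-∣⁻
    (split-∣1 irr (trans (∷-cong a≈xy refl) (sym (const-* x (ι y)))))

  primeᵖ : ∀ {f g h} → Irreducible f → f ∣ g * h → f ∣ g ⊎ f ∣ h
  primeᵖ {[]} irr = ⊥-elim (irreducible⇒≉0 irr refl)
  primeᵖ {a ∷ f} {g} {h} irr f∣gh with f ≟0
  ... | no  f≉0 = nonConstant-prime irr (λ b p → f≉0 (mk≋ λ i → at p (suc i)))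
    (pseudoGCD (suc (List.length f)) (List.length g) (a ∷ f) g (length-bound (a ∷ f)) (length-bound g)
      λ (af≈0 , _) → irreducible⇒≉0 irr af≈0) f∣gh
  ... | yes f≈0 = Sum.map (∣ʳ-respˡ-≈ (sym af≈a)) (∣ʳ-respˡ-≈ (sym af≈a))
    (ι-prime g h (ι-irreducible⁻ (irreducible-respects-∥ (∥-reflexive af≈a) irr))
      (∣ʳ-respˡ-≈ af≈a f∣gh))
    where
    af≈a : a ∷ f ≈ ι a
    af≈a = ∷-cong R.refl f≈0

  ≋-isSizedUFD : IsSizedUFD ≋-rawRing
  ≋-isSizedUFD = record { isSizedDomain = ≋-isSizedDomain ; prime = primeᵖ }

  polynomialRing-isSizedUFD : IsSizedUFD (Univariate.polynomialRing R)
  polynomialRing-isSizedUFD = changeEquality-isSizedUFD ≋-rawRing (Univariate._≈ᵖ_ R) at mk≋ ≋-isSizedUFD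

-- Polynomials over a finite field

module FiniteField (F : HeytingField c ℓ₁ ℓ₂) {q : ℕ} (card : HasCardinality (HeytingField.setoid F) q) where
  open HeytingField F hiding (zero)
  open HCR heytingCommutativeRing
  open CommutativeRing (HeytingCommutativeRing.commutativeRing heytingCommutativeRing) using (ring; semiring; +-group)
  open RingProperties ring using (x[y-z]≈xy-xz)
  open GroupProperties +-group using () renaming (x∙y⁻¹≈ε⇒x≈y to x-y≈0⇒x≈y; x≈y⇒x∙y⁻¹≈ε to x≈y⇒x-y≈0)
  open Exp semiring using (_^_; ^-homo-*)
  open Inverse card

  rawField : RawRing c ℓ₁
  rawField = Polynomials.rawField F 0

  open RawSemiringDefinitions (RawRing.rawSemiring rawField) using (_∣_)

  infix 4 _≟_
  _≟_ : ∀ x y → Dec (x ≈ y)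
  x ≟ y = Dec.map′ (λ eq → trans (sym (strictlyInverseˡ x)) (trans (to-cong eq) (strictlyInverseˡ y)))
                   from-cong (from x Fin.≟ from y)

  -- At this stage `¬ x ≈ 0#` does not yet provide `x # 0#`. The goal is negative, however, and so
  -- `tight` allows both apartness relations to be assumed.
  *-≉0 : ∀ {x y} → ¬ x ≈ 0# → ¬ y ≈ 0# → ¬ x * y ≈ 0#
  *-≉0 x≉0 y≉0 xy≈0 =
    x≉0 (proj₁ (tight _ _) λ x#0 → y≉0 (proj₁ (tight _ _) λ y#0 →
      proj₂ (tight _ _) xy≈0 (x#0y#0→xy#0 x#0 y#0)))

  0≉1 : ¬ 0# ≈ 1#
  0≉1 0≈1 = proj₂ (tight _ _) (sym 0≈1) 1#0

  ^-≉0 : ∀ {x} n → ¬ x ≈ 0# → ¬ x ^ n ≈ 0#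
  ^-≉0 zero    x≉0 = 0≉1 ∘ sym
  ^-≉0 (suc n) x≉0 = *-≉0 x≉0 (^-≉0 n x≉0)

  -- Two of the q + 1 powers x^0, ..., x^q agree. Cancelling the smaller one leaves x^(k+1) = 1, so
  -- x^k is the inverse of x.
  ≉0⇒∣1 : ∀ {x} → ¬ x ≈ 0# → x ∣ 1#
  ≉0⇒∣1 {x} x≉0 with Fin.pigeonhole (ℕ.n<1+n q) (λ i → from (x ^ toℕ i))
  ... | i , j , i<j , eq with ℕ.m≤n⇒∃[o]m+o≡n i<j
  ... | k , i+k≡j = x ^ k , trans (*-comm (x ^ k) x) (x-y≈0⇒x≈y _ _ xᵏ⁺¹-1≈0)
    where
    open ≈-Reasoning setoid
    n = toℕ i
    powers : x ^ n ≈ x ^ n * x ^ suc k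
    powers = begin
      x ^ n                   ≈⟨ strictlyInverseˡ _ ⟨
      to (from (x ^ n))       ≈⟨ to-cong eq ⟩
      to (from (x ^ toℕ j))   ≈⟨ strictlyInverseˡ _ ⟩
      x ^ toℕ j               ≡⟨ ≡.cong (x ^_) (≡.trans (≡.sym i+k≡j) (≡.sym (ℕ.+-suc n k))) ⟩
      x ^ (n ℕ.+ suc k)       ≈⟨ ^-homo-* x n (suc k) ⟩
      x ^ n * x ^ suc k       ∎
    xᵏ⁺¹-1≈0 : x ^ suc k - 1# ≈ 0#
    xᵏ⁺¹-1≈0 = Dec.decidable-stable (_ ≟ _) λ ≉0 → *-≉0 (^-≉0 n x≉0) ≉0 (begin
      x ^ n * (x ^ suc k - 1#)          ≈⟨ x[y-z]≈xy-xz _ _ _ ⟩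
      x ^ n * x ^ suc k - x ^ n * 1#    ≈⟨ x≈y⇒x-y≈0 (trans (sym powers) (sym (*-identityʳ _))) ⟩
      0#                                ∎)

  ≉0⇒#0 : ∀ {x} → ¬ x ≈ 0# → x # 0#
  ≉0⇒#0 x≉0 with ≉0⇒∣1 x≉0
  ... | y , yx≈1 = invertibleˡ⇒# (y , trans (*-congˡ (x-0≈x _)) yx≈1)

  #0⇒≉0 : ∀ {x} → x # 0# → ¬ x ≈ 0#
  #0⇒≉0 x#0 x≈0 = proj₂ (tight _ _) x≈0 x#0

  sizeꟳ : Carrier → ℕ
  sizeꟳ x with x ≟ 0#
  ... | yes _ = 0
  ... | no  _ = 1

  ≈0⇒size : ∀ {x} → x ≈ 0# → sizeꟳ x ≡ 0
  ≈0⇒size {x} x≈0 with x ≟ 0#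
  ... | yes _   = ≡.refl
  ... | no  x≉0 = ⊥-elim (x≉0 x≈0)

  ≉0⇒size : ∀ {x} → ¬ x ≈ 0# → sizeꟳ x ≡ 1
  ≉0⇒size {x} x≉0 with x ≟ 0#
  ... | yes x≈0 = ⊥-elim (x≉0 x≈0)
  ... | no  _   = ≡.refl

  size⇒≈0 : ∀ {x} → sizeꟳ x ≡ 0 → x ≈ 0#
  size⇒≈0 {x} eq with x ≟ 0#
  ... | yes x≈0 = x≈0

  size⇒≉0 : ∀ {x} → sizeꟳ x ≡ 1 → ¬ x ≈ 0#
  size⇒≉0 eq x≈0 with () ← ≡.trans (≡.sym eq) (≈0⇒size x≈0)

  size≤1 : ∀ x → sizeꟳ x ≤ 1
  size≤1 x with x ≟ 0#
  ... | yes _ = z≤n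
  ... | no  _ = s≤s z≤n

  rawField-isSizedUFD : IsSizedUFD rawField
  rawField-isSizedUFD = record
    { isSizedDomain = record
      { isCommutativeRawRing = isCommutativeRing
      ; 1≉0       = 0≉1 ∘ sym
      ; size      = sizeꟳ
      ; size-cong = cong
      ; size-0    = ≈0⇒size refl
      ; size⁻¹-0  = size⇒≈0
      ; size-+    = size-+
      ; size-*    = λ x≉0 y≉0 → ≡.trans (≡.cong suc (≉0⇒size (*-≉0 x≉0 y≉0)))
                      (≡.sym (≡.cong₂ ℕ._+_ (≉0⇒size x≉0) (≉0⇒size y≉0)))
      ; size-1⇒∣1 = ≉0⇒∣1 ∘ size⇒≉0
      ; finite    = λ _ → List.tabulate to , λ x _ → Any.tabulate⁺ (from x) (sym (strictlyInverseˡ x))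
      }
    -- Vacuous: a field has no irreducible elements, since every non-zero element is a unit.
    ; prime = λ {p} irr → ⊥-elim (p∤1 irr (≉0⇒∣1 (Primality.Irreducible⇒≉0 semiring 0≉1 irr)))
    }
    where
    open RawSemiringDefinitions.Irreducible
    cong : ∀ {x y} → x ≈ y → sizeꟳ x ≡ sizeꟳ y
    cong {x} {y} x≈y with y ≟ 0#
    ... | yes y≈0 = ≈0⇒size (trans x≈y y≈0)
    ... | no  y≉0 = ≉0⇒size (λ x≈0 → y≉0 (trans (sym x≈y) x≈0))
    size-+ : ∀ x y → sizeꟳ (x + y) ≤ sizeꟳ x ⊔ sizeꟳ y
    size-+ x y with x ≟ 0# | y ≟ 0#
    ... | no  _   | yes _   = size≤1 _
    ... | no  _   | no  _   = size≤1 _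
    ... | yes _   | no  _   = size≤1 _
    ... | yes x≈0 | yes y≈0 = ℕ.≤-reflexive (≈0⇒size (trans (+-cong x≈0 y≈0) (+-identityˡ 0#)))

  multivariateRing-isSizedUFD : ∀ k → IsSizedUFD (multivariateRing rawField k)
  multivariateRing-isSizedUFD zero    = rawField-isSizedUFD
  multivariateRing-isSizedUFD (suc k) =
    GaussLemma.polynomialRing-isSizedUFD (multivariateRing rawField k) (multivariateRing-isSizedUFD k)

-- Coefficients and total degree

module Coefficients (F : HeytingField c ℓ₁ ℓ₂) {q : ℕ} (card : HasCardinality (HeytingField.setoid F) q) where
  private
    module 𝔽 = HeytingField F
  open FiniteField F card hiding (_≟_)

  private
    R : ℕ → RawRing c ℓ₁
    R = multivariateRing rawField
    module R k = RawRing (R k)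
    module S k = SizedDomain (R k) (IsSizedUFD.isSizedDomain (multivariateRing-isSizedUFD k))
    module P k = PolynomialRing (R k) (S.isCommutativeRawRing k)
    module G k = GaussLemma (R k) (multivariateRing-isSizedUFD k)
    module Z k = PolynomialSize (R k) (IsSizedUFD.isSizedDomain (multivariateRing-isSizedUFD k))

  -- The recursive function local to Polynomials.coeff F K cannot be named;
  -- it is recovered here by unification, with the number k of the
  -- variables it is applied to separate from the parameter K.
  partialCoeff : ∀ (K k : ℕ) → R.Carrier k → Vec ℕ k → 𝔽.Carrier
  partialCoeff-spec : ∀ k f α →
    Polynomials.coeff F (suc k) (f ∷ []) (0 ∷ α) ≡ partialCoeff (suc k) k f α
  partialCoeff = _
  partialCoeff-spec k f α with suc k
  ... | K = ≡.refl

  module Partial (K : ℕ) where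
    private
      C : ∀ {k} → R.Carrier k → Vec ℕ k → 𝔽.Carrier
      C {k} = partialCoeff K k

    coeff-cong : ∀ k {f g} → R._≈_ k f g → ∀ α → C {k} f α 𝔽.≈ C g α
    coeff-cong zero    f≈g []      = f≈g
    coeff-cong (suc k) f≈g (i ∷ α) = coeff-cong k (f≈g i) α

    coeff-injective : ∀ k {f g} → (∀ α → C {k} f α 𝔽.≈ C g α) → R._≈_ k f g
    coeff-injective zero    eq   = eq []
    coeff-injective (suc k) eq i = coeff-injective k λ α → eq (i ∷ α)

    constant : ∀ k → 𝔽.Carrier → R.Carrier k
    constant zero    a = a
    constant (suc k) a = constant k a ∷ []

    coeff-constant-* : ∀ k a f α → C {k} (R._*_ k (constant k a) f) α 𝔽.≈ a 𝔽.* C f α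
    coeff-constant-* zero    a f []      = 𝔽.refl
    coeff-constant-* (suc k) a f (i ∷ α) = 𝔽.trans
      (coeff-cong k (S.trans k (P.at {k} (P.const-* k (constant k a) f) i) (P.coeff-· k (constant k a) f i)) α)
      (coeff-constant-* k a (Univariate.coeff₁ (R k) f i) α)

    -- Units have size 1, so this identifies them with the non-zero constants of F; that is what
    -- turns `∥` into `∼`.
    size-1⇒constant : ∀ k {f} → S.size k f ≡ 1 → ∃[ a ] (¬ a 𝔽.≈ 𝔽.0# × R._≈_ k f (constant k a))
    size-1⇒constant zero    {f} s≡1 = f , size⇒≉0 s≡1 , 𝔽.refl
    size-1⇒constant (suc k) {f} s≡1 with size-1⇒constant k {Univariate.coeff₁ (R k) f 0} s₀≡1
      where
      s₀≡1 : S.size k (Univariate.coeff₁ (R k) f 0) ≡ 1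
      s₀≡1 = ≡.trans (≡.sym (ℕ.⊔-identityʳ _))
        (≡.trans (≡.sym (Z.sizeᵖ-cong k (G.size-1⇒constant k f s≡1))) s≡1)
    ... | a , a≉0 , f₀≈a = a , a≉0 ,
      P.at {k} (P.≋-trans k (G.size-1⇒constant k f s≡1) (P.∷-cong k f₀≈a (P.≋-refl k)))

    -- The truncated subtraction is intended: for i ≥ n the bound says that the coefficient
    -- vanishes.
    size-coeff₁ : ∀ k f n → Z.sizeᵖ k f ≤ n → ∀ i → S.size k (Univariate.coeff₁ (R k) f i) ≤ n ℕ.∸ i
    size-coeff₁ k []      n s≤n i       = ℕ.≤-trans (ℕ.≤-reflexive (S.size-0 k)) z≤n
    size-coeff₁ k (a ∷ f) n s≤n zero    = ℕ.≤-trans (ℕ.m≤m⊔n _ _) s≤n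
    size-coeff₁ k (a ∷ f) n s≤n (suc i) = tail-bound n (ℕ.≤-trans (ℕ.m≤n⊔m (S.size k a) _) s≤n)
      where
      tail-bound : ∀ n → Z.shift k (Z.sizeᵖ k f) ≤ n → S.size k (Univariate.coeff₁ (R k) f i) ≤ n ℕ.∸ suc i
      tail-bound zero    p = ℕ.≤-trans (size-coeff₁ k f 0 (Z.shift≤suc⇒≤ k (ℕ.m≤n⇒m≤1+n p)) i)
                               (ℕ.≤-reflexive (ℕ.0∸n≡0 i))
      tail-bound (suc n) p = size-coeff₁ k f n (Z.shift≤suc⇒≤ k p) i

    size-bounds : ∀ k {f n} → S.size k f ≤ n → ∀ α → n ≤ Vec.sum α → C {k} f α 𝔽.≈ 𝔽.0#
    size-bounds zero    s≤n []      z≤n = size⇒≈0 (ℕ.n≤0⇒n≡0 s≤n)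
    size-bounds (suc k) {f} {n} s≤n (i ∷ α) n≤ =
      size-bounds k (size-coeff₁ k f n s≤n i) α (ℕ.m≤n+o⇒m∸n≤o n i n≤)

    size-attained : ∀ k {f m} → S.size k f ≡ suc m → ∃[ α ] Vec.sum α ≡ m × ¬ (C {k} f α 𝔽.≈ 𝔽.0#)
    size-attained zero {f} {m} s≡ = [] , ≡.sym (ℕ.n≤0⇒n≡0 (ℕ.s≤s⁻¹ (≡.subst (_≤ 1) s≡ (size≤1 f)))) ,
      λ f≈0 → ℕ.1+n≢0 (≡.trans (≡.sym s≡) (≈0⇒size f≈0))
    size-attained (suc k) {a ∷ f} {m} s≡ with ℕ.⊔-sel (S.size k a) (Z.shift k (Z.sizeᵖ k f))
    ... | inj₁ s≡a with size-attained k (≡.trans (≡.sym s≡a) s≡)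
    ...   | α , sum≡ , ≉0 = 0 ∷ α , sum≡ , ≉0
    size-attained (suc k) {a ∷ f} {m} s≡
        | inj₂ s≡f with Z.sizeᵖ k f in sf≡ | ≡.trans (≡.sym s≡f) s≡
    ... | suc n | ≡.refl with size-attained (suc k) {f} sf≡
    ...   | i ∷ α , sum≡ , ≉0 = suc i ∷ α , ≡.cong suc sum≡ , ≉0

-- Associates and proportional polynomials

module Link (F : HeytingField c ℓ₁ ℓ₂) {q : ℕ} (card : HasCardinality (HeytingField.setoid F) q) (k : ℕ) where
  private
    module 𝔽 = HeytingField F
  open FiniteField F card using (multivariateRing-isSizedUFD; #0⇒≉0; ≉0⇒#0)
  open Coefficients F card using (module Partial)
  open Partial k
  open Polynomials F k hiding (rawField; _∣_; Irreducible)

  isSizedUFD : IsSizedUFD Poly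
  isSizedUFD = multivariateRing-isSizedUFD k

  open SizedDomain Poly (IsSizedUFD.isSizedDomain isSizedUFD)

  ∼⇒∥ : ∀ {f g} → f ∼ g → f ∥ g
  ∼⇒∥ {f} {g} f∼g = scaled f∼g , scaled (∼-sym {f} {g} f∼g)
    where
    scaled : ∀ {f g} → f ∼ g → f ∣ g
    scaled {f} (a , _ , af≈g) =
      constant k a , coeff-injective k λ α → 𝔽.trans (coeff-constant-* k a f α) (af≈g α)

  ∥⇒∼ : ∀ {f g} → f ≉ 0# → f ∥ g → f ∼ g
  ∥⇒∼ {f} {g} f≉0 ((r , rf≈g) , (s , sg≈f)) with size-1⇒constant k {r} (∣1⇒size≡1 (s , sr≈1))
    where
    sr≈1 : s * r ≈ 1#
    sr≈1 = *-cancelˡ f≉0 (begin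
      f * (s * r)   ≈⟨ x∙yz≈y∙zx f s r ⟩
      s * (r * f)   ≈⟨ *-congˡ rf≈g ⟩
      s * g         ≈⟨ sg≈f ⟩
      f             ≈⟨ *-identityʳ f ⟨
      f * 1#        ∎)
      where open ≈-Reasoning setoid
  ... | a , a≉0 , r≈a = a , ≉0⇒#0 a≉0 , λ α → 𝔽.trans (𝔽.sym (coeff-constant-* k a f α))
    (coeff-cong k (trans (*-congʳ (sym r≈a)) rf≈g) α)

  totalDegree⇒size : ∀ {f m} → HasTotalDegree f m → size f ≡ suc m
  totalDegree⇒size {f} {m} deg = go (size f) ≡.refl
    where
    open HasTotalDegree deg
    go : ∀ s → size f ≡ s → s ≡ suc m
    go zero    s≡ = ⊥-elim (proj₂ (proj₂ attained) (size-bounds k {f} {0} (ℕ.≤-reflexive s≡) _ z≤n))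
    go (suc s) s≡ with size-attained k {f} s≡ | ℕ.<-cmp s m
    ... | α , ≡.refl , ≉0 | tri< s<m _ _ = ⊥-elim (proj₂ (proj₂ attained)
      (size-bounds k {f} (ℕ.≤-reflexive s≡) (proj₁ attained) (≡.subst (Vec.sum α <_) (≡.sym (proj₁ (proj₂ attained))) s<m)))
    ... | α , ≡.refl , ≉0 | tri≈ _ s≡m _ = ≡.cong suc s≡m
    ... | α , ≡.refl , ≉0 | tri> _ _ s>m = ⊥-elim (≉0 (bounded α s>m))

  size⇒totalDegree : ∀ {f m} → size f ≡ suc m → HasTotalDegree f m
  size⇒totalDegree {f} s≡ = record
    { attained = size-attained k {f} s≡
    ; bounded  = size-bounds k {f} (ℕ.≤-reflexive s≡)
    }

-- Finite setoids

-- Repetitions are allowed; `cardinality` removes them by means of the decidable equality.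
Enumeration : Setoid c ℓ → Set _
Enumeration S = ∃[ xs ] ∀ x → Any (x ≈_) xs
  where open Setoid S

module _ (S : Setoid c ℓ) where
  open Setoid S

  module _ {P : Pred Carrier r} (P? : ∀ x → Dec (P x)) where

    select : List Carrier → List (Σ[ x ∈ Carrier ] P x)
    select []       = []
    select (x ∷ xs) with P? x
    ... | yes px = (x , px) ∷ select xs
    ... | no  _  = select xs

    select-complete : (∀ {x y} → x ≈ y → P x → P y) →
      ∀ {x xs} → P x → Any (x ≈_) xs → Any (λ (y , _) → x ≈ y) (select xs)
    select-complete resp {x} {y ∷ _} px (here x≈y) with P? y
    ... | yes _  = here x≈y
    ... | no ¬py = ⊥-elim (¬py (resp x≈y px))
    select-complete resp {x} {y ∷ _} px (there x∈xs) with P? y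
    ... | yes _ = there (select-complete resp px x∈xs)
    ... | no  _ = select-complete resp px x∈xs

    restrict : (∀ {x y} → x ≈ y → P x → P y) →
               Enumeration S → Enumeration (On.setoid {B = Σ[ x ∈ Carrier ] P x} S proj₁)
    restrict resp (xs , complete) = select xs , λ (x , px) → select-complete resp px (complete x)

  cardinality : Binary.Decidable _≈_ → Enumeration S → ∃[ n ] HasCardinality S n
  cardinality _≟_ (xs , complete) with deduplicate xs
    where
    deduplicate : ∀ xs → ∃[ ys ] (AllPairs (λ x y → ¬ x ≈ y) ys × (∀ {x} → Any (x ≈_) xs → Any (x ≈_) ys))
    deduplicate []       = [] , [] , λ ()
    deduplicate (x ∷ xs) with deduplicate xs
    ... | ys , unique , ⊆ys with Any.any? (x ≟_) ys
    ...   | yes x∈ys = ys , unique , λ { (here y≈x) → Any.map (trans y≈x) x∈ys ; (there y∈xs) → ⊆ys y∈xs }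
    ...   | no  x∉ys = x ∷ ys , All.¬Any⇒All¬ ys x∉ys ∷ unique ,
                       λ { (here y≈x) → here y≈x ; (there y∈xs) → there (⊆ys y∈xs) }
  ... | ys , unique , ⊆ys = List.length ys , record
    { to        = List.lookup ys
    ; from      = λ x → Any.index (member x)
    ; to-cong   = λ i≡j → reflexive (≡.cong (List.lookup ys) i≡j)
    ; from-cong = λ {x} {y} x≈y → lookup-injective unique
        (trans (sym (Any.lookup-index (member x))) (trans x≈y (Any.lookup-index (member y))))
    ; inverse   = (λ {x} i≡ → trans (reflexive (≡.cong (List.lookup ys) i≡)) (sym (Any.lookup-index (member x))))
                , λ {i} {x} x≈ → lookup-injective unique (trans (sym (Any.lookup-index (member x))) x≈)
    }
    where
    member : ∀ x → Any (x ≈_) ys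
    member x = ⊆ys (complete x)
    lookup-injective : ∀ {zs} → AllPairs (λ x y → ¬ x ≈ y) zs → ∀ {i j} → List.lookup zs i ≈ List.lookup zs j → i ≡ j
    lookup-injective (x∉ ∷ u) {Fin.zero}  {Fin.zero}  eq = ≡.refl
    lookup-injective (x∉ ∷ u) {Fin.zero}  {Fin.suc j} eq = ⊥-elim (All.lookup x∉ (∈-lookup j) eq)
    lookup-injective (x∉ ∷ u) {Fin.suc i} {Fin.zero}  eq = ⊥-elim (All.lookup x∉ (∈-lookup i) (sym eq))
    lookup-injective (x∉ ∷ u) {Fin.suc i} {Fin.suc j} eq = ≡.cong Fin.suc (lookup-injective u eq)

product-enumeration : {S : Setoid c ℓ} {T : Setoid c ℓ} → Enumeration S → Enumeration T → Enumeration (S ×ₛ T)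
product-enumeration (xs , x∈) (ys , y∈) = List.cartesianProduct xs ys ,
  λ (x , y) → Any.cartesianProductWith⁺ _,_ _,_ (x∈ x) (y∈ y)

-- Unique factorization and the Möbius function

module UniqueFactorization (R : RawRing c ℓ) (isSizedUFD : IsSizedUFD R) where
  open IsSizedUFD isSizedUFD using (isSizedDomain; prime) public
  open SizedDomain R isSizedDomain public

  NonZero : Set _
  NonZero = Σ[ x ∈ Carrier ] x ≉ 0#

  infix 4 _∥?_
  _∥?_ : ∀ x y → Dec (x ∥ y)
  x ∥? y = (x ∣? y) Dec.×-dec (y ∣? x)

  ∥-cancelˡ : ∀ {x y z} → x ≉ 0# → x * y ∥ x * z → y ∥ z
  ∥-cancelˡ x≉0 (p , q) = ∣-cancelˡ x≉0 p , ∣-cancelˡ x≉0 q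

  irreducible-factor : ∀ {x} → x ≉ 0# → x ∤ 1# → ∃[ p ] (Irreducible p × p ∣ x)
  irreducible-factor x≉0 x∤1 with factor x≉0
  ... | []     , _       , (x∣1 , _)  = ⊥-elim (x∤1 x∣1)
  ... | p ∷ ps , irr ∷ _ , (_ , ps∣x) = p , irr , ∣ʳ-trans (x∣xy p _) ps∣x

  prime-∣-product : ∀ {p qs} → Irreducible p → All Irreducible qs → p ∣ product qs → Any (p ∥_) qs
  prime-∣-product irr []             p∣1 = ⊥-elim (p∤1 irr p∣1)
  prime-∣-product irr (irr-q ∷ irrs) p∣  with prime irr p∣
  ... | inj₁ p∣q  = here (irreducible-∣-irreducible irr irr-q p∣q)
  ... | inj₂ p∣qs = there (prime-∣-product irr irrs p∣qs)

  remove-factor : ∀ {p qs} → All Irreducible qs → Any (p ∥_) qs →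
    ∃[ rs ] (All Irreducible rs × List.length qs ≡ suc (List.length rs) × p * product rs ∥ product qs)
  remove-factor {qs = q ∷ qs} (_ ∷ irrs) (here p∥q) = qs , irrs , ≡.refl , *-cong-∥ p∥q ∥-refl
  remove-factor {p} {q ∷ qs} (irr ∷ irrs) (there p∈qs) with remove-factor irrs p∈qs
  ... | rs , irr-rs , len , assoc = q ∷ rs , irr ∷ irr-rs , ≡.cong suc len ,
    ∥-trans (∥-reflexive (x∙yz≈y∙xz p q (product rs))) (*-cong-∥ ∥-refl assoc)

  -- The uniqueness of factorization in the form that `möbius` requires: the number of factors
  -- determines the sign.
  length-unique : ∀ {ps qs} → All Irreducible ps → All Irreducible qs →
                  product ps ∥ product qs → List.length ps ≡ List.length qs
  length-unique []          []          _           = ≡.refl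
  length-unique []          (irr ∷ _)   (_ , qs∣1)  = ⊥-elim (p∤1 irr (∣ʳ-trans (x∣xy _ _) qs∣1))
  length-unique {p ∷ ps} (irr ∷ irrs) irr-qs ps∥qs
    with remove-factor irr-qs (prime-∣-product irr irr-qs (∣ʳ-trans (x∣xy p _) (proj₁ ps∥qs)))
  ... | rs , irr-rs , len , assoc = ≡.trans
    (≡.cong suc (length-unique irrs irr-rs (∥-cancelˡ (irreducible⇒≉0 irr) (∥-trans ps∥qs (∥-sym assoc)))))
    (≡.sym len)

  Distinct : List Carrier → Set _
  Distinct = AllPairs (λ p q → ¬ (p ∥ q))

  Squareful : Carrier → Set _
  Squareful x = ∃[ p ] (Irreducible p × p * p ∣ x)

  square-∣-* : ∀ {p x y} → Irreducible p → ¬ (p ∣ x) → p * p ∣ x * y → p * p ∣ y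
  square-∣-* {p} {x} {y} irr p∤x p²∣xy with prime irr (∣ʳ-trans (x∣xy p p) p²∣xy)
  ... | inj₁ p∣x = ⊥-elim (p∤x p∣x)
  ... | inj₂ (u , up≈y)
    with prime irr (∣-cancelˡ (irreducible⇒≉0 irr) (∣ʳ-respʳ-≈ xy≈pxu p²∣xy))
    where
    xy≈pxu : x * y ≈ p * (x * u)
    xy≈pxu = trans (*-congˡ (sym up≈y)) (x∙yz≈z∙xy x u p)
  ...   | inj₁ p∣x = ⊥-elim (p∤x p∣x)
  ...   | inj₂ p∣u = ∣ʳ-respʳ-≈ (trans (*-comm p u) up≈y) (x∣y⇒zx∣zy p p∣u)

  distinct⇒¬squareful : ∀ {ps} → All Irreducible ps → Distinct ps → ¬ Squareful (product ps)
  distinct⇒¬squareful []            _           (p , irr , p²∣1) = p∤1 irr (∣ʳ-trans (x∣xy p p) p²∣1)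
  distinct⇒¬squareful {q ∷ qs} (irr-q ∷ irrs) (q∦qs ∷ dist) (p , irr , p²∣qqs) with p ∣? q
  ... | no  p∤q = distinct⇒¬squareful irrs dist (p , irr , square-∣-* irr p∤q p²∣qqs)
  -- Here p and q are associates, so q q divides q times the product of qs. After one q is
  -- cancelled, q is an associate of a later factor.
  ... | yes p∣q = All.All¬⇒¬Any q∦qs (prime-∣-product irr-q irrs q∣qs)
    where
    q∣p : q ∣ p
    q∣p = proj₂ (irreducible-∣-irreducible irr irr-q p∣q)
    q∣qs : q ∣ product qs
    q∣qs = ∣-cancelˡ (irreducible⇒≉0 irr-q) (∣ʳ-trans (∙-cong-∣ q∣p q∣p) p²∣qqs)

  distinct? : ∀ {ps} → All Irreducible ps → Distinct ps ⊎ Squareful (product ps)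
  distinct? []                     = inj₁ []
  distinct? {p ∷ ps} (irr ∷ irrs) with Any.any? (p ∥?_) ps
  ... | yes p∈ps = inj₂ (p , irr , x∣y⇒zx∣zy p (p∣ p∈ps))
    where
    p∣ : ∀ {qs} → Any (p ∥_) qs → p ∣ product qs
    p∣ (here (p∣q , _)) = ∣ʳ-trans p∣q (x∣xy _ _)
    p∣ (there p∈qs)     = ∣ʳ-trans (p∣ p∈qs) (x∣yx _ _)
  ... | no  p∉ps with distinct? irrs
  ...   | inj₁ dist                = inj₁ (All.¬Any⇒All¬ ps p∉ps ∷ dist)
  ...   | inj₂ (q , irr-q , q²∣ps) = inj₂ (q , irr-q , ∣ʳ-trans q²∣ps (x∣yx _ p))

  -- The two clauses that specify μ cover all non-zero elements. Hence they determine μ, force it to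
  -- be constant on associates, and allow `möbius` to be defined by cases.
  squarefree-or-squareful : ∀ {x} → x ≉ 0# →
    (∃[ ps ] (All Irreducible ps × Distinct ps × x ∥ product ps)) ⊎ Squareful x
  squarefree-or-squareful x≉0 with factor x≉0
  ... | ps , irrs , x∥ps with distinct? irrs
  ...   | inj₁ dist              = inj₁ (ps , irrs , dist , x∥ps)
  ...   | inj₂ (p , irr , p²∣ps) = inj₂ (p , irr , ∣ʳ-trans p²∣ps (proj₂ x∥ps))

  -- The Möbius function

  record IsMöbiusFunction (μ : NonZero → ℤ) : Set (c Level.⊔ ℓ) where
    field
      squarefree : ∀ x {ps} → All Irreducible ps → Distinct ps → proj₁ x ∥ product ps →
                   μ x ≡ -1ℤ ℤ.^ List.length ps
      squareful  : ∀ x → Squareful (proj₁ x) → μ x ≡ 0ℤ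

    μ-cong : ∀ {x y} → proj₁ x ∥ proj₁ y → μ x ≡ μ y
    μ-cong {x} {y} x∥y with squarefree-or-squareful (proj₂ y)
    ... | inj₁ (ps , irrs , dist , y∥ps) =
      ≡.trans (squarefree x irrs dist (∥-trans x∥y y∥ps)) (≡.sym (squarefree y irrs dist y∥ps))
    ... | inj₂ (p , irr , p²∣y) =
      ≡.trans (squareful x (p , irr , ∣ʳ-trans p²∣y (proj₂ x∥y))) (≡.sym (squareful y (p , irr , p²∣y)))

    μ-unit : ∀ x → proj₁ x ∥ 1# → μ x ≡ 1ℤ
    μ-unit x x∥1 = squarefree x [] [] x∥1

    μ-prime-* : ∀ {p x y} → Irreducible p → ¬ (p ∣ proj₁ x) → proj₁ y ∥ p * proj₁ x → μ y ≡ ℤ.- μ x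
    μ-prime-* {p} {x} {y} irr p∤x y∥px with squarefree-or-squareful (proj₂ x)
    ... | inj₁ (ps , irrs , dist , x∥ps) = ≡.trans
      (squarefree y (irr ∷ irrs) (All.map (λ q∣x p∥q → p∤x (∣ʳ-trans (proj₁ p∥q) q∣x)) (factors∣ irrs (proj₂ x∥ps)) ∷ dist)
        (∥-trans y∥px (*-cong-∥ ∥-refl x∥ps)))
      (≡.trans (ℤ.-1*i≡-i _) (≡.cong ℤ.-_ (≡.sym (squarefree x irrs dist x∥ps))))
      where
      factors∣ : ∀ {qs} → All Irreducible qs → product qs ∣ proj₁ x → All (_∣ proj₁ x) qs
      factors∣ []       _    = []
      factors∣ (_ ∷ is) qs∣x = ∣ʳ-trans (x∣xy _ _) qs∣x ∷ factors∣ is (∣ʳ-trans (x∣yx _ _) qs∣x)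
    ... | inj₂ (q , irr-q , q²∣x) = ≡.trans
      (squareful y (q , irr-q , ∣ʳ-trans q²∣x (∣ʳ-trans (x∣yx _ p) (proj₂ y∥px))))
      (≡.cong ℤ.-_ (≡.sym (squareful x (q , irr-q , q²∣x))))

    μ-prime-∣ : ∀ {p} {x y : NonZero} → Irreducible p → p ∣ proj₁ x → proj₁ y ∥ p * proj₁ x → μ y ≡ 0ℤ
    μ-prime-∣ {p} {x} {y} irr p∣x y∥px =
      squareful y (p , irr , ∣ʳ-trans (x∣y⇒zx∣zy p p∣x) (proj₂ y∥px))

  möbius : NonZero → ℤ
  möbius (x , x≉0) = Sum.[ (λ (ps , _) → -1ℤ ℤ.^ List.length ps) , (λ _ → 0ℤ) ]′ (squarefree-or-squareful x≉0)

  möbius-isMöbius : IsMöbiusFunction möbius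
  möbius-isMöbius = record { squarefree = sf ; squareful = sq }
    where
    sf : ∀ x {ps} → All Irreducible ps → Distinct ps → proj₁ x ∥ product ps → möbius x ≡ -1ℤ ℤ.^ List.length ps
    sf (x , x≉0) irrs dist x∥ps with squarefree-or-squareful x≉0
    ... | inj₁ (qs , irr-qs , _ , x∥qs) =
      ≡.cong (-1ℤ ℤ.^_) (length-unique irr-qs irrs (∥-trans (∥-sym x∥qs) x∥ps))
    ... | inj₂ (p , irr , p²∣x) = ⊥-elim (distinct⇒¬squareful irrs dist (p , irr , ∣ʳ-trans p²∣x (proj₁ x∥ps)))
    sq : ∀ x → Squareful (proj₁ x) → möbius x ≡ 0ℤ
    sq (x , x≉0) (p , irr , p²∣x) with squarefree-or-squareful x≉0
    ... | inj₁ (qs , irr-qs , dist , x∥qs) =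
      ⊥-elim (distinct⇒¬squareful irr-qs dist (p , irr , ∣ʳ-trans p²∣x (proj₁ x∥qs)))
    ... | inj₂ _ = ≡.refl

  Coprime : Carrier → Carrier → Set _
  Coprime x y = ∀ {e} → e ∣ x × e ∣ y → e ∣ 1#

  coprime-or-common-prime : ∀ {x y} → x ≉ 0# → Coprime x y ⊎ ∃[ p ] (Irreducible p × p ∣ x × p ∣ y)
  coprime-or-common-prime {x} {y} x≉0
    with find {P = λ e → e ∤ 1# × e ∣ x × e ∣ y} (size x)
           (λ { e≈e′ (e∤1 , e∣x , e∣y) → e∤1 ∘ ∣ʳ-respˡ-≈ (sym e≈e′) , ∣ʳ-respˡ-≈ e≈e′ e∣x , ∣ʳ-respˡ-≈ e≈e′ e∣y })
           (λ { e (_ , e∣x , _) → ∣⇒size≤ x≉0 e∣x })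
           (λ e → Dec.¬? (e ∣? 1#) Dec.×-dec ((e ∣? x) Dec.×-dec (e ∣? y)))
  ... | no none = inj₁ λ {e} (e∣x , e∣y) → Dec.decidable-stable (e ∣? 1#) λ e∤1 → none (e , e∤1 , e∣x , e∣y)
  ... | yes (e , e∤1 , e∣x , e∣y) with irreducible-factor (∣-≉0 e∣x x≉0) e∤1
  ...   | p , irr , p∣e = inj₂ (p , irr , ∣ʳ-trans p∣e e∣x , ∣ʳ-trans p∣e e∣y)

  coprime? : ∀ {x} → x ≉ 0# → ∀ y → Dec (Coprime x y)
  coprime? x≉0 y with coprime-or-common-prime {y = y} x≉0
  ... | inj₁ cop                    = yes cop
  ... | inj₂ (p , irr , p∣x , p∣y)  = no λ cop → p∤1 irr (cop (p∣x , p∣y))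

-- Finite sums and power series

module FiniteSums where
  open import Data.Integer.Base using (_+_; _*_; _-_; -_)
  open import Algebra.Properties.Semiring.Sum ℤ.+-*-semiring
    using (sum; sum-cong-≗; ∑-comm; ∑-distrib-+; *-distribˡ-sum; *-distribʳ-sum; sum-replicate-zero)
  import Algebra.Properties.Semiring.Sum ℕ.+-*-semiring as ℕ-Sum
  import Algebra.Properties.CommutativeMonoid.Sum ℕ.*-1-commutativeMonoid as ℕ-Product

  private
    variable
      a : Level
      A : Set a
      m n : ℕ

  -- The Iverson bracket.
  ⟦_⟧ : Dec A → ℤ
  ⟦ A? ⟧ = if does A? then 1ℤ else 0ℤ

  ⟦⟧-true : (A? : Dec A) → A → ⟦ A? ⟧ ≡ 1ℤ
  ⟦⟧-true (yes _) _ = ≡.refl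
  ⟦⟧-true (no ¬a) a = ⊥-elim (¬a a)

  ⟦⟧-false : (A? : Dec A) → ¬ A → ⟦ A? ⟧ ≡ 0ℤ
  ⟦⟧-false (yes a) ¬a = ⊥-elim (¬a a)
  ⟦⟧-false (no _)  _  = ≡.refl

  ⟦⟧-cong : ∀ {b} {B : Set b} (A? : Dec A) (B? : Dec B) → (A → B) → (B → A) → ⟦ A? ⟧ ≡ ⟦ B? ⟧
  ⟦⟧-cong (yes a) B? to from = ≡.sym (⟦⟧-true B? (to a))
  ⟦⟧-cong (no ¬a) B? to from = ≡.sym (⟦⟧-false B? (¬a ∘ from))

  ⟦⟧-× : ∀ {b} {B : Set b} (A? : Dec A) (B? : Dec B) → ⟦ A? Dec.×-dec B? ⟧ ≡ ⟦ A? ⟧ * ⟦ B? ⟧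
  ⟦⟧-× (yes _) (yes _) = ≡.refl
  ⟦⟧-× (yes _) (no _)  = ≡.refl
  ⟦⟧-× (no _)  (yes _) = ≡.refl
  ⟦⟧-× (no _)  (no _)  = ≡.refl

  sum-zero : {f : Fin n → ℤ} → (∀ i → f i ≡ 0ℤ) → sum f ≡ 0ℤ
  sum-zero {n} f≡0 = ≡.trans (sum-cong-≗ f≡0) (sum-replicate-zero n)

  sum-ones : ∀ n → sum {n} (λ _ → 1ℤ) ≡ + n
  sum-ones zero    = ≡.refl
  sum-ones (suc n) = ≡.cong (_+_ 1ℤ) (sum-ones n)

  sum-neg : (f : Fin n → ℤ) → sum (λ i → - f i) ≡ - sum f
  sum-neg f = ≡.trans (sum-cong-≗ λ i → ≡.sym (ℤ.-1*i≡-i (f i)))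
    (≡.trans (≡.sym (*-distribˡ-sum -1ℤ f)) (ℤ.-1*i≡-i (sum f)))

  sum-unique : {Q : Fin n → Set r} (Q? : ∀ i → Dec (Q i)) (i : Fin n) → Q i → (∀ j → Q j → j ≡ i) →
               sum (λ j → ⟦ Q? j ⟧) ≡ 1ℤ
  sum-unique Q? Fin.zero    q unique = ≡.cong₂ _+_ (⟦⟧-true (Q? Fin.zero) q)
    (sum-zero λ j → ⟦⟧-false (Q? (Fin.suc j)) λ q′ → Fin.0≢1+n (≡.sym (unique _ q′)))
  sum-unique Q? (Fin.suc i) q unique = ≡.cong₂ _+_ (⟦⟧-false (Q? Fin.zero) λ q′ → Fin.0≢1+n (unique _ q′))
    (sum-unique (Q? ∘ Fin.suc) i q λ j q′ → Fin.suc-injective (unique _ q′))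

  ∃!-Fin : (Fin n → Set r) → Set r
  ∃!-Fin Q = ∃[ i ] (Q i × ∀ j → Q j → j ≡ i)

  -- Both sides are the double sum of f i over the pairs (i , j) related by R.
  sum-correspondence : {R : Fin m → Fin n → Set r} (R? : ∀ i j → Dec (R i j)) {f : Fin m → ℤ} {g : Fin n → ℤ} →
    (∀ i j → R i j → f i ≡ g j) →
    (∀ i → f i ≡ 0ℤ ⊎ ∃!-Fin (R i)) → (∀ j → g j ≡ 0ℤ ⊎ ∃!-Fin (λ i → R i j)) →
    sum f ≡ sum g
  sum-correspondence {R = R} R? {f} {g} agree left right = begin
    sum f                                        ≡⟨ sum-cong-≗ (λ i → expand (R? i) (left i)) ⟩
    sum (λ i → sum λ j → ⟦ R? i j ⟧ * f i)       ≡⟨ ∑-comm (λ i j → ⟦ R? i j ⟧ * f i) ⟩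
    sum (λ j → sum λ i → ⟦ R? i j ⟧ * f i)       ≡⟨ sum-cong-≗ (λ j → sum-cong-≗ λ i → exchange (R? i j) (agree i j)) ⟩
    sum (λ j → sum λ i → ⟦ R? i j ⟧ * g j)       ≡⟨ sum-cong-≗ (λ j → expand (λ i → R? i j) (right j)) ⟨
    sum g                                        ∎
    where
    open ≡-Reasoning
    expand : ∀ {k x} {Q : Fin k → Set _} (Q? : ∀ j → Dec (Q j)) → x ≡ 0ℤ ⊎ ∃!-Fin Q →
             x ≡ sum (λ j → ⟦ Q? j ⟧ * x)
    expand Q? (inj₁ ≡.refl) = ≡.sym (sum-zero λ j → ℤ.*-zeroʳ ⟦ Q? j ⟧)
    expand {x = x} Q? (inj₂ (j , q , unique)) = begin
      x                          ≡⟨ ℤ.*-identityˡ x ⟨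
      1ℤ * x                     ≡⟨ ≡.cong (_* x) (sum-unique Q? j q unique) ⟨
      sum (λ j → ⟦ Q? j ⟧) * x   ≡⟨ *-distribʳ-sum x (λ j → ⟦ Q? j ⟧) ⟩
      sum (λ j → ⟦ Q? j ⟧ * x)   ∎
    exchange : ∀ {x y} {B : Set _} (B? : Dec B) → (B → x ≡ y) → ⟦ B? ⟧ * x ≡ ⟦ B? ⟧ * y
    exchange (yes b) eq = ≡.cong (1ℤ *_) (eq b)
    exchange (no _)  _  = ≡.refl

  sumTo : ℕ → (ℕ → ℤ) → ℤ
  sumTo n f = sum {n} (f ∘ toℕ)

  sumTo-zero : ∀ n {f : ℕ → ℤ} → (∀ i → f i ≡ 0ℤ) → sumTo n f ≡ 0ℤ
  sumTo-zero n f≡0 = sum-zero {n} λ i → f≡0 (toℕ i)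

  sumTo-cong : ∀ n {f g : ℕ → ℤ} → (∀ i → i < n → f i ≡ g i) → sumTo n f ≡ sumTo n g
  sumTo-cong n f≡g = sum-cong-≗ λ i → f≡g (toℕ i) (Fin.toℕ<n i)

  sumTo-truncate : ∀ {k n f} → (∀ i → k ≤ i → f i ≡ 0ℤ) → k ≤ n → sumTo n f ≡ sumTo k f
  sumTo-truncate {zero}  {n}         vanish _         = sumTo-zero n λ i → vanish i z≤n
  sumTo-truncate {suc k} {suc n} {f} vanish (s≤s k≤n) =
    ≡.cong (_+_ (f 0)) (sumTo-truncate (λ i k≤i → vanish (suc i) (s≤s k≤i)) k≤n)

  -- A function F : ℕ → ℤ stands for the power series Σ F d t^d: then
  -- shifted e F is t^e F, and Δ e F is (1 - t^e) F.

  shifted : ℕ → (ℕ → ℤ) → ℕ → ℤ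
  shifted zero    F d       = F d
  shifted (suc e) F zero    = 0ℤ
  shifted (suc e) F (suc d) = shifted e F d

  Δ : ℕ → (ℕ → ℤ) → ℕ → ℤ
  Δ e F d = F d - shifted e F d

  shifted-+ : ∀ e F d → shifted e F (e ℕ.+ d) ≡ F d
  shifted-+ zero    F d = ≡.refl
  shifted-+ (suc e) F d = shifted-+ e F d

  shifted-< : ∀ {e d} F → d < e → shifted e F d ≡ 0ℤ
  shifted-< {suc e} {zero}  F _         = ≡.refl
  shifted-< {suc e} {suc d} F (s≤s d<e) = shifted-< F d<e

  shifted-shifted : ∀ e e′ F d → shifted e (shifted e′ F) d ≡ shifted (e ℕ.+ e′) F d
  shifted-shifted zero    e′ F d       = ≡.refl
  shifted-shifted (suc e) e′ F zero    = ≡.refl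
  shifted-shifted (suc e) e′ F (suc d) = shifted-shifted e e′ F d

  shifted-cong : ∀ e {F G d} → (∀ i → i ≤ d → F i ≡ G i) → shifted e F d ≡ shifted e G d
  shifted-cong zero            F≡G = F≡G _ ℕ.≤-refl
  shifted-cong (suc e) {d = zero}  F≡G = ≡.refl
  shifted-cong (suc e) {d = suc d} F≡G = shifted-cong e λ i i≤d → F≡G i (ℕ.m≤n⇒m≤1+n i≤d)

  Δ-cong : ∀ e {F G d} → (∀ i → i ≤ d → F i ≡ G i) → Δ e F d ≡ Δ e G d
  Δ-cong e F≡G = ≡.cong₂ _-_ (F≡G _ ℕ.≤-refl) (shifted-cong e F≡G)

  shifted-sum : ∀ e n (β : ℕ → ℤ) (G : ℕ → ℕ → ℤ) d →
    shifted e (λ d → sumTo n λ i → β i * G i d) d ≡ sumTo n (λ i → β i * shifted e (G i) d)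
  shifted-sum zero    n β G d       = ≡.refl
  shifted-sum (suc e) n β G zero    = ≡.sym (sumTo-zero n λ i → ℤ.*-zeroʳ (β i))
  shifted-sum (suc e) n β G (suc d) = shifted-sum e n β G d

  sumTo-shifted : ∀ e n F → sumTo n (shifted e F) ≡ sumTo (n ℕ.∸ e) F
  sumTo-shifted zero    n       F = ≡.refl
  sumTo-shifted (suc e) zero    F = ≡.refl
  sumTo-shifted (suc e) (suc n) F = ≡.trans (ℤ.+-identityˡ _) (sumTo-shifted e n F)

  -- The value of (1 - t^e) F at t = 1 is 0 when F is a polynomial. The hypothesis puts the degree
  -- of F below n - e, so that t^e F also fits below n and the truncated sums cancel.
  sumTo-Δ : ∀ e n {F} → (∀ d → n ≤ d ℕ.+ e → F d ≡ 0ℤ) → sumTo n (Δ e F) ≡ 0ℤ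
  sumTo-Δ e n {F} vanish = begin
    sumTo n (Δ e F)                                 ≡⟨ ∑-distrib-+ {n} (F ∘ toℕ) (λ i → - shifted e F (toℕ i)) ⟩
    sumTo n F + sum {n} (λ i → - shifted e F (toℕ i)) ≡⟨ ≡.cong (_+_ (sumTo n F)) (sum-neg {n} (shifted e F ∘ toℕ)) ⟩
    sumTo n F - sumTo n (shifted e F)               ≡⟨ ≡.cong₂ _-_ truncate (sumTo-shifted e n F) ⟩
    sumTo (n ℕ.∸ e) F - sumTo (n ℕ.∸ e) F           ≡⟨ ℤ.+-inverseʳ (sumTo (n ℕ.∸ e) F) ⟩
    0ℤ                                              ∎
    where
    open ≡-Reasoning
    truncate : sumTo n F ≡ sumTo (n ℕ.∸ e) F
    truncate = sumTo-truncate
      (λ d n∸e≤d → vanish d (ℕ.≤-trans (ℕ.m≤n+m∸n n e) (≡.subst (e ℕ.+ (n ℕ.∸ e) ≤_) (ℕ.+-comm e d) (ℕ.+-monoʳ-≤ e n∸e≤d))))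
      (ℕ.m∸n≤m n e)

  Δ^ : ℕ → ℕ → (ℕ → ℤ) → ℕ → ℤ
  Δ^ zero    e F = F
  Δ^ (suc M) e F = Δ e (Δ^ M e F)

  signedBinomial : ℕ → ℕ → ℤ
  signedBinomial M a = -1ℤ ℤ.^ a * + (M C a)

  signedBinomial-pascal : ∀ M a → signedBinomial (suc M) (suc a) ≡ signedBinomial M (suc a) - signedBinomial M a
  signedBinomial-pascal M a = begin
    -1ℤ * s * + (suc M C suc a)                  ≡⟨ ≡.cong (λ x → -1ℤ * s * + x) (nCk+nC[k+1]≡[n+1]C[k+1] M a) ⟨
    -1ℤ * s * (+ (M C a) + + (M C suc a))        ≡⟨ ℤ.*-distribˡ-+ (-1ℤ * s) (+ (M C a)) (+ (M C suc a)) ⟩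
    -1ℤ * s * + (M C a) + -1ℤ * s * + (M C suc a) ≡⟨ ℤ.+-comm (-1ℤ * s * + (M C a)) _ ⟩
    -1ℤ * s * + (M C suc a) + -1ℤ * s * + (M C a) ≡⟨ ≡.cong (_+_ (-1ℤ * s * + (M C suc a))) (≡.trans (ℤ.*-assoc -1ℤ s (+ (M C a))) (ℤ.-1*i≡-i _)) ⟩
    -1ℤ * s * + (M C suc a) - s * + (M C a)      ∎
    where
    open ≡-Reasoning
    s = -1ℤ ℤ.^ a

  -- The binomial expansion of (1 - t^e)^M.
  Δ^-expansion : ∀ M e b F d → 0 < e → d ≤ b →
    Δ^ M e F d ≡ sumTo (suc b) (λ a → signedBinomial M a * shifted (e ℕ.* a) F d)
  Δ^-expansion zero e b F d 0<e d≤b = ≡.sym (begin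
    1ℤ * + (0 C 0) * shifted (e ℕ.* 0) F d + sumTo b (λ a → signedBinomial 0 (suc a) * shifted (e ℕ.* suc a) F d)
      ≡⟨ ≡.cong₂ _+_ (≡.trans (ℤ.*-identityˡ _) (≡.cong (λ k → shifted k F d) (ℕ.*-zeroʳ e)))
           (sumTo-zero b λ a → ≡.cong (_* shifted (e ℕ.* suc a) F d) (vanish a)) ⟩
    F d + 0ℤ  ≡⟨ ℤ.+-identityʳ (F d) ⟩
    F d       ∎)
    where
    open ≡-Reasoning
    vanish : ∀ a → signedBinomial 0 (suc a) ≡ 0ℤ
    vanish a = ≡.trans (≡.cong (λ x → -1ℤ ℤ.^ suc a * + x) (k>n⇒nCk≡0 {0} {suc a} (s≤s z≤n))) (ℤ.*-zeroʳ (-1ℤ ℤ.^ suc a))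
  Δ^-expansion (suc M) e b F d 0<e d≤b = begin
    Δ^ M e F d - shifted e (Δ^ M e F) d
      ≡⟨ ≡.cong₂ _-_ (Δ^-expansion M e b F d 0<e d≤b)
           (≡.trans (shifted-cong e λ i i≤d → Δ^-expansion M e b F i 0<e (ℕ.≤-trans i≤d d≤b))
             (≡.trans (shifted-sum e (suc b) (β M) (λ a → shifted (e ℕ.* a) F) d)
               (≡.trans (sumTo-cong (suc b) λ a _ → ≡.cong (β M a *_)
                          (≡.trans (shifted-shifted e (e ℕ.* a) F d) (≡.cong (λ k → shifted k F d) (≡.sym (ℕ.*-suc e a)))))
                        -- The term a = b vanishes because e (b + 1) exceeds d. Dropping it lines
                        -- this sum up with the terms a + 1 of the other one, as Pascal's rule
                        -- needs.
                        (sumTo-truncate {b} {suc b} {λ a → β M a * sh (suc a)} vanish (ℕ.n≤1+n b))))) ⟩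
    β M 0 * sh 0 + sumTo b (λ a → β M (suc a) * sh (suc a)) - sumTo b (λ a → β M a * sh (suc a))
      ≡⟨ ℤ.+-assoc (β M 0 * sh 0) (sumTo b (λ a → β M (suc a) * sh (suc a))) _ ⟩
    β M 0 * sh 0 + (sumTo b (λ a → β M (suc a) * sh (suc a)) - sumTo b (λ a → β M a * sh (suc a)))
      ≡⟨ ≡.cong (_+_ (β M 0 * sh 0)) (≡.cong (_+_ (sumTo b (λ a → β M (suc a) * sh (suc a))))
           (≡.sym (sum-neg {b} (λ i → β M (toℕ i) * sh (suc (toℕ i)))))) ⟩
    β M 0 * sh 0 + (sumTo b (λ a → β M (suc a) * sh (suc a)) + sumTo b (λ a → - (β M a * sh (suc a))))
      ≡⟨ ≡.cong (_+_ (β M 0 * sh 0)) (∑-distrib-+ {b} (λ i → β M (suc (toℕ i)) * sh (suc (toℕ i))) (λ i → - (β M (toℕ i) * sh (suc (toℕ i))))) ⟨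
    β M 0 * sh 0 + sumTo b (λ a → β M (suc a) * sh (suc a) - β M a * sh (suc a))
      ≡⟨ ≡.cong (_+_ (β M 0 * sh 0)) (sumTo-cong b λ a _ → pascal a) ⟩
    β (suc M) 0 * sh 0 + sumTo b (λ a → β (suc M) (suc a) * sh (suc a))  ∎
    where
    open ≡-Reasoning
    β = signedBinomial
    sh : ℕ → ℤ
    sh a = shifted (e ℕ.* a) F d
    vanish : ∀ a → b ≤ a → β M a * sh (suc a) ≡ 0ℤ
    vanish a b≤a = ≡.trans (≡.cong (β M a *_) (shifted-< F (ℕ.≤-trans (s≤s (ℕ.≤-trans d≤b b≤a)) (ℕ.m≤n*m (suc a) e {{ℕ.>-nonZero 0<e}}))))
      (ℤ.*-zeroʳ (β M a))
    pascal : ∀ a → β M (suc a) * sh (suc a) - β M a * sh (suc a) ≡ β (suc M) (suc a) * sh (suc a)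
    pascal a = begin
      β M (suc a) * x - β M a * x        ≡⟨ ≡.cong (_+_ (β M (suc a) * x)) (ℤ.neg-distribˡ-* (β M a) x) ⟩
      β M (suc a) * x + - β M a * x      ≡⟨ ℤ.*-distribʳ-+ x (β M (suc a)) (- β M a) ⟨
      (β M (suc a) - β M a) * x          ≡⟨ ≡.cong (_* x) (signedBinomial-pascal M a) ⟨
      β (suc M) (suc a) * x              ∎
      where x = sh (suc a)

  -- Sums over lists and the expansion of the Euler product

  ∑ᴸ : (A → ℤ) → List A → ℤ
  ∑ᴸ f xs = List.foldr _+_ 0ℤ (List.map f xs)

  ∑ᴸ-cong : {f g : A → ℤ} → (∀ x → f x ≡ g x) → ∀ xs → ∑ᴸ f xs ≡ ∑ᴸ g xs
  ∑ᴸ-cong f≡g []       = ≡.refl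
  ∑ᴸ-cong f≡g (x ∷ xs) = ≡.cong₂ _+_ (f≡g x) (∑ᴸ-cong f≡g xs)

  ∑ᴸ-zero : {f : A → ℤ} → (∀ x → f x ≡ 0ℤ) → ∀ xs → ∑ᴸ f xs ≡ 0ℤ
  ∑ᴸ-zero f≡0 []       = ≡.refl
  ∑ᴸ-zero f≡0 (x ∷ xs) = ≡.cong₂ _+_ (f≡0 x) (∑ᴸ-zero f≡0 xs)

  *-distribˡ-∑ᴸ : ∀ β (f : A → ℤ) xs → β * ∑ᴸ f xs ≡ ∑ᴸ (λ x → β * f x) xs
  *-distribˡ-∑ᴸ β f []       = ℤ.*-zeroʳ β
  *-distribˡ-∑ᴸ β f (x ∷ xs) = ≡.trans (ℤ.*-distribˡ-+ β (f x) _) (≡.cong (_+_ (β * f x)) (*-distribˡ-∑ᴸ β f xs))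

  ∑ᴸ-map-++ : ∀ {b} {B : Set b} (f : B → ℤ) (g : A → B) xs ys →
              ∑ᴸ f (List.map g xs List.++ ys) ≡ ∑ᴸ (f ∘ g) xs + ∑ᴸ f ys
  ∑ᴸ-map-++ f g []       ys = ≡.sym (ℤ.+-identityˡ _)
  ∑ᴸ-map-++ f g (x ∷ xs) ys = ≡.trans (≡.cong (_+_ (f (g x))) (∑ᴸ-map-++ f g xs ys)) (≡.sym (ℤ.+-assoc (f (g x)) _ _))

  -- `upTo` is `applyUpTo id`; the recursion of `applyUpTo` changes the function, so g has to be
  -- general.
  ∑ᴸ-product : ∀ {b} {B : Set b} (f : B → ℤ) (_⊕_ : ℕ → A → B) g n ys →
    ∑ᴸ f (cartesianProductWith _⊕_ (applyUpTo g n) ys) ≡ sumTo n (λ i → ∑ᴸ (λ y → f (g i ⊕ y)) ys)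
  ∑ᴸ-product f _⊕_ g zero    ys = ≡.refl
  ∑ᴸ-product f _⊕_ g (suc n) ys =
    ≡.trans (∑ᴸ-map-++ f (g 0 ⊕_) ys _) (≡.cong (_+_ (∑ᴸ (λ y → f (g 0 ⊕ y)) ys)) (∑ᴸ-product f _⊕_ (g ∘ suc) n ys))

  ∑ᴸ-filter : ∀ {p} {P : A → Set p} (P? : ∀ x → Dec (P x)) (f : A → ℤ) xs →
              ∑ᴸ f (List.filter P? xs) ≡ ∑ᴸ (λ x → ⟦ P? x ⟧ * f x) xs
  ∑ᴸ-filter P? f []       = ≡.refl
  ∑ᴸ-filter P? f (x ∷ xs) with P? x
  ... | yes _ = ≡.cong₂ _+_ (≡.sym (ℤ.*-identityˡ (f x))) (∑ᴸ-filter P? f xs)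
  ... | no  _ = ≡.trans (∑ᴸ-filter P? f xs) (≡.sym (ℤ.+-identityˡ _))

  -- Multiplying the generating function Σ t x t^(w x) by t^k adds k to every weight. The successor
  -- case needs no rewriting, since the Boolean of `suc i ≟ suc j` computes to that of `i ≟ j`.
  shifted-∑ᴸ : ∀ k (w : A → ℕ) (t : A → ℤ) xs d →
    shifted k (λ d → ∑ᴸ (λ x → ⟦ w x ℕ.≟ d ⟧ * t x) xs) d ≡ ∑ᴸ (λ x → ⟦ k ℕ.+ w x ℕ.≟ d ⟧ * t x) xs
  shifted-∑ᴸ zero    w t xs d       = ≡.refl
  shifted-∑ᴸ (suc k) w t xs zero    = ≡.sym (∑ᴸ-zero (λ x → ≡.refl) xs)
  shifted-∑ᴸ (suc k) w t xs (suc d) = shifted-∑ᴸ k w t xs d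

  -- The power series 1.
  δ : ℕ → ℤ
  δ d = ⟦ 0 ℕ.≟ d ⟧

  -- The product of (1 - t^j)^(I j) over s < j ≤ s + n.
  eulerProduct : (ℕ → ℕ) → ℕ → ℕ → ℕ → ℤ
  eulerProduct I zero    s = δ
  eulerProduct I (suc n) s = Δ^ (I (suc s)) (suc s) (eulerProduct I n (suc s))

  module _ (I : ℕ → ℕ) where

    -- weight and binomialTerm, for an entry at position i standing for
    -- a_(s+i+1).
    weightFrom : ∀ {n} → ℕ → Vec ℕ n → ℕ
    weightFrom s []      = 0
    weightFrom s (a ∷ v) = suc s ℕ.* a ℕ.+ weightFrom (suc s) v

    termFrom : ∀ {n} → ℕ → Vec ℕ n → ℤ
    termFrom s []      = 1ℤ
    termFrom s (a ∷ v) = signedBinomial (I (suc s)) a * termFrom (suc s) v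

    weightFrom-sum : ∀ {n} s (v : Vec ℕ n) → weightFrom s v ≡ ℕ-Sum.sum (λ i → suc (s ℕ.+ toℕ i) ℕ.* lookup v i)
    weightFrom-sum s []      = ≡.refl
    weightFrom-sum s (a ∷ v) = ≡.cong₂ ℕ._+_
      (≡.cong (λ i → suc i ℕ.* a) (≡.sym (ℕ.+-identityʳ s)))
      (≡.trans (weightFrom-sum (suc s) v)
        (ℕ-Sum.sum-cong-≗ λ i → ≡.cong (λ j → suc j ℕ.* lookup v i) (≡.sym (ℕ.+-suc s (toℕ i)))))

    termFrom-product : ∀ {n} s (v : Vec ℕ n) →
      termFrom s v ≡ -1ℤ ℤ.^ Vec.sum v * + ℕ-Product.sum (λ i → I (suc (s ℕ.+ toℕ i)) C lookup v i)
    termFrom-product s []      = ≡.refl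
    termFrom-product s (a ∷ v) = begin
      -1ℤ ℤ.^ a * + x * termFrom (suc s) v                   ≡⟨ ≡.cong (-1ℤ ℤ.^ a * + x *_) (termFrom-product (suc s) v) ⟩
      -1ℤ ℤ.^ a * + x * (-1ℤ ℤ.^ Vec.sum v * + y)            ≡⟨ interchange (-1ℤ ℤ.^ a) (+ x) (-1ℤ ℤ.^ Vec.sum v) (+ y) ⟩
      -1ℤ ℤ.^ a * -1ℤ ℤ.^ Vec.sum v * (+ x * + y)            ≡⟨ ≡.cong₂ _*_ (ℤ.^-distribˡ-+-* -1ℤ a (Vec.sum v)) (ℤ.pos-* x y) ⟨
      -1ℤ ℤ.^ (a ℕ.+ Vec.sum v) * + (x ℕ.* y)                ≡⟨ ≡.cong (λ z → -1ℤ ℤ.^ (a ℕ.+ Vec.sum v) * + z)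
        (≡.cong₂ ℕ._*_ (≡.cong (λ i → I (suc i) C a) (≡.sym (ℕ.+-identityʳ s)))
          (ℕ-Product.sum-cong-≗ λ i → ≡.cong (λ j → I (suc j) C lookup v i) (≡.sym (ℕ.+-suc s (toℕ i))))) ⟩
      -1ℤ ℤ.^ Vec.sum (a ∷ v) * + ℕ-Product.sum (λ i → I (suc (s ℕ.+ toℕ i)) C lookup (a ∷ v) i)  ∎
      where
      open ≡-Reasoning
      open CommutativeSemigroupProperties ℤ.*-commutativeSemigroup using (interchange)
      x = I (suc s) C a
      y = ℕ-Product.sum (λ i → I (suc (suc s ℕ.+ toℕ i)) C lookup v i)

    -- The induction hypothesis is used at all degrees up to d while the bound b on the entries
    -- stays the same. Hence the hypothesis `d ≤ b`, although b = d is what is wanted in the end.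
    eulerProduct-expansion : ∀ n s b d → d ≤ b →
      eulerProduct I n s d ≡ ∑ᴸ (λ v → ⟦ weightFrom s v ℕ.≟ d ⟧ * termFrom s v) (boundedVectors b n)
    eulerProduct-expansion zero    s b d d≤b = ≡.sym (≡.trans (ℤ.+-identityʳ _) (ℤ.*-identityʳ _))
    eulerProduct-expansion (suc n) s b d d≤b = begin
      Δ^ (I (suc s)) (suc s) (eulerProduct I n (suc s)) d
        ≡⟨ Δ^-expansion (I (suc s)) (suc s) b (eulerProduct I n (suc s)) d (s≤s z≤n) d≤b ⟩
      sumTo (suc b) (λ a → β a * shifted (suc s ℕ.* a) (eulerProduct I n (suc s)) d)
        ≡⟨ sumTo-cong (suc b) (λ a _ → ≡.cong (β a *_) (≡.trans
             (shifted-cong (suc s ℕ.* a) λ i i≤d → eulerProduct-expansion n (suc s) b i (ℕ.≤-trans i≤d d≤b))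
             (shifted-∑ᴸ (suc s ℕ.* a) (weightFrom (suc s)) (termFrom (suc s)) vs d))) ⟩
      sumTo (suc b) (λ a → β a * ∑ᴸ (λ v → ⟦ weightFrom s (a ∷ v) ℕ.≟ d ⟧ * termFrom (suc s) v) vs)
        ≡⟨ sumTo-cong (suc b) (λ a _ → ≡.trans (*-distribˡ-∑ᴸ (β a) _ vs)
             (∑ᴸ-cong (λ v → x∙yz≈y∙xz (β a) ⟦ weightFrom s (a ∷ v) ℕ.≟ d ⟧ (termFrom (suc s) v)) vs)) ⟩
      sumTo (suc b) (λ a → ∑ᴸ (λ v → ⟦ weightFrom s (a ∷ v) ℕ.≟ d ⟧ * termFrom s (a ∷ v)) vs)
        ≡⟨ ∑ᴸ-product (λ v → ⟦ weightFrom s v ℕ.≟ d ⟧ * termFrom s v) _∷_ id (suc b) vs ⟨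
      ∑ᴸ (λ v → ⟦ weightFrom s v ℕ.≟ d ⟧ * termFrom s v) (boundedVectors b (suc n)) ∎
      where
      open ≡-Reasoning
      open CommutativeSemigroupProperties ℤ.*-commutativeSemigroup using (x∙yz≈y∙xz)
      β = signedBinomial (I (suc s))
      vs = boundedVectors b n

    eulerProduct-binomialSum : ∀ d → eulerProduct I d 0 d ≡ binomialSum I d
    eulerProduct-binomialSum d = begin
      eulerProduct I d 0 d
        ≡⟨ eulerProduct-expansion d 0 d d ℕ.≤-refl ⟩
      ∑ᴸ (λ v → ⟦ weightFrom 0 v ℕ.≟ d ⟧ * termFrom 0 v) (boundedVectors d d)
        ≡⟨ ∑ᴸ-cong (λ v → ≡.cong₂ _*_
             (≡.cong (λ w → ⟦ w ℕ.≟ d ⟧) (weightFrom-sum 0 v)) (termFrom-product 0 v)) (boundedVectors d d) ⟩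
      ∑ᴸ (λ v → ⟦ weight v ℕ.≟ d ⟧ * binomialTerm I v) (boundedVectors d d)
        ≡⟨ ∑ᴸ-filter (λ v → weight v ℕ.≟ d) (binomialTerm I) (boundedVectors d d) ⟨
      binomialSum I d ∎
      where open ≡-Reasoning

open FiniteSums

-- Sums of the Möbius function

open import Algebra.Properties.Semiring.Sum ℤ.+-*-semiring
  using (sum; sum-cong-≗; ∑-comm; ∑-distrib-+; *-distribˡ-sum; *-distribʳ-sum)

module MöbiusSums (R : RawRing c ℓ) (isSizedUFD : IsSizedUFD R) where
  open UniqueFactorization R isSizedUFD

  module OverRepresentatives
    (N : ℕ → ℕ) (rep : ∀ m → Fin (N m) → NonZero)
    (rep-size : ∀ {m} i → size (proj₁ (rep m i)) ≡ suc m)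
    (rep-injective : ∀ {m i j} → proj₁ (rep m i) ∥ proj₁ (rep m j) → i ≡ j)
    (rep-complete : ∀ {m x} → size x ≡ suc m → ∃[ i ] x ∥ proj₁ (rep m i))
    (μ : NonZero → ℤ) (isMöbius : IsMöbiusFunction μ) where

    open IsMöbiusFunction isMöbius

    private
      [_,_] : ∀ m → Fin (N m) → Carrier
      [ m , i ] = proj₁ (rep m i)

      rep≉0 : ∀ {m} i → [ m , i ] ≉ 0#
      rep≉0 i = proj₂ (rep _ i)

    rep-unique : ∀ {m x} → size x ≡ suc m → ∃!-Fin (λ i → x ∥ [ m , i ])
    rep-unique s≡ with rep-complete s≡
    ... | i , x∥i = i , x∥i , λ j x∥j → rep-injective (∥-trans (∥-sym x∥j) x∥i)

    size≡suc⇒≉0 : ∀ {x n} → size x ≡ suc n → x ≉ 0#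
    size≡suc⇒≉0 s≡ = size>0⇒≉0 (≡.subst (0 <_) (≡.sym s≡) (s≤s z≤n))

    size-*-suc : ∀ {x y a b} → size x ≡ suc a → size y ≡ suc b → size (x * y) ≡ suc (a ℕ.+ b)
    size-*-suc {a = a} {b} sx sy = ℕ.suc-injective (≡.trans (size-* (size≡suc⇒≉0 sx) (size≡suc⇒≉0 sy))
      (≡.trans (≡.cong₂ ℕ._+_ sx sy) (≡.cong suc (ℕ.+-suc a b))))

    quotient-size : ∀ {u x y a n} → x ≉ 0# → u * y ≈ x → size x ≡ suc n → size y ≡ suc a → size u ≡ suc (n ℕ.∸ a)
    quotient-size {u} {x} {y} {a} {n} x≉0 uy≈x sx sy with size u in su
    ... | zero  = ⊥-elim (x≉0 (trans (sym uy≈x) (trans (*-congʳ (size⁻¹-0 su)) (zeroˡ y))))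
    ... | suc b = ≡.cong suc (≡.sym (≡.trans (≡.cong (ℕ._∸ a) n≡) (ℕ.m+n∸n≡m b a)))
      where
      n≡ : n ≡ b ℕ.+ a
      n≡ = ℕ.suc-injective (≡.trans (≡.sym sx) (≡.trans (size-cong (sym uy≈x)) (size-*-suc su sy)))

    -- Together with `multiple-unique`: up to associates, multiplication by y is a bijection from
    -- the elements of degree m - a to the multiples of y of degree m.
    quotient-unique : ∀ {y m a} → size y ≡ suc a → a ≤ m → ∀ i → y ∣ [ m , i ] →
                      ∃!-Fin (λ j → [ m , i ] ∥ y * [ m ℕ.∸ a , j ])
    quotient-unique {y} {m} {a} sy a≤m i (u , uy≈i)
      with rep-unique (quotient-size (rep≉0 i) uy≈i (rep-size i) sy)
    ... | j , u∥j , unique = j , ∥-trans i∥yu (*-cong-∥ ∥-refl u∥j) ,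
      λ j′ i∥yj′ → unique j′ (∥-cancelˡ (size≡suc⇒≉0 sy) (∥-trans (∥-sym i∥yu) i∥yj′))
      where
      i∥yu : [ m , i ] ∥ y * u
      i∥yu = ∥-reflexive (trans (sym uy≈i) (*-comm u y))

    multiple-unique : ∀ {y m a} → size y ≡ suc a → a ≤ m → ∀ j →
                      ∃!-Fin (λ i → [ m , i ] ∥ y * [ m ℕ.∸ a , j ])
    multiple-unique {y} {m} {a} sy a≤m j
      with rep-unique (≡.trans (size-*-suc sy (rep-size j)) (≡.cong suc (ℕ.m+[n∸m]≡n a≤m)))
    ... | i , yj∥i , unique = i , ∥-sym yj∥i , λ i′ i′∥yj → unique i′ (∥-sym i′∥yj)

    ∣⇒size-≤ : ∀ {x y a b} → size x ≡ suc a → size y ≡ suc b → x ∣ y → a ≤ b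
    ∣⇒size-≤ sx sy x∣y = ℕ.s≤s⁻¹ (≡.subst₂ _≤_ sx sy (∣⇒size≤ (size≡suc⇒≉0 sy) x∣y))

    count-multiples : ∀ {y m a} → size y ≡ suc a → a ≤ m → sum (λ i → ⟦ y ∣? [ m , i ] ⟧) ≡ + N (m ℕ.∸ a)
    count-multiples {y} {m} {a} sy a≤m = ≡.trans
      (sum-correspondence (λ i j → [ m , i ] ∥? y * [ m ℕ.∸ a , j ])
        (λ i j i∥yj → ⟦⟧-true (y ∣? [ m , i ]) (∣ʳ-trans (x∣xy y _) (proj₂ i∥yj)))
        left (λ j → inj₂ (multiple-unique sy a≤m j)))
      (sum-ones (N (m ℕ.∸ a)))
      where
      left : ∀ i → ⟦ y ∣? [ m , i ] ⟧ ≡ 0ℤ ⊎ ∃!-Fin (λ j → [ m , i ] ∥ y * [ m ℕ.∸ a , j ])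
      left i with y ∣? [ m , i ]
      ... | yes y∣i = inj₂ (quotient-unique sy a≤m i y∣i)
      ... | no  _   = inj₁ ≡.refl

    restrictedSum : {X : Pred Carrier r} → Decidable X → ℕ → ℤ
    restrictedSum X? d = sum (λ i → ⟦ X? [ d , i ] ⟧ ℤ.* μ (rep d i))

    module _ {X : Pred Carrier r} (X? : Decidable X) where

      restrictedSum-cong : ∀ {r′} {Y : Pred Carrier r′} (Y? : Decidable Y) →
        (∀ x → X x → Y x) → (∀ x → Y x → X x) → ∀ d → restrictedSum X? d ≡ restrictedSum Y? d
      restrictedSum-cong Y? to from d = sum-cong-≗ λ i →
        ≡.cong (ℤ._* μ (rep d i)) (⟦⟧-cong (X? _) (Y? _) (to _) (from _))

      restrictedSum-empty : ∀ {d} → (∀ x → size x ≡ suc d → ¬ X x) → restrictedSum X? d ≡ 0ℤ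
      restrictedSum-empty ¬X = sum-zero λ i →
        ≡.cong (ℤ._* μ (rep _ i)) (⟦⟧-false (X? _) (¬X _ (rep-size i)))

      -- Degree 0 consists of a single class, that of the units, on which μ is 1.
      restrictedSum-units : (∀ x → x ∣ 1# → X x) → restrictedSum X? 0 ≡ 1ℤ
      restrictedSum-units X-units with rep-unique size-1
      ... | i , 1∥i , unique = ≡.trans (sum-cong-≗ λ j → one (1∥rep j))
        (sum-unique (λ j → 1# ∥? [ 0 , j ]) i 1∥i unique)
        where
        1∥rep : ∀ j → 1# ∥ [ 0 , j ]
        1∥rep j = ([ 0 , j ] , *-identityʳ _) , size-1⇒∣1 (rep-size j)
        one : ∀ {j} → 1# ∥ [ 0 , j ] → ⟦ X? [ 0 , j ] ⟧ ℤ.* μ (rep 0 j) ≡ ⟦ 1# ∥? [ 0 , j ] ⟧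
        one {j} 1∥j = ≡.trans (≡.cong₂ ℤ._*_ (⟦⟧-true (X? _) (X-units _ (proj₂ 1∥j))) (μ-unit (rep 0 j) (∥-sym 1∥j)))
          (≡.sym (⟦⟧-true (1# ∥? [ 0 , j ]) 1∥j))

      Coprime-to : Carrier → Pred Carrier _
      Coprime-to p x = X x × p ∤ x

      coprime-to? : ∀ p → Decidable (Coprime-to p)
      coprime-to? p x = X? x Dec.×-dec Dec.¬? (p ∣? x)

      -- Splitting the elements x of X by whether p ∣ x: if so, write x = p y;
      -- then μ x = - μ y if p ∤ y, and μ x = 0 if p ∣ y.
      restrictedSum-Δ : ∀ {p e} → Irreducible p → size p ≡ suc e → (∀ {x y} → x ∥ y → X x → X y) →
        (∀ {x} → p ∤ x → X x → X (p * x)) → (∀ {x} → p ∤ x → X (p * x) → X x) →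
        ∀ d → restrictedSum X? d ≡ Δ e (restrictedSum (coprime-to? p)) d
      restrictedSum-Δ {p} {e} irr sp X-resp X-* X-/ d = begin
        restrictedSum X? d
          ≡⟨ sum-cong-≗ (λ i → split i) ⟩
        sum (λ i → ⟦ coprime-to? p [ d , i ] ⟧ ℤ.* μ (rep d i) ℤ.+ multiples i)
          ≡⟨ ∑-distrib-+ (λ i → ⟦ coprime-to? p [ d , i ] ⟧ ℤ.* μ (rep d i)) multiples ⟩
        restrictedSum (coprime-to? p) d ℤ.+ sum multiples
          ≡⟨ ≡.cong (ℤ._+_ (restrictedSum (coprime-to? p) d)) sum-multiples ⟩
        restrictedSum (coprime-to? p) d ℤ.- shifted e (restrictedSum (coprime-to? p)) d  ∎
        where
        open ≡-Reasoning
        multiple? : Decidable (λ x → X x × p ∣ x)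
        multiple? x = X? x Dec.×-dec (p ∣? x)
        multiples : Fin (N d) → ℤ
        multiples i = ⟦ multiple? [ d , i ] ⟧ ℤ.* μ (rep d i)
        split : ∀ i → ⟦ X? [ d , i ] ⟧ ℤ.* μ (rep d i) ≡ ⟦ coprime-to? p [ d , i ] ⟧ ℤ.* μ (rep d i) ℤ.+ multiples i
        split i with X? [ d , i ] | p ∣? [ d , i ]
        ... | yes _ | yes _ = ≡.sym (ℤ.+-identityˡ _)
        ... | yes _ | no  _ = ≡.sym (ℤ.+-identityʳ _)
        ... | no  _ | yes _ = ≡.refl
        ... | no  _ | no  _ = ≡.refl
        sum-multiples : sum multiples ≡ ℤ.- shifted e (restrictedSum (coprime-to? p)) d
        sum-multiples with e ℕ.≤? d
        ... | no e≰d = ≡.trans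
          (sum-zero λ i → ≡.cong (ℤ._* μ (rep d i)) (⟦⟧-false (multiple? _) λ (_ , p∣i) → e≰d (∣⇒size-≤ sp (rep-size i) p∣i)))
          (≡.cong ℤ.-_ (≡.sym (shifted-< (restrictedSum (coprime-to? p)) (ℕ.≰⇒> e≰d))))
        ... | yes e≤d = begin
          sum multiples
            ≡⟨ sum-correspondence (λ i j → [ d , i ] ∥? p * [ d ℕ.∸ e , j ]) agree left
                 (λ j → inj₂ (multiple-unique sp e≤d j)) ⟩
          sum (λ j → ℤ.- (⟦ coprime-to? p [ d ℕ.∸ e , j ] ⟧ ℤ.* μ (rep (d ℕ.∸ e) j)))
            ≡⟨ sum-neg (λ j → ⟦ coprime-to? p [ d ℕ.∸ e , j ] ⟧ ℤ.* μ (rep (d ℕ.∸ e) j)) ⟩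
          ℤ.- restrictedSum (coprime-to? p) (d ℕ.∸ e)
            ≡⟨ ≡.cong ℤ.-_ (shifted-+ e (restrictedSum (coprime-to? p)) (d ℕ.∸ e)) ⟨
          ℤ.- shifted e (restrictedSum (coprime-to? p)) (e ℕ.+ (d ℕ.∸ e))
            ≡⟨ ≡.cong (λ d → ℤ.- shifted e (restrictedSum (coprime-to? p)) d) (ℕ.m+[n∸m]≡n e≤d) ⟩
          ℤ.- shifted e (restrictedSum (coprime-to? p)) d ∎
          where
          left : ∀ i → multiples i ≡ 0ℤ ⊎ ∃!-Fin (λ j → [ d , i ] ∥ p * [ d ℕ.∸ e , j ])
          left i with p ∣? [ d , i ]
          ... | yes p∣i = inj₂ (quotient-unique sp e≤d i p∣i)
          ... | no  p∤i = inj₁ (≡.cong (ℤ._* μ (rep d i)) (⟦⟧-false (X? [ d , i ] Dec.×-dec no p∤i) (p∤i ∘ proj₂)))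
          agree : ∀ i j → [ d , i ] ∥ p * [ d ℕ.∸ e , j ] →
                  multiples i ≡ ℤ.- (⟦ coprime-to? p [ d ℕ.∸ e , j ] ⟧ ℤ.* μ (rep (d ℕ.∸ e) j))
          agree i j i∥pj with p ∣? [ d ℕ.∸ e , j ]
          ... | yes p∣j = ≡.trans
            (≡.trans (≡.cong (ℤ._*_ ⟦ multiple? [ d , i ] ⟧) (μ-prime-∣ {x = rep _ j} {rep _ i} irr p∣j i∥pj)) (ℤ.*-zeroʳ ⟦ multiple? [ d , i ] ⟧))
            (≡.cong (λ x → ℤ.- (x ℤ.* μ (rep _ j))) (≡.sym (⟦⟧-false (X? [ d ℕ.∸ e , j ] Dec.×-dec Dec.¬? (yes p∣j)) λ (_ , p∤j) → p∤j p∣j)))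
          ... | no p∤j = ≡.trans
            (≡.cong₂ ℤ._*_ (⟦⟧-cong (multiple? [ d , i ]) (X? [ d ℕ.∸ e , j ] Dec.×-dec yes p∤j)
                (λ (Xi , _) → X-/ p∤j (X-resp i∥pj Xi) , p∤j)
                (λ (Xj , _) → X-resp (∥-sym i∥pj) (X-* p∤j Xj) , ∣ʳ-trans (x∣xy p _) (proj₂ i∥pj)))
              (μ-prime-* {x = rep _ j} {rep _ i} irr p∤j i∥pj))
            (≡.sym (ℤ.neg-distribʳ-* ⟦ X? [ d ℕ.∸ e , j ] Dec.×-dec yes p∤j ⟧ (μ (rep _ j))))

    irreducible-*-∣ : ∀ {p x y} → Irreducible p → p ∤ x → p ∣ y → x ∣ y → p * x ∣ y
    irreducible-*-∣ {p} {x} irr p∤x p∣y (u , ux≈y) with prime irr (∣ʳ-respʳ-≈ (sym ux≈y) p∣y)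
    ... | inj₁ p∣u = ∣ʳ-respʳ-≈ ux≈y (∙-cong-∣ p∣u ∣ʳ-refl)
    ... | inj₂ p∣x = ⊥-elim (p∤x p∣x)

    common-divisor? : ∀ x y → Decidable (λ h → h ∣ x × h ∣ y)
    common-divisor? x y h = (h ∣? x) Dec.×-dec (h ∣? y)

    irreducible-size : ∀ {p} → Irreducible p → size p ≡ suc (pred (size p))
    irreducible-size {p} irr = ≡.sym (ℕ.suc-pred (size p) {{ℕ.>-nonZero (≉0⇒size>0 (irreducible⇒≉0 irr))}})

    common-divisor-sum : ∀ {x y m n} (x≉0 : x ≉ 0#) → size x ≡ suc m → size y ≡ suc n →
      sumTo (suc (m ⊓ n)) (restrictedSum (common-divisor? x y)) ≡ ⟦ coprime? x≉0 y ⟧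
    common-divisor-sum {x} {y} {m} {n} x≉0 sx sy with coprime-or-common-prime {y = y} x≉0
    ... | inj₁ coprime = ≡.cong₂ ℤ._+_
      (restrictedSum-units (common-divisor? x y) λ h h∣1 → ∣ʳ-trans h∣1 (1∣ x) , ∣ʳ-trans h∣1 (1∣ y))
      (sumTo-zero (m ⊓ n) λ d → restrictedSum-empty (common-divisor? x y) {suc d} λ h sh h∣xy →
        ℕ.1+n≢0 (ℕ.suc-injective (≡.trans (≡.sym sh) (∣1⇒size≡1 (coprime h∣xy)))))
    ... | inj₂ (p , irr , p∣x , p∣y) = ≡.trans
      (sumTo-cong (suc (m ⊓ n)) λ d _ → restrictedSum-Δ (common-divisor? x y) irr (irreducible-size irr)
        (λ (_ , h′∣h) (h∣x , h∣y) → ∣ʳ-trans h′∣h h∣x , ∣ʳ-trans h′∣h h∣y)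
        (λ p∤h (h∣x , h∣y) → irreducible-*-∣ irr p∤h p∣x h∣x , irreducible-*-∣ irr p∤h p∣y h∣y)
        (λ {h} _ (ph∣x , ph∣y) → ∣ʳ-trans (x∣yx h p) ph∣x , ∣ʳ-trans (x∣yx h p) ph∣y) d)
      -- If h divides x and y but p ∤ h, then p h divides them too, so deg h + deg p ≤ m ⊓ n. This
      -- is the vanishing that makes the telescoping sum end in 0.
      (sumTo-Δ (pred (size p)) (suc (m ⊓ n)) λ d m⊓n<d+e →
        restrictedSum-empty (coprime-to? (common-divisor? x y) p) λ h sh ((h∣x , h∣y) , p∤h) →
          ℕ.<⇒≱ m⊓n<d+e (≡.subst (_≤ m ⊓ n) (ℕ.+-comm (pred (size p)) d) (ℕ.⊓-glb
            (∣⇒size-≤ (size-*-suc (irreducible-size irr) sh) sx (irreducible-*-∣ irr p∤h p∣x h∣x))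
            (∣⇒size-≤ (size-*-suc (irreducible-size irr) sh) sy (irreducible-*-∣ irr p∤h p∣y h∣y)))))

    -- Counting coprime pairs

    module _ {m n P : ℕ} (pair : Fin P → Carrier × Carrier)
      (pair-size : ∀ l → size (proj₁ (pair l)) ≡ suc m × size (proj₂ (pair l)) ≡ suc n)
      (pair-coprime : ∀ l → Coprime (proj₁ (pair l)) (proj₂ (pair l)))
      (pair-injective : ∀ {k l} → proj₁ (pair k) ∥ proj₁ (pair l) → proj₂ (pair k) ∥ proj₂ (pair l) → k ≡ l)
      (pair-complete : ∀ {x y} → size x ≡ suc m → size y ≡ suc n → Coprime x y →
                       ∃[ l ] (x ∥ proj₁ (pair l) × y ∥ proj₂ (pair l))) where

      private
        Represents : Fin P → Fin (N m) → Fin (N n) → Set _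
        Represents l i j = proj₁ (pair l) ∥ [ m , i ] × proj₂ (pair l) ∥ [ n , j ]

        represents? : ∀ l i j → Dec (Represents l i j)
        represents? l i j = (proj₁ (pair l) ∥? [ m , i ]) Dec.×-dec (proj₂ (pair l) ∥? [ n , j ])

      -- The coprime pairs come with an enumeration of their own, unrelated to those of degrees m
      -- and n. The three are compared by counting in two ways the triples (l , i , j) for which
      -- `Represents` holds.
      coprime-pairs-sum : + P ≡ sum (λ i → sum (λ j → ⟦ coprime? (rep≉0 i) [ n , j ] ⟧))
      coprime-pairs-sum = begin
        + P
          ≡⟨ sum-ones P ⟨
        sum {P} (λ l → 1ℤ)
          ≡⟨ sum-cong-≗ (λ l → represented l) ⟩
        sum (λ l → sum (λ i → sum (λ j → ⟦ represents? l i j ⟧)))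
          ≡⟨ ∑-comm (λ l i → sum (λ j → ⟦ represents? l i j ⟧)) ⟩
        sum (λ i → sum (λ l → sum (λ j → ⟦ represents? l i j ⟧)))
          ≡⟨ sum-cong-≗ (λ i → ∑-comm (λ l j → ⟦ represents? l i j ⟧)) ⟩
        sum (λ i → sum (λ j → sum (λ l → ⟦ represents? l i j ⟧)))
          ≡⟨ sum-cong-≗ (λ i → sum-cong-≗ λ j → representing i j) ⟩
        sum (λ i → sum (λ j → ⟦ coprime? (rep≉0 i) [ n , j ] ⟧))  ∎
        where
        open ≡-Reasoning
        represented : ∀ l → 1ℤ ≡ sum (λ i → sum (λ j → ⟦ represents? l i j ⟧))
        represented l with rep-unique (proj₁ (pair-size l)) | rep-unique (proj₂ (pair-size l))
        ... | i₀ , x∥i₀ , unique-i | j₀ , y∥j₀ , unique-j = ≡.sym (begin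
          sum (λ i → sum (λ j → ⟦ represents? l i j ⟧))
            ≡⟨ sum-cong-≗ (λ i → ≡.trans (sum-cong-≗ λ j → ⟦⟧-× (x ∥? [ m , i ]) (y ∥? [ n , j ]))
                 (≡.sym (*-distribˡ-sum ⟦ x ∥? [ m , i ] ⟧ (λ j → ⟦ y ∥? [ n , j ] ⟧)))) ⟩
          sum (λ i → ⟦ x ∥? [ m , i ] ⟧ ℤ.* sum (λ j → ⟦ y ∥? [ n , j ] ⟧))
            ≡⟨ *-distribʳ-sum (sum (λ j → ⟦ y ∥? [ n , j ] ⟧)) (λ i → ⟦ x ∥? [ m , i ] ⟧) ⟨
          sum (λ i → ⟦ x ∥? [ m , i ] ⟧) ℤ.* sum (λ j → ⟦ y ∥? [ n , j ] ⟧)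
            ≡⟨ ≡.cong₂ ℤ._*_ (sum-unique (λ i → x ∥? [ m , i ]) i₀ x∥i₀ unique-i)
                             (sum-unique (λ j → y ∥? [ n , j ]) j₀ y∥j₀ unique-j) ⟩
          1ℤ ∎)
          where
          x = proj₁ (pair l)
          y = proj₂ (pair l)
        representing : ∀ i j → sum (λ l → ⟦ represents? l i j ⟧) ≡ ⟦ coprime? (rep≉0 i) [ n , j ] ⟧
        representing i j with coprime? (rep≉0 i) [ n , j ]
        ... | yes coprime with pair-complete (rep-size i) (rep-size j) coprime
        ...   | l , x∥ , y∥ = sum-unique (λ l → represents? l i j) l (∥-sym x∥ , ∥-sym y∥)
          λ l′ (x′∥ , y′∥) → pair-injective (∥-trans x′∥ x∥) (∥-trans y′∥ y∥)
        representing i j | no ¬coprime = sum-zero λ l → ⟦⟧-false (represents? l i j) λ ((_ , i∣x) , (_ , j∣y)) →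
          ¬coprime λ (e∣i , e∣j) → pair-coprime l (∣ʳ-trans e∣i i∣x , ∣ʳ-trans e∣j j∣y)

      -- The indicator of coprimality is replaced by the sum of μ over common divisors, and the sum
      -- over the pairs is carried out first: a fixed h of degree d divides both entries of N (m -
      -- d) N (n - d) of them.
      coprime-pairs-count : + P ≡ sumTo (suc (m ⊓ n)) (λ d → + N (m ℕ.∸ d) ℤ.* + N (n ℕ.∸ d) ℤ.* sum (λ h → μ (rep d h)))
      coprime-pairs-count = begin
        + P
          ≡⟨ coprime-pairs-sum ⟩
        sum (λ i → sum (λ j → ⟦ coprime? (rep≉0 i) [ n , j ] ⟧))
          ≡⟨ sum-cong-≗ (λ i → sum-cong-≗ λ j → ≡.sym (common-divisor-sum (rep≉0 i) (rep-size i) (rep-size j))) ⟩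
        sum (λ i → sum (λ j → sumTo D λ d → restrictedSum (common-divisor? [ m , i ] [ n , j ]) d))
          ≡⟨ sum-cong-≗ (λ i → ∑-comm {N n} {D} λ j d → restrictedSum (common-divisor? [ m , i ] [ n , j ]) (toℕ d)) ⟩
        sum (λ i → sumTo D λ d → sum (λ j → restrictedSum (common-divisor? [ m , i ] [ n , j ]) d))
          ≡⟨ ∑-comm {N m} {D} (λ i d → sum (λ j → restrictedSum (common-divisor? [ m , i ] [ n , j ]) (toℕ d))) ⟩
        sumTo D (λ d → sum (λ i → sum (λ j → restrictedSum (common-divisor? [ m , i ] [ n , j ]) d)))
          ≡⟨ sumTo-cong D (λ d d<D → summand d (ℕ.s≤s⁻¹ d<D)) ⟩
        sumTo D (λ d → + N (m ℕ.∸ d) ℤ.* + N (n ℕ.∸ d) ℤ.* sum (λ h → μ (rep d h))) ∎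
        where
        open ≡-Reasoning
        D = suc (m ⊓ n)
        summand : ∀ d → d ≤ m ⊓ n →
          sum (λ i → sum (λ j → restrictedSum (common-divisor? [ m , i ] [ n , j ]) d)) ≡
          + N (m ℕ.∸ d) ℤ.* + N (n ℕ.∸ d) ℤ.* sum (λ h → μ (rep d h))
        summand d d≤ = begin
          sum (λ i → sum (λ j → sum (λ h → t i j h ℤ.* μ (rep d h))))
            ≡⟨ sum-cong-≗ (λ i → ∑-comm λ j h → t i j h ℤ.* μ (rep d h)) ⟩
          sum (λ i → sum (λ h → sum (λ j → t i j h ℤ.* μ (rep d h))))
            ≡⟨ ∑-comm (λ i h → sum (λ j → t i j h ℤ.* μ (rep d h))) ⟩
          sum (λ h → sum (λ i → sum (λ j → t i j h ℤ.* μ (rep d h))))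
            ≡⟨ sum-cong-≗ factorise ⟩
          sum (λ h → + N (m ℕ.∸ d) ℤ.* + N (n ℕ.∸ d) ℤ.* μ (rep d h))
            ≡⟨ *-distribˡ-sum (+ N (m ℕ.∸ d) ℤ.* + N (n ℕ.∸ d)) (λ h → μ (rep d h)) ⟨
          + N (m ℕ.∸ d) ℤ.* + N (n ℕ.∸ d) ℤ.* sum (λ h → μ (rep d h)) ∎
          where
          t : Fin (N m) → Fin (N n) → Fin (N d) → ℤ
          t i j h = ⟦ common-divisor? [ m , i ] [ n , j ] [ d , h ] ⟧
          factorise : ∀ h → sum (λ i → sum (λ j → t i j h ℤ.* μ (rep d h))) ≡
                            + N (m ℕ.∸ d) ℤ.* + N (n ℕ.∸ d) ℤ.* μ (rep d h)
          factorise h = begin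
            sum (λ i → sum (λ j → t i j h ℤ.* μₕ))
              ≡⟨ sum-cong-≗ (λ i → *-distribʳ-sum μₕ (λ j → t i j h)) ⟨
            sum (λ i → sum (λ j → t i j h) ℤ.* μₕ)
              ≡⟨ *-distribʳ-sum μₕ (λ i → sum (λ j → t i j h)) ⟨
            sum (λ i → sum (λ j → t i j h)) ℤ.* μₕ
              ≡⟨ ≡.cong (ℤ._* μₕ) (sum-cong-≗ λ i → ≡.trans
                   (sum-cong-≗ λ j → ⟦⟧-× ([ d , h ] ∣? [ m , i ]) ([ d , h ] ∣? [ n , j ]))
                   (≡.sym (*-distribˡ-sum ⟦ [ d , h ] ∣? [ m , i ] ⟧ (λ j → ⟦ [ d , h ] ∣? [ n , j ] ⟧)))) ⟩
            sum (λ i → ⟦ [ d , h ] ∣? [ m , i ] ⟧ ℤ.* sum (λ j → ⟦ [ d , h ] ∣? [ n , j ] ⟧)) ℤ.* μₕ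
              ≡⟨ ≡.cong (ℤ._* μₕ) (*-distribʳ-sum (sum (λ j → ⟦ [ d , h ] ∣? [ n , j ] ⟧)) (λ i → ⟦ [ d , h ] ∣? [ m , i ] ⟧)) ⟨
            sum (λ i → ⟦ [ d , h ] ∣? [ m , i ] ⟧) ℤ.* sum (λ j → ⟦ [ d , h ] ∣? [ n , j ] ⟧) ℤ.* μₕ
              ≡⟨ ≡.cong (ℤ._* μₕ) (≡.cong₂ ℤ._*_
                   (count-multiples (rep-size h) (ℕ.≤-trans d≤ (ℕ.m⊓n≤m m n)))
                   (count-multiples (rep-size h) (ℕ.≤-trans d≤ (ℕ.m⊓n≤n m n)))) ⟩
            + N (m ℕ.∸ d) ℤ.* + N (n ℕ.∸ d) ℤ.* μₕ ∎
            where μₕ = μ (rep d h)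

    -- The sieve

    Sieved : List Carrier → Pred Carrier _
    Sieved ps x = All (_∤ x) ps

    sieved? : ∀ ps → Decidable (Sieved ps)
    sieved? ps x = All.all? (λ p → Dec.¬? (p ∣? x)) ps

    degree : Carrier → ℕ
    degree p = pred (size p)

    sieve-step : ∀ {p ps} → Irreducible p → All Irreducible ps → All (λ q → ¬ (p ∥ q)) ps →
      ∀ d → restrictedSum (sieved? ps) d ≡ Δ (degree p) (restrictedSum (sieved? (p ∷ ps))) d
    sieve-step {p} {ps} irr irrs p∦ps d = ≡.trans
      (restrictedSum-Δ (sieved? ps) irr (irreducible-size irr)
        (λ x∥y → All.map (λ q∤x q∣y → q∤x (∣ʳ-trans q∣y (proj₂ x∥y))))
        -- A prime q that divides p x divides p or x; the first would make q an associate of p.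
        (λ _ sieved → All.zipWith (λ (q∤x , irr-q , p∦q) q∣px → Sum.[
            (λ q∣p → p∦q (∥-sym (irreducible-∣-irreducible irr-q irr q∣p))) , q∤x ]′ (prime irr-q q∣px))
          (sieved , All.zip (irrs , p∦ps)))
        (λ _ → All.map (λ q∤px q∣x → q∤px (∣ʳ-trans q∣x (x∣yx _ p)))) d)
      (Δ-cong (degree p) λ i _ → restrictedSum-cong (coprime-to? (sieved? ps) p) (sieved? (p ∷ ps))
        (λ { x (sieved , p∤x) → p∤x ∷ sieved }) (λ { x (p∤x ∷ sieved) → sieved , p∤x }) i)

    -- The primes in `qs` have been sieved out and those in `ps` are still to come; each one that
    -- moves across costs a factor 1 - t^(deg p). With `ps` empty, every non-unit of degree at most
    -- D has a prime factor in `qs`, so that only the units remain and the series is 1 up to degree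
    -- D.
    sieve : ∀ {D} ps qs → All Irreducible ps → All Irreducible qs → Distinct ps →
      All (λ p → All (λ q → ¬ (p ∥ q)) qs) ps →
      (∀ {p} → Irreducible p → size p ≤ suc D → Any (p ∥_) ps ⊎ Any (p ∥_) qs) →
      ∀ d → d ≤ D → restrictedSum (sieved? qs) d ≡ List.foldr (λ p → Δ (degree p)) δ ps d
    sieve [] qs irr-ps irr-qs dist ∦qs complete zero d≤D =
      restrictedSum-units (sieved? qs) λ x x∣1 → All.map (λ irr-q q∣x → p∤1 irr-q (∣ʳ-trans q∣x x∣1)) irr-qs
    sieve [] qs irr-ps irr-qs dist ∦qs complete (suc d) d≤D =
      restrictedSum-empty (sieved? qs) λ x sx sieved → avoid x sx sieved
      where
      avoid : ∀ x → size x ≡ suc (suc d) → ¬ Sieved qs x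
      avoid x sx sieved with irreducible-factor (size≡suc⇒≉0 sx) 
        (λ x∣1 → ℕ.1+n≢0 (ℕ.suc-injective (≡.trans (≡.sym sx) (∣1⇒size≡1 x∣1))))
      ... | p , irr , p∣x with complete irr (ℕ.≤-trans (∣⇒size≤ (size≡suc⇒≉0 sx) p∣x) (≡.subst (_≤ _) (≡.sym sx) (s≤s d≤D)))
      ...   | inj₂ p∈qs = All.All¬⇒¬Any sieved (Any.map (λ p∥q → ∣ʳ-trans (proj₂ p∥q) p∣x) p∈qs)
    sieve (p ∷ ps) qs (irr ∷ irr-ps) irr-qs (p∦ps ∷ dist) (p∦qs ∷ ∦qs) complete d d≤D = ≡.trans
      (sieve-step irr irr-qs p∦qs d)
      (Δ-cong (degree p) λ i i≤d → sieve ps (p ∷ qs) irr-ps (irr ∷ irr-qs) dist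
        (All.zipWith (λ (p∦r , r∦qs) → (p∦r ∘ ∥-sym) ∷ r∦qs) (p∦ps , ∦qs))
        (λ irr-r sr → move (complete irr-r sr)) i (ℕ.≤-trans i≤d d≤D))
      where
      move : ∀ {r} → Any (r ∥_) (p ∷ ps) ⊎ Any (r ∥_) qs → Any (r ∥_) ps ⊎ Any (r ∥_) (p ∷ qs)
      move (inj₁ (here r∥p))   = inj₂ (here r∥p)
      move (inj₁ (there r∈ps)) = inj₁ r∈ps
      move (inj₂ r∈qs)         = inj₂ (there r∈qs)

    module _ (I : ℕ → ℕ) (irr : ∀ j → Fin (I j) → Carrier)
      (irr-irreducible : ∀ {j} i → Irreducible (irr j i))
      (irr-size : ∀ {j} i → size (irr j i) ≡ suc j)
      (irr-injective : ∀ {j i i′} → irr j i ∥ irr j i′ → i ≡ i′)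
      (irr-complete : ∀ {j p} → Irreducible p → size p ≡ suc j → ∃[ i ] p ∥ irr j i) where

      -- Degrees s + 1 to s + n, in the order of the factors of `eulerProduct`. Degree 0 never
      -- occurs, as its elements are units.
      irreducibles : ℕ → ℕ → List Carrier
      irreducibles zero    s = []
      irreducibles (suc n) s = List.tabulate (irr (suc s)) List.++ irreducibles n (suc s)

      irreducibles-irreducible : ∀ n s → All Irreducible (irreducibles n s)
      irreducibles-irreducible zero    s = []
      irreducibles-irreducible (suc n) s = All.++⁺ (All.tabulate⁺ irr-irreducible) (irreducibles-irreducible n (suc s))

      irreducibles-size : ∀ n s → All (λ p → suc s < size p) (irreducibles n s)
      irreducibles-size zero    s = []
      irreducibles-size (suc n) s = All.++⁺ (All.tabulate⁺ λ i → ℕ.≤-reflexive (≡.sym (irr-size i)))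
        (All.map ℕ.<⇒≤ (irreducibles-size n (suc s)))

      irreducibles-distinct : ∀ n s → Distinct (irreducibles n s)
      irreducibles-distinct zero    s = []
      irreducibles-distinct (suc n) s = AllPairs.++⁺
        (AllPairs.tabulate⁺ λ i≢j i∥j → i≢j (irr-injective i∥j))
        (irreducibles-distinct n (suc s))
        (All.tabulate⁺ λ i → All.map (λ s< i∥q → ℕ.<⇒≢ s< (≡.trans (≡.sym (irr-size i))
          (∥⇒size≡ (irreducible⇒≉0 (irr-irreducible i)) i∥q))) (irreducibles-size n (suc s)))

      irreducibles-complete : ∀ n s {p j} → Irreducible p → size p ≡ suc j → s < j → j ≤ s ℕ.+ n →
                              Any (p ∥_) (irreducibles n s)
      irreducibles-complete zero    s irr-p sp s<j j≤ = ⊥-elim (ℕ.<⇒≱ s<j (≡.subst (_ ≤_) (ℕ.+-identityʳ s) j≤))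
      irreducibles-complete (suc n) s {j = j} irr-p sp s<j j≤ with suc s ℕ.≟ j
      ... | no  s≢j    = Any.++⁺ʳ _ (irreducibles-complete n (suc s) irr-p sp (ℕ.≤∧≢⇒< s<j s≢j) (≡.subst (j ≤_) (ℕ.+-suc s n) j≤))
      ... | yes ≡.refl with irr-complete irr-p sp
      ...   | i , p∥i = Any.++⁺ˡ (Any.tabulate⁺ i p∥i)

      foldr-irreducibles : ∀ n s → List.foldr (λ p → Δ (degree p)) δ (irreducibles n s) ≡ eulerProduct I n s
      foldr-irreducibles zero    s = ≡.refl
      foldr-irreducibles (suc n) s = ≡.trans
        (List.foldr-++ (λ p → Δ (degree p)) δ (List.tabulate (irr (suc s))) (irreducibles n (suc s)))
        (≡.trans (same-degree (irr (suc s)) (λ i → ≡.cong pred (irr-size i)))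
          (≡.cong (Δ^ (I (suc s)) (suc s)) (foldr-irreducibles n (suc s))))
        where
        same-degree : ∀ {k e F} (p : Fin k → Carrier) → (∀ i → degree (p i) ≡ e) →
                      List.foldr (λ p → Δ (degree p)) F (List.tabulate p) ≡ Δ^ k e F
        same-degree {zero}  p eq = ≡.refl
        same-degree {suc k} p eq = ≡.cong₂ Δ (eq Fin.zero) (same-degree (p ∘ Fin.suc) (eq ∘ Fin.suc))

      möbius-sum : ∀ d → sum (λ h → μ (rep d h)) ≡ eulerProduct I d 0 d
      möbius-sum d = begin
        sum (λ h → μ (rep d h))
          ≡⟨ sum-cong-≗ (λ h → ℤ.*-identityˡ (μ (rep d h))) ⟨
        restrictedSum (sieved? []) d
          ≡⟨ sieve (irreducibles d 0) [] (irreducibles-irreducible d 0) []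
               (irreducibles-distinct d 0) (All.universal (λ _ → []) _) complete d ℕ.≤-refl ⟩
        List.foldr (λ p → Δ (degree p)) δ (irreducibles d 0) d
          ≡⟨ ≡.cong (λ F → F d) (foldr-irreducibles d 0) ⟩
        eulerProduct I d 0 d ∎
        where
        open ≡-Reasoning
        complete : ∀ {p} → Irreducible p → size p ≤ suc d → Any (p ∥_) (irreducibles d 0) ⊎ Any (p ∥_) []
        complete {p} irr-p sp = inj₁ (irreducibles-complete d 0 irr-p (irreducible-size irr-p)
          -- An irreducible element is no unit, so its degree is at least 1.
          (ℕ.s≤s⁻¹ (≡.subst (1 <_) (irreducible-size irr-p) (∤1⇒size>1 (irreducible⇒≉0 irr-p) (p∤1 irr-p))))
          (ℕ.s≤s⁻¹ (≡.subst (_≤ suc d) (irreducible-size irr-p) sp)))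

-- The counting functions

open import Data.Integer.Base using (_*_)
open import Data.Integer.Properties using (+-*-semiring)

module _ (F : HeytingField c ℓ₁ ℓ₂) {q : ℕ} (card : HasCardinality (HeytingField.setoid F) q) (k : ℕ) where
  open Link F card k
  open Polynomials F k hiding (_∣_; Irreducible)
  private
    module P = UniqueFactorization Poly isSizedUFD
  open P using (size; _∥_; Irreducible)

  normalized : ∀ {m f} → size f ≡ suc m → Setoid.Carrier (𝒩 m)
  normalized {m} {f} s≡ =
    (f , P.size>0⇒≉0 (≡.subst (1 ≤_) (≡.sym s≡) (s≤s z≤n))) , size⇒totalDegree s≡

  normalized-size : ∀ {m} (h : Setoid.Carrier (𝒩 m)) → size (polynomial h) ≡ suc m
  normalized-size (_ , deg) = totalDegree⇒size deg

  _∼?_ : (f g : NormalizedPoly) → Dec (proj₁ f ∼ proj₁ g)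
  (f , f≉0) ∼? (g , _) = Dec.map′ (∥⇒∼ f≉0) ∼⇒∥ (f P.∥? g)

  𝒩-enumeration : ∀ m → Enumeration (𝒩 m)
  𝒩-enumeration m = List.map (λ (_ , s≡) → normalized s≡) (select P.setoid size? (proj₁ (P.finite (suc m)))) ,
    λ h → Any.map⁺ (Any.map (λ f≈g → ∥⇒∼ (proj₂ (proj₁ h)) (P.∥-reflexive f≈g))
      (select-complete P.setoid size? (λ f≈g s≡ → ≡.trans (≡.sym (P.size-cong f≈g)) s≡) (normalized-size h)
        (proj₂ (P.finite (suc m)) (polynomial h) (ℕ.≤-reflexive (normalized-size h)))))
    where
    size? : ∀ f → Dec (size f ≡ suc m)
    size? f = size f ℕ.≟ suc m

  irreducibles-enumeration : ∀ m → Enumeration (Irreducibles m)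
  irreducibles-enumeration m = restrict (𝒩 m) (λ h → P.irreducible? (polynomial h))
    (λ f∼g → P.irreducible-respects-∥ (∼⇒∥ f∼g)) (𝒩-enumeration m)

  isGCD⇒coprime : ∀ {f g} → IsGCD f g P.1# → P.Coprime f g
  isGCD⇒coprime = IsGCD.greatest

  coprime⇒isGCD : ∀ {f g} → P.Coprime f g → IsGCD f g P.1#
  coprime⇒isGCD {f} {g} coprime = record
    { commonDivisor = (P.1∣ f) , (P.1∣ g)
    ; greatest      = coprime
    }

  isGCD-resp-∥ : ∀ {f f′ g g′} → f ∥ f′ → g ∥ g′ → IsGCD f g P.1# → IsGCD f′ g′ P.1#
  isGCD-resp-∥ (_ , f′∣f) (_ , g′∣g) gcd = coprime⇒isGCD λ (e∣f′ , e∣g′) →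
    isGCD⇒coprime gcd (P.∣ʳ-trans e∣f′ f′∣f , P.∣ʳ-trans e∣g′ g′∣g)

  coprimePairs-enumeration : ∀ m n → Enumeration (CoprimePairs m n)
  coprimePairs-enumeration m n = restrict (𝒩 m ×ₛ 𝒩 n)
    (λ (f , g) → Dec.map′ coprime⇒isGCD isGCD⇒coprime (P.coprime? (proj₂ (proj₁ f)) (polynomial g)))
    (λ (f∼f′ , g∼g′) → isGCD-resp-∥ (∼⇒∥ f∼f′) (∼⇒∥ g∼g′))
    (product-enumeration {S = 𝒩 m} {𝒩 n} (𝒩-enumeration m) (𝒩-enumeration n))

  distinct⇒≁ : ∀ {ps} → P.Distinct ps → AllPairs (λ p r → ¬ (p ∼ r)) ps
  distinct⇒≁ = AllPairs.map (λ p∦r → p∦r ∘ ∼⇒∥)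

  ≁⇒distinct : ∀ {ps} → All Irreducible ps → AllPairs (λ p r → ¬ (p ∼ r)) ps → P.Distinct ps
  ≁⇒distinct []           []           = []
  ≁⇒distinct (irr ∷ irrs) (p≁ps ∷ ≁s) =
    All.map (λ p≁r → p≁r ∘ ∥⇒∼ (P.irreducible⇒≉0 irr)) p≁ps ∷ ≁⇒distinct irrs ≁s

  isMöbius⇒ : ∀ {μ} → IsMöbius μ → P.IsMöbiusFunction μ
  isMöbius⇒ isM = record
    { squarefree = λ h {ps} irrs dist h∥ps → squarefree h ps irrs (distinct⇒≁ dist) (∥⇒∼ (proj₂ h) h∥ps)
    ; squareful  = λ h (p , irr , p²∣h) → square h p irr p²∣h
    }
    where open IsMöbius isM

  isMöbius⇐ : ∀ {μ} → P.IsMöbiusFunction μ → IsMöbius μ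
  isMöbius⇐ isM = record
    { squarefree = λ h ps irrs ≁s h∼ps → squarefree h irrs (≁⇒distinct irrs ≁s) (∼⇒∥ h∼ps)
    ; square     = λ h p irr p²∣h → squareful h (p , irr , p²∣h)
    }
    where open P.IsMöbiusFunction isM

  counting : Counting
  counting = record
    { N = λ m → proj₁ (𝒩-cardinality m)
    ; I = λ m → proj₁ (irreducibles-cardinality m)
    ; P = λ m n → proj₁ (coprimePairs-cardinality m n)
    ; μ = record { to = P.möbius ; cong = λ {f} {g} f∼g → μ-cong {f} {g} (∼⇒∥ f∼g) }
    ; N-counts   = λ m → proj₂ (𝒩-cardinality m)
    ; I-counts   = λ m → proj₂ (irreducibles-cardinality m)
    ; P-counts   = λ m n → proj₂ (coprimePairs-cardinality m n)
    ; μ-isMöbius = isMöbius⇐ P.möbius-isMöbius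
    }
    where
    open P.IsMöbiusFunction P.möbius-isMöbius using (μ-cong)
    𝒩-cardinality : ∀ m → ∃[ n ] HasCardinality (𝒩 m) n
    𝒩-cardinality m = cardinality (𝒩 m) (λ f g → proj₁ f ∼? proj₁ g) (𝒩-enumeration m)
    irreducibles-cardinality : ∀ m → ∃[ n ] HasCardinality (Irreducibles m) n
    irreducibles-cardinality m = cardinality (Irreducibles m)
      (λ f g → proj₁ (proj₁ f) ∼? proj₁ (proj₁ g)) (irreducibles-enumeration m)
    coprimePairs-cardinality : ∀ m n → ∃[ l ] HasCardinality (CoprimePairs m n) l
    coprimePairs-cardinality m n = cardinality (CoprimePairs m n)
      (λ ((f , g) , _) ((f′ , g′) , _) → (proj₁ f ∼? proj₁ f′) Dec.×-dec (proj₁ g ∼? proj₁ g′))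
      (coprimePairs-enumeration m n)

  module _ (C : Counting) where
    open Counting C
    private
      to-injective : ∀ {a b} {S : Setoid a b} {n} (count : HasCardinality S n) {i j} →
                     Setoid._≈_ S (Inverse.to count i) (Inverse.to count j) → i ≡ j
      to-injective count {i} {j} eq = ≡.trans (≡.sym (Inverse.strictlyInverseʳ count i))
        (≡.trans (Inverse.from-cong count eq) (Inverse.strictlyInverseʳ count j))

      to-surjective : ∀ {a b} {S : Setoid a b} {n} (count : HasCardinality S n) x →
                      ∃[ i ] Setoid._≈_ S x (Inverse.to count i)
      to-surjective {S = S} count x = Inverse.from count x , Setoid.sym S (Inverse.strictlyInverseˡ count x)

      rep : ∀ m → Fin (N m) → NormalizedPoly
      rep m i = proj₁ (Inverse.to (N-counts m) i)

      rep-size : ∀ {m} i → size (proj₁ (rep m i)) ≡ suc m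
      rep-size {m} i = normalized-size (Inverse.to (N-counts m) i)

      rep-injective : ∀ {m i j} → proj₁ (rep m i) ∥ proj₁ (rep m j) → i ≡ j
      rep-injective {m} {i} i∥j = to-injective (N-counts m) (∥⇒∼ (proj₂ (rep m i)) i∥j)

      rep-complete : ∀ {m f} → size f ≡ suc m → ∃[ i ] f ∥ proj₁ (rep m i)
      rep-complete {m} s≡ with to-surjective (N-counts m) (normalized s≡)
      ... | i , f∼i = i , ∼⇒∥ f∼i

      open MöbiusSums.OverRepresentatives Poly isSizedUFD N rep rep-size rep-injective rep-complete (Func.to μ) (isMöbius⇒ μ-isMöbius)

      pair : ∀ m n → Fin (P m n) → Setoid.Carrier (CoprimePairs m n)
      pair m n = Inverse.to (P-counts m n)

      irr : ∀ m → Fin (I m) → Setoid.Carrier (Irreducibles m)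
      irr m = Inverse.to (I-counts m)

    P-formula : ∀ m n → + P m n ≡ sum⁺-syntax +-*-semiring (m ⊓ n)
                  (λ d → + N (m ∸ toℕ d) * + N (n ∸ toℕ d) * A (toℕ d))
    P-formula m n = coprime-pairs-count
      (λ l → let ((f , g) , _) = pair m n l in polynomial f , polynomial g)
      (λ l → let ((f , g) , _) = pair m n l in normalized-size f , normalized-size g)
      (λ l → isGCD⇒coprime (proj₂ (pair m n l)))
      (λ {l} f∥f′ g∥g′ → let ((f , g) , _) = pair m n l in
        to-injective (P-counts m n) (∥⇒∼ (proj₂ (proj₁ f)) f∥f′ , ∥⇒∼ (proj₂ (proj₁ g)) g∥g′))
      (λ sf sg coprime → let (l , f∼ , g∼) = to-surjective (P-counts m n) ((normalized sf , normalized sg) , coprime⇒isGCD coprime)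
        in l , ∼⇒∥ f∼ , ∼⇒∥ g∼)

    A-formula : ∀ d → A d ≡ binomialSum I d
    A-formula d = ≡.trans
      (möbius-sum I (λ j i → polynomial (proj₁ (irr j i)))
        (λ {j} i → proj₂ (irr j i))
        (λ {j} i → normalized-size (proj₁ (irr j i)))
        (λ {j} {i} i∥i′ → to-injective (I-counts j) (∥⇒∼ (proj₂ (proj₁ (proj₁ (irr j i)))) i∥i′))
        (λ {j} irr-p sp → let (i , p∼) = to-surjective (I-counts j) (normalized sp , irr-p) in i , ∼⇒∥ p∼)
        d)
      (eulerProduct-binomialSum I d)

mainTheorem9 : ∀ {c ℓ₁ ℓ₂} (q : ℕ) → IsPrimePower q →
    (F : HeytingField c ℓ₁ ℓ₂) → HasCardinality (HeytingField.setoid F) q →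
    (k : ℕ) → 1 ≤ k →
    Polynomials.Counting F k ×
    ((C : Polynomials.Counting F k) →
      let open Polynomials.Counting C in
      (∀ m n →
        + P m n ≡
          sum⁺-syntax +-*-semiring (m ⊓ n)
            (λ d → + N (m ∸ toℕ d) * + N (n ∸ toℕ d) * A (toℕ d))) ×
      (∀ d → A d ≡ binomialSum I d))
mainTheorem9 q _ F card k _ = counting F card k , λ C → P-formula F card k C , A-formula F card k C
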